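{- Let $H$ be a bipartite graph containing a subgraph $K$ isomorphic to the complete bipartite graph $K_{s,t}$ (for some $s,t\ge 1$), and assume that each vertex $v\in V(H)$ is adjacent to a vertex of $V(K)$. Let $F$ be a graph with chromatic number $3$ that has a color-critical edge. Then $H$ is weakly $F$-Tur\'an-good, i.e., there is $n_0$ such that for every $n\ge n_0$ there is a complete bipartite graph $T$ on $n$ vertices with $\mathrm{ex}(n,H,F)=\mathcal{N}(H,T)$.
   Context: All graphs are finite and simple. For graphs $H,G$, $\mathcal{N}(H,G)$ denotes the number of subgraphs of $G$ isomorphic to $H$ (copies of $H$ in $G$). For graphs $H,F$, $\mathrm{ex}(n,H,F)$ denotes the maximum of $\mathcal{N}(H,G)$ over all $n$-vertex graphs $G$ containing no subgraph isomorphic to $F$ ($F$-free graphs). An edge of $F$ is color-critical if deleting it decreases the chromatic number of $F$. Given $F$ with $\chi(F)=r+1$, a graph $H$ is called weakly $F$-Tur\'an-good if for all sufficiently large $n$, $\mathrm{ex}(n,H,F)=\mathcal{N}(H,T)$ for some complete $r$-partite $n$-vertex graph $T$. -}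

module Defs where

open import Data.Nat using (ℕ; _+_; _≤_; _<_; _<ᵇ_)
open import Data.Bool using (Bool; true; false; _xor_; _∧_; not; _∨_)
open import Data.Fin using (Fin; toℕ)
open import Data.Fin.Properties using (_≟_)
open import Data.Vec using (Vec; lookup)
open import Data.List using (List; length)
open import Data.List.Relation.Unary.All using (All)
open import Data.List.Relation.Unary.Unique.Propositional using (Unique)
open import Data.List.Membership.Propositional using (_∈_)
open import Data.Product using (Σ; ∃; _×_; _,_; proj₁; proj₂)
open import Relation.Binary.PropositionalEquality using (_≡_; _≢_)
open import Relation.Nullary using (¬_)
open import Relation.Nullary.Decidable using (⌊_⌋)
open import Function.Definitions using (Injective)

Graph : ℕ → Set
Graph n = Fin n → Fin n → Bool

IsSimple : ∀ {n} → Graph n → Set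
IsSimple {n} G = (∀ (i j : Fin n) → G i j ≡ G j i) × (∀ (i : Fin n) → G i i ≡ false)

Kab : (a b : ℕ) → Graph (a + b)
Kab a b i j = (toℕ i <ᵇ a) xor (toℕ j <ᵇ a)

deleteEdge : ∀ {n} → Graph n → Fin n → Fin n → Graph n
deleteEdge G u v i j =
  G i j ∧ not ((⌊ i ≟ u ⌋ ∧ ⌊ j ≟ v ⌋) ∨ (⌊ i ≟ v ⌋ ∧ ⌊ j ≟ u ⌋))

Colorable : ∀ {n} → Graph n → ℕ → Set
Colorable {n} G k = Σ (Fin n → Fin k) λ c → ∀ i j → G i j ≡ true → c i ≢ c j

ChromaticNumber : ∀ {n} → Graph n → ℕ → Set
ChromaticNumber G k = Colorable G k × (∀ j → Colorable G j → k ≤ j)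

HasColorCriticalEdge : ∀ {n} → Graph n → Set
HasColorCriticalEdge {n} G =
  Σ (Fin n) λ u → Σ (Fin n) λ v → G u v ≡ true ×
    Σ ℕ λ k → Σ ℕ λ j → ChromaticNumber G k × ChromaticNumber (deleteEdge G u v) j × j < k

-- A (candidate) subgraph of a graph on Fin n: a vertex set and an edge set (adjacency matrix).
SubgraphData : ℕ → Set
SubgraphData n = Vec Bool n × Vec (Vec Bool n) n

inV : ∀ {n} → SubgraphData n → Fin n → Bool
inV S v = lookup (proj₁ S) v

inE : ∀ {n} → SubgraphData n → Fin n → Fin n → Bool
inE S i j = lookup (lookup (proj₂ S) i) j

IsSubgraph : ∀ {n} → Graph n → SubgraphData n → Set
IsSubgraph {n} G S =
  (∀ (i j : Fin n) → inE S i j ≡ inE S j i) ×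
  (∀ (i j : Fin n) → inE S i j ≡ true → inV S i ≡ true × inV S j ≡ true × G i j ≡ true)

IsoTo : ∀ {h n} → Graph h → SubgraphData n → Set
IsoTo {h} {n} H S =
  Σ (Fin h → Fin n) λ f →
    Injective _≡_ _≡_ f ×
    (∀ i → inV S (f i) ≡ true) ×
    (∀ v → inV S v ≡ true → ∃ λ i → f i ≡ v) ×
    (∀ i j → H i j ≡ inE S (f i) (f j))

IsCopy : ∀ {h n} → Graph h → Graph n → SubgraphData n → Set
IsCopy H G S = IsSubgraph G S × IsoTo H S

HasCount : {A : Set} → (A → Set) → ℕ → Set
HasCount {A} P k =
  Σ (List A) λ L → Unique L × All P L × (∀ a → P a → a ∈ L) × length L ≡ k

NumCopies : ∀ {h n} → Graph h → Graph n → ℕ → Set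
NumCopies H G k = HasCount (IsCopy H G) k

Free : ∀ {f n} → Graph f → Graph n → Set
Free F G = ¬ (Σ _ λ S → IsCopy F G S)

IsEx : ∀ {h f} → ℕ → Graph h → Graph f → ℕ → Set
IsEx n H F m =
  (Σ (Graph n) λ G → IsSimple G × Free F G × NumCopies H G m) ×
  (∀ (G : Graph n) → IsSimple G → Free F G → ∀ k → NumCopies H G k → k ≤ m)

{-# OPTIONS --safe #-}
module Submission where

open import Defs
open import Data.Nat using (ℕ; zero; suc; pred; _+_; _*_; _^_; _∸_; _≤_; _<_; z≤n; s≤s; _<ᵇ_; _≤?_; _⊓_; _⊔_; ⌊_/2⌋; ⌈_/2⌉; >-nonZero; _!)
open import Data.Nat.Properties hiding (_≟_; suc-injective)
open import Data.Nat.Divisibility using (m≤n⇒m!∣n!; ∣-trans; m∣m*n)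
open import Data.Nat.DivMod using (_/_; m*[n/m]≡n)
import Data.Nat.ListAction as ListAction
open import Data.Nat.Tactic.RingSolver using (solve-∀)
import Data.Bool as Bool
open import Data.Bool using (Bool; true; false; _∧_; not; _xor_; if_then_else_)
open import Data.Bool.Properties using (not-involutive; xor-comm; xor-same; ∧-comm; ∧-assoc; ¬-not; not-¬)
import Data.Fin as Fin
open import Data.Fin using (Fin; zero; suc; toℕ)
import Data.Fin.Properties as Fin
open import Data.Fin.Properties using (_≟_; all?; any?; suc-injective)
import Data.Vec as Vec
open import Data.Vec using (Vec; []; _∷_; lookup; tabulate)
import Data.Vec.Properties as Vec
open import Data.Vec.Properties using (lookup∘tabulate)
import Data.List as List
open import Data.List using (List; []; _∷_; length; allFin; cartesianProductWith; filter; deduplicate)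
open import Data.List.Relation.Unary.All using (All; []; _∷_)
import Data.List.Relation.Unary.All as All
open import Data.List.Relation.Unary.Any using (here; there)
open import Data.List.Relation.Unary.AllPairs using ([]; _∷_)
open import Data.List.Relation.Unary.Unique.Propositional using (Unique)
import Data.List.Relation.Unary.Unique.DecPropositional.Properties as UniqueDec
open import Data.List.Membership.Propositional using (_∈_)
open import Data.List.Membership.Propositional.Properties
  using (∈-allFin; ∈-cartesianProductWith⁺; ∈-map⁺; ∈-map⁻; ∈-filter⁺; ∈-filter⁻; ∈-deduplicate⁺; ∈-deduplicate⁻)
open import Data.Product using (Σ; ∃; _×_; _,_; proj₁; proj₂)
import Data.Product.Properties as Product
open import Data.Sum using (_⊎_; inj₁; inj₂)
open import Data.Empty using (⊥; ⊥-elim)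
open import Relation.Nullary using (¬_; Dec; yes; no)
open import Relation.Nullary.Decidable using (⌊_⌋; _×-dec_; _→-dec_; ¬?)
open import Relation.Binary.PropositionalEquality using (_≡_; _≢_; refl; sym; trans; cong; cong₂; subst; subst₂; module ≡-Reasoning)
open import Function using (_∘_; id; case_of_)
open import Algebra.Properties.Semiring.Sum +-*-semiring
  using (sum; sum-cong-≗; *-distribˡ-sum; *-distribʳ-sum)
  renaming (∑-distrib-+ to sum-+; ∑-comm to sum-comm₂)
open import Algebra.Properties.CommutativeMonoid.Sum *-1-commutativeMonoid
  using () renaming (sum to prod; sum-cong-≗ to prod-cong; ∑-distrib-+ to prod-distrib-*)

-- In any graph, AM-GM applied to the vertices of H outside the dominating biclique bounds the number of
-- embeddings of H by the sum of d(v)^(p-1) d(u)^(q-1) over ordered edges uv, where p and q are the sizes of the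
-- colour classes of H.  Since the sum of 1/d(u) + 1/d(v) over the edges of any graph is at most n, and
-- d(u) + d(v) ≤ n when uv lies in no triangle, this sum is at most the maximum of x^p y^q + x^q y^p over
-- x + y = n, with a definite loss unless d(u) + d(v) is close to n for some edge uv.  An F-free graph has
-- few triangles at every vertex, because by Kővári–Sós–Turán the neighbourhoods contain few edges; so if G
-- has at least as many copies of H as every complete bipartite graph, then for some edge uv the
-- neighbourhoods of u and v nearly partition the vertex set and contain few edges.  Comparing embeddings
-- gained through edges inside the parts with those lost through missing edges across, almost all edges
-- across are present.  Moving the few exceptional vertices to the side where they have few neighbours
-- leaves inner edges only at vertices that miss many edges across, and the same comparison shows that the
-- complete bipartite graph has at least as many copies.

-- In the upper bound `F` enters only through `NoBook`: a critical edge places `F` inside a large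
-- complete bipartite graph with one edge added in a part, so every contradiction with freeness is
-- the construction of a book. The best part sizes need not be balanced and are never computed.
-- Instead `M` bounds the embeddings of `H` into all cuts, is finally taken to be their maximum, and
-- all estimates are relative to it. The polynomials in the degrees count homomorphisms rather than
-- embeddings; the difference has order `n ^ (h - 1)` and is absorbed, because the loss in the
-- absence of a good edge `uv` has order `n ^ h`.
--
-- No rationals occur. `n ≤ k * m` says that `m` is at least a `1 / k` fraction of `n`, reciprocals
-- of degrees have the denominator `n !`, other divisions are cleared by multiplying, and linear
-- steps are closed by `≤-by` from a ring identity with slack `s`. The constants are chosen in the
-- order `c₀`, `g`, `C`, `e`, `c`, `b`, `ℓ`, `K`, each from `H` and the earlier ones, and `n` is
-- large after all of them.

≤-by : ∀ {a b l r} s → l ≤ r → b + l ≡ a + r + s → a ≤ b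
≤-by {a} {b} {l} {r} s l≤r eq = +-cancelʳ-≤ l a b (begin
  a + l  ≤⟨ +-monoʳ-≤ a l≤r ⟩
  a + r  ≤⟨ m≤m+n (a + r) s ⟩
  a + r + s  ≡⟨ sym eq ⟩
  b + l  ∎)
  where open ≤-Reasoning

-- Indicators, counting, finite sums and products

𝟙 : Bool → ℕ
𝟙 true  = 1
𝟙 false = 0

# : ∀ {n} → (Fin n → Bool) → ℕ
# P = sum (λ x → 𝟙 (P x))

infix 4 _==_
_==_ : ∀ {n} → Fin n → Fin n → Bool
i == j = ⌊ i ≟ j ⌋

==-refl : ∀ {n} (i : Fin n) → (i == i) ≡ true
==-refl i with i ≟ i
... | yes _  = refl
... | no i≢i = ⊥-elim (i≢i refl)

==-sound : ∀ {n} {i j : Fin n} → (i == j) ≡ true → i ≡ j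
==-sound {i = i} {j} eq with i ≟ j
... | yes i≡j = i≡j

==-≢ : ∀ {n} {i j : Fin n} → i ≢ j → (i == j) ≡ false
==-≢ {i = i} {j} i≢j with i ≟ j
... | yes i≡j = ⊥-elim (i≢j i≡j)
... | no _    = refl

suc-== : ∀ {n} (a x : Fin n) → (suc a == suc x) ≡ (a == x)
suc-== a x with a ≟ x
... | yes _ = refl
... | no _  = refl

𝟙≤1 : ∀ b → 𝟙 b ≤ 1
𝟙≤1 true  = ≤-refl
𝟙≤1 false = z≤n

𝟙-mono : ∀ {a b} → (a ≡ true → b ≡ true) → 𝟙 a ≤ 𝟙 b
𝟙-mono {false} {b}     a⇒b = z≤n
𝟙-mono {true}  {true}  a⇒b = ≤-refl
𝟙-mono {true}  {false} a⇒b with () ← a⇒b refl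

𝟙-pos : ∀ {b} → 0 < 𝟙 b → b ≡ true
𝟙-pos {true} _ = refl

true⇒1≤𝟙 : ∀ {b} → b ≡ true → 1 ≤ 𝟙 b
true⇒1≤𝟙 refl = ≤-refl

∧-true : ∀ {a b} → a ∧ b ≡ true → a ≡ true × b ≡ true
∧-true {true} {true} _ = refl , refl

∧-intro : ∀ {a b} → a ≡ true → b ≡ true → a ∧ b ≡ true
∧-intro refl refl = refl

not-true : ∀ {a} → not a ≡ true → a ≡ false
not-true {false} _ = refl

⌊⌋-sound : ∀ {A : Set} (A? : Dec A) → ⌊ A? ⌋ ≡ true → A
⌊⌋-sound (yes a) _ = a

⌊⌋-complete : ∀ {A : Set} (A? : Dec A) → A → ⌊ A? ⌋ ≡ true
⌊⌋-complete (yes _) _ = refl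
⌊⌋-complete (no ¬a) a = ⊥-elim (¬a a)

⌊⌋-refute : ∀ {A : Set} (A? : Dec A) → ¬ A → ⌊ A? ⌋ ≡ false
⌊⌋-refute (yes a) ¬a = ⊥-elim (¬a a)
⌊⌋-refute (no _)  _  = refl

*-pos : ∀ {a b} → 0 < a * b → 0 < a × 0 < b
*-pos {suc a} {suc b} _ = s≤s z≤n , s≤s z≤n
*-pos {suc a} {zero} p with () ← subst (0 <_) (*-zeroʳ a) p

01-≤ : ∀ {a b} → a ≤ 1 → (0 < a → 1 ≤ b) → a ≤ b
01-≤ {zero}  _   _ = z≤n
01-≤ {suc a} a≤1 f = ≤-trans a≤1 (f (s≤s z≤n))

sum-mono : ∀ {n} {f g : Fin n → ℕ} → (∀ x → f x ≤ g x) → sum f ≤ sum g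
sum-mono {zero}  f≤g = z≤n
sum-mono {suc n} f≤g = +-mono-≤ (f≤g zero) (sum-mono (f≤g ∘ suc))

sum-const : ∀ n c → sum {n} (λ _ → c) ≡ n * c
sum-const zero    c = refl
sum-const (suc n) c = cong (c +_) (sum-const n c)

sum-zero : ∀ n → sum {n} (λ _ → 0) ≡ 0
sum-zero n = trans (sum-const n 0) (*-zeroʳ n)

sum-≤-const : ∀ {n c} {f : Fin n → ℕ} → (∀ x → f x ≤ c) → sum f ≤ n * c
sum-≤-const {n} {c} f≤c = ≤-trans (sum-mono f≤c) (≤-reflexive (sum-const n c))

term≤sum : ∀ {n} (f : Fin n → ℕ) x → f x ≤ sum f
term≤sum f zero    = m≤m+n (f zero) _
term≤sum f (suc x) = ≤-trans (term≤sum (f ∘ suc) x) (m≤n+m _ (f zero))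

sum-δ : ∀ {n} a (f : Fin n → ℕ) → sum (λ x → 𝟙 (a == x) * f x) ≡ f a
sum-δ {suc n} zero f = begin
  1 * f zero + sum {n} (λ _ → 0)  ≡⟨ cong₂ _+_ (*-identityˡ (f zero)) (sum-zero n) ⟩
  f zero + 0  ≡⟨ +-identityʳ _ ⟩
  f zero  ∎
  where open ≡-Reasoning
sum-δ {suc n} (suc a) f = trans (sum-cong-≗ (λ x → cong (λ b → 𝟙 b * f (suc x)) (suc-== a x))) (sum-δ a (f ∘ suc))

sum-δ₁ : ∀ {n} (a : Fin n) → sum (λ x → 𝟙 (a == x)) ≡ 1
sum-δ₁ a = trans (sum-cong-≗ (λ x → sym (*-identityʳ (𝟙 (a == x))))) (sum-δ a (λ _ → 1))

sum-pos : ∀ {n} (f : Fin n → ℕ) → 0 < sum f → ∃ λ x → 0 < f x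
sum-pos {suc n} f pos with f zero in eq
... | suc _ = zero , subst (0 <_) (sym eq) (s≤s z≤n)
... | zero  = let (x , fx) = sum-pos (f ∘ suc) pos in suc x , fx

sum-average : ∀ {n} c (f : Fin n → ℕ) → 0 < n → n * c ≤ sum f → ∃ λ x → c ≤ f x
sum-average {n} zero    f (s≤s z≤n) _ = zero , z≤n
sum-average {suc n} c@(suc _) f _ h with c ≤? f zero
... | yes c≤f = zero , c≤f
sum-average {suc zero} c@(suc _) f _ h | no c≰f =
  ⊥-elim (c≰f (subst₂ _≤_ (+-identityʳ c) (+-identityʳ (f zero)) h))
sum-average {suc (suc n)} c@(suc _) f _ h | no c≰f =
  let (x , r) = sum-average c (f ∘ suc) (s≤s z≤n)
                  (+-cancelˡ-≤ c _ _ (≤-trans h (+-monoˡ-≤ _ (<⇒≤ (≰⇒> c≰f)))))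
  in suc x , r

sum-*ˡ : ∀ {n} c (f : Fin n → ℕ) → sum (λ x → c * f x) ≡ c * sum f
sum-*ˡ c f = sym (*-distribˡ-sum c f)

sum-*ʳ : ∀ {n} c (f : Fin n → ℕ) → sum (λ x → f x * c) ≡ sum f * c
sum-*ʳ c f = sym (*-distribʳ-sum c f)

#-mono : ∀ {n} (P Q : Fin n → Bool) → (∀ x → P x ≡ true → Q x ≡ true) → # P ≤ # Q
#-mono P Q P⇒Q = sum-mono (λ x → 𝟙-mono (P⇒Q x))

#≤n : ∀ {n} (P : Fin n → Bool) → # P ≤ n
#≤n {n} P = ≤-trans (sum-≤-const (𝟙≤1 ∘ P)) (≤-reflexive (*-identityʳ n))

#-not : ∀ {n} (P : Fin n → Bool) → # P + # (not ∘ P) ≡ n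
#-not {n} P = begin
  # P + # (not ∘ P)  ≡⟨ sym (sum-+ (𝟙 ∘ P) (𝟙 ∘ not ∘ P)) ⟩
  sum (λ x → 𝟙 (P x) + 𝟙 (not (P x)))  ≡⟨ sum-cong-≗ (λ x → one (P x)) ⟩
  sum {n} (λ _ → 1)  ≡⟨ sum-const n 1 ⟩
  n * 1  ≡⟨ *-identityʳ n ⟩
  n  ∎
  where
  open ≡-Reasoning
  one : ∀ b → 𝟙 b + 𝟙 (not b) ≡ 1
  one true  = refl
  one false = refl

#-pos : ∀ {n} (P : Fin n → Bool) → 0 < # P → ∃ λ x → P x ≡ true
#-pos P pos = let (x , p) = sum-pos (𝟙 ∘ P) pos in x , 𝟙-pos p

prod-one : ∀ {n} (f : Fin n → ℕ) → (∀ x → f x ≡ 1) → prod f ≡ 1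
prod-one {zero}  f f≡1 = refl
prod-one {suc n} f f≡1 rewrite f≡1 zero = trans (+-identityʳ _) (prod-one (f ∘ suc) (f≡1 ∘ suc))

prod-pos : ∀ {n} (f : Fin n → ℕ) → 0 < prod f → ∀ x → 0 < f x
prod-pos f pos zero    = proj₁ (*-pos {f zero} pos)
prod-pos f pos (suc x) = prod-pos (f ∘ suc) (proj₂ (*-pos {f zero} pos)) x

prod-≤1 : ∀ {n} (f : Fin n → ℕ) → (∀ x → f x ≤ 1) → prod f ≤ 1
prod-≤1 {zero}  f f≤1 = ≤-refl
prod-≤1 {suc n} f f≤1 = *-mono-≤ (f≤1 zero) (prod-≤1 (f ∘ suc) (f≤1 ∘ suc))

prod-≥1 : ∀ {n} (f : Fin n → ℕ) → (∀ x → 1 ≤ f x) → 1 ≤ prod f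
prod-≥1 {zero}  f f≥1 = ≤-refl
prod-≥1 {suc n} f f≥1 = *-mono-≤ (f≥1 zero) (prod-≥1 (f ∘ suc) (f≥1 ∘ suc))

-- Sums over all maps Fin h → Fin n, the maps being represented by vectors so that equality is extensional.
∑V : ∀ {n} h → (Vec (Fin n) h → ℕ) → ℕ
∑V zero    φ = φ []
∑V (suc h) φ = sum λ x → ∑V h λ v → φ (x ∷ v)

∑V-mono : ∀ {n} h {φ ψ : Vec (Fin n) h → ℕ} → (∀ v → φ v ≤ ψ v) → ∑V h φ ≤ ∑V h ψ
∑V-mono zero    φ≤ψ = φ≤ψ []
∑V-mono (suc h) φ≤ψ = sum-mono λ x → ∑V-mono h λ v → φ≤ψ (x ∷ v)

∑V-cong : ∀ {n} h {φ ψ : Vec (Fin n) h → ℕ} → (∀ v → φ v ≡ ψ v) → ∑V h φ ≡ ∑V h ψ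
∑V-cong zero    φ≡ψ = φ≡ψ []
∑V-cong (suc h) φ≡ψ = sum-cong-≗ λ x → ∑V-cong h λ v → φ≡ψ (x ∷ v)

∑V-+ : ∀ {n} h (φ ψ : Vec (Fin n) h → ℕ) → ∑V h (λ v → φ v + ψ v) ≡ ∑V h φ + ∑V h ψ
∑V-+ zero    φ ψ = refl
∑V-+ (suc h) φ ψ = trans (sum-cong-≗ λ x → ∑V-+ h (φ ∘ (x ∷_)) (ψ ∘ (x ∷_)))
                         (sum-+ (λ x → ∑V h (φ ∘ (x ∷_))) (λ x → ∑V h (ψ ∘ (x ∷_))))

∑V-*ˡ : ∀ {n} h c (φ : Vec (Fin n) h → ℕ) → ∑V h (λ v → c * φ v) ≡ c * ∑V h φ
∑V-*ˡ zero    c φ = refl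
∑V-*ˡ (suc h) c φ = trans (sum-cong-≗ λ x → ∑V-*ˡ h c (φ ∘ (x ∷_))) (sum-*ˡ c (λ x → ∑V h (φ ∘ (x ∷_))))

∑V-sum : ∀ {n} h {m} (φ : Fin m → Vec (Fin n) h → ℕ) → ∑V h (λ v → sum λ i → φ i v) ≡ sum (λ i → ∑V h (φ i))
∑V-sum zero    φ = refl
∑V-sum (suc h) φ = trans (sum-cong-≗ λ x → ∑V-sum h (λ i → φ i ∘ (x ∷_)))
                         (sum-comm₂ (λ x i → ∑V h (φ i ∘ (x ∷_))))

∑V-comm : ∀ {n m} h k (φ : Vec (Fin n) h → Vec (Fin m) k → ℕ) →
          ∑V h (λ v → ∑V k (φ v)) ≡ ∑V k (λ w → ∑V h (λ v → φ v w))
∑V-comm h zero    φ = refl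
∑V-comm h (suc k) φ = trans (∑V-sum h (λ x v → ∑V k (φ v ∘ (x ∷_))))
                            (sum-cong-≗ λ x → ∑V-comm h k (λ v → φ v ∘ (x ∷_)))

-- Distributivity: the coordinates are chosen independently. With indicator weights this counts the
-- maps with prescribed sets of values.
∑V-prod : ∀ {n} h (w : Fin h → Fin n → ℕ) → ∑V h (λ v → prod λ l → w l (lookup v l)) ≡ prod (λ l → sum (w l))
∑V-prod zero    w = refl
∑V-prod {n} (suc h) w = begin
  sum (λ x → ∑V h (λ v → w zero x * prod (λ l → w (suc l) (lookup v l))))
    ≡⟨ sum-cong-≗ (λ x → trans (∑V-*ˡ h (w zero x) (λ v → prod (λ l → w (suc l) (lookup v l))))
                               (cong (w zero x *_) (∑V-prod h (w ∘ suc)))) ⟩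
  sum (λ x → w zero x * prod (λ l → sum (w (suc l))))
    ≡⟨ sum-*ʳ (prod (λ l → sum (w (suc l)))) (w zero) ⟩
  sum (w zero) * prod (λ l → sum (w (suc l)))  ∎
  where open ≡-Reasoning

∑V-const : ∀ {n} h c → ∑V {n} h (λ _ → c) ≡ n ^ h * c
∑V-const zero    c = sym (+-identityʳ c)
∑V-const {n} (suc h) c = begin
  sum {n} (λ _ → ∑V {n} h (λ _ → c))  ≡⟨ sum-const n (∑V {n} h (λ _ → c)) ⟩
  n * ∑V {n} h (λ _ → c)  ≡⟨ cong (n *_) (∑V-const {n} h c) ⟩
  n * (n ^ h * c)  ≡⟨ sym (*-assoc n (n ^ h) c) ⟩
  n * n ^ h * c  ∎
  where open ≡-Reasoning

-- Each value of coordinate `i` extends to `n ^ (h - 1)` vectors; the factor `n` on the left avoids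
-- a truncated exponent, as does `n * n` in `∑V-pair`.
∑V-single : ∀ {n} h (i : Fin h) (φ : Fin n → ℕ) → ∑V h (λ v → φ (lookup v i)) * n ≡ sum φ * n ^ h
∑V-single {n} (suc h) zero φ = begin
  sum (λ x → ∑V h (λ _ → φ x)) * n  ≡⟨ cong (_* n) (sum-cong-≗ λ x → ∑V-const h (φ x)) ⟩
  sum (λ x → n ^ h * φ x) * n  ≡⟨ cong (_* n) (sum-*ˡ (n ^ h) φ) ⟩
  n ^ h * sum φ * n  ≡⟨ ring (n ^ h) (sum φ) n ⟩
  sum φ * (n * n ^ h)  ∎
  where
  open ≡-Reasoning
  ring : ∀ a b c → a * b * c ≡ b * (c * a)
  ring = solve-∀
∑V-single {n} (suc h) (suc i) φ = begin
  sum (λ (_ : Fin n) → ∑V h (λ v → φ (lookup v i))) * n  ≡⟨ cong (_* n) (sum-const n _) ⟩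
  n * ∑V h (λ v → φ (lookup v i)) * n  ≡⟨ *-assoc n _ n ⟩
  n * (∑V h (λ v → φ (lookup v i)) * n)  ≡⟨ cong (n *_) (∑V-single h i φ) ⟩
  n * (sum φ * n ^ h)  ≡⟨ ring n (sum φ) (n ^ h) ⟩
  sum φ * (n * n ^ h)  ∎
  where
  open ≡-Reasoning
  ring : ∀ a b c → a * (b * c) ≡ b * (a * c)
  ring = solve-∀

∑V-pair : ∀ {n} h {i j : Fin h} → i ≢ j → (φ : Fin n → Fin n → ℕ) →
  ∑V h (λ v → φ (lookup v i) (lookup v j)) * (n * n) ≡ sum (λ x → sum (φ x)) * n ^ h
∑V-pair (suc h) {zero} {zero} i≢j φ = ⊥-elim (i≢j refl)
∑V-pair {n} (suc h) {zero} {suc j} _ φ = begin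
  sum (λ x → ∑V h (λ v → φ x (lookup v j))) * (n * n)  ≡⟨ sym (*-assoc (sum (λ x → ∑V h (λ v → φ x (lookup v j)))) n n) ⟩
  sum (λ x → ∑V h (λ v → φ x (lookup v j))) * n * n  ≡⟨ cong (_* n) (sym (sum-*ʳ n (λ x → ∑V h (λ v → φ x (lookup v j))))) ⟩
  sum (λ x → ∑V h (λ v → φ x (lookup v j)) * n) * n  ≡⟨ cong (_* n) (sum-cong-≗ λ x → ∑V-single h j (φ x)) ⟩
  sum (λ x → sum (φ x) * n ^ h) * n  ≡⟨ cong (_* n) (sum-*ʳ (n ^ h) (λ x → sum (φ x))) ⟩
  sum (λ x → sum (φ x)) * n ^ h * n  ≡⟨ ring (sum (λ x → sum (φ x))) (n ^ h) n ⟩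
  sum (λ x → sum (φ x)) * (n * n ^ h)  ∎
  where
  open ≡-Reasoning
  ring : ∀ a b c → a * b * c ≡ a * (c * b)
  ring = solve-∀
∑V-pair {n} (suc h) {suc i} {zero} _ φ =
  trans (∑V-pair (suc h) {zero} {suc i} (λ ()) (λ x y → φ y x)) (cong (_* (n * n ^ h)) (sum-comm₂ (λ x y → φ y x)))
∑V-pair {n} (suc h) {suc i} {suc j} i≢j φ = begin
  sum (λ (_ : Fin n) → ∑V h ψ) * (n * n)  ≡⟨ cong (_* (n * n)) (sum-const n (∑V h ψ)) ⟩
  n * ∑V h ψ * (n * n)  ≡⟨ *-assoc n (∑V h ψ) (n * n) ⟩
  n * (∑V h ψ * (n * n))  ≡⟨ cong (n *_) (∑V-pair h (i≢j ∘ cong suc) φ) ⟩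
  n * (sum (λ x → sum (φ x)) * n ^ h)  ≡⟨ ring n (sum (λ x → sum (φ x))) (n ^ h) ⟩
  sum (λ x → sum (φ x)) * (n * n ^ h)  ∎
  where
  open ≡-Reasoning
  ψ : Vec (Fin n) h → ℕ
  ψ v = φ (lookup v i) (lookup v j)
  ring : ∀ a b c → a * (b * c) ≡ b * (a * c)
  ring = solve-∀

-- Degrees, embeddings and their images

deg : ∀ {n} → Graph n → Fin n → ℕ
deg G x = # (G x)

codeg : ∀ {n} → Graph n → Fin n → Fin n → ℕ
codeg G x y = # (λ z → G x z ∧ G y z)

-- For simple `G` this is twice the number of edges in the neighbourhood of `x`, since the pairs
-- `y`, `z` are ordered.
tri : ∀ {n} → Graph n → Fin n → ℕ
tri G x = sum λ y → 𝟙 (G x y) * codeg G x y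

irreflexive : ∀ {n} {G : Graph n} → IsSimple G → ∀ {v} → G v v ≡ true → ⊥
irreflexive (_ , G-irr) {v} e with () ← trans (sym e) (G-irr v)

codeg-sym : ∀ {n} (G : Graph n) u v → codeg G u v ≡ codeg G v u
codeg-sym G u v = sum-cong-≗ λ z → cong 𝟙 (∧-comm (G u z) (G v z))

record IsHom {h n} (H : Graph h) (G : Graph n) (f : Fin h → Fin n) : Set where
  constructor mkHom
  field
    inj : ∀ i j → f i ≡ f j → i ≡ j
    hom : ∀ i j → H i j ≡ true → G (f i) (f j) ≡ true

image : ∀ {h n} → Graph h → (Fin h → Fin n) → SubgraphData n
image H f = tabulate (λ v → ⌊ any? (λ i → f i ≟ v) ⌋)
          , tabulate (λ u → tabulate λ v → ⌊ any? (λ i → any? λ j → f i ≟ u ×-dec (f j ≟ v ×-dec (H i j Bool.≟ true))) ⌋)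

module _ {h n} (H : Graph h) (f : Fin h → Fin n) where
  private
    edge? : ∀ u v → Dec (∃ λ i → ∃ λ j → f i ≡ u × f j ≡ v × H i j ≡ true)
    edge? u v = any? (λ i → any? λ j → f i ≟ u ×-dec (f j ≟ v ×-dec (H i j Bool.≟ true)))

  inV-image : ∀ v → inV (image H f) v ≡ ⌊ any? (λ i → f i ≟ v) ⌋
  inV-image v = lookup∘tabulate _ v

  inE-image : ∀ u v → inE (image H f) u v ≡ ⌊ edge? u v ⌋
  inE-image u v = trans (cong (λ w → lookup w v) (lookup∘tabulate _ u)) (lookup∘tabulate _ v)

  inV-image-intro : ∀ i → inV (image H f) (f i) ≡ true
  inV-image-intro i = trans (inV-image (f i)) (⌊⌋-complete (any? _) (i , refl))

  inV-image-elim : ∀ v → inV (image H f) v ≡ true → ∃ λ i → f i ≡ v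
  inV-image-elim v eq = ⌊⌋-sound (any? _) (trans (sym (inV-image v)) eq)

  inE-image-intro : ∀ i j → H i j ≡ true → inE (image H f) (f i) (f j) ≡ true
  inE-image-intro i j e = trans (inE-image (f i) (f j)) (⌊⌋-complete (edge? _ _) (i , j , refl , refl , e))

  inE-image-elim : ∀ u v → inE (image H f) u v ≡ true → ∃ λ i → ∃ λ j → f i ≡ u × f j ≡ v × H i j ≡ true
  inE-image-elim u v eq = ⌊⌋-sound (edge? u v) (trans (sym (inE-image u v)) eq)

Bool-ext : ∀ {a b} → (a ≡ true → b ≡ true) → (b ≡ true → a ≡ true) → a ≡ b
Bool-ext {true}  {b}     f g = sym (f refl)
Bool-ext {false} {false} f g = refl
Bool-ext {false} {true}  f g = g refl

xor≡true : ∀ {a b} → a xor b ≡ true → b ≡ not a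
xor≡true {true}  {false} _ = refl
xor≡true {false} {true}  _ = refl

image-isCopy : ∀ {h n} (H : Graph h) (G : Graph n) (f : Fin h → Fin n) →
  IsSimple H → IsHom H G f → IsCopy H G (image H f)
image-isCopy H G f (H-sym , _) (mkHom f-inj f-hom) =
  ((λ u v → Bool-ext (flip u v) (flip v u)) , sub) ,
  f , (λ {i} {j} → f-inj i j) , inV-image-intro H f , inV-image-elim H f ,
  λ i j → Bool-ext (inE-image-intro H f i j) (back i j)
  where
  flip : ∀ u v → inE (image H f) u v ≡ true → inE (image H f) v u ≡ true
  flip u v e with inE-image-elim H f u v e
  ... | i , j , refl , refl , Hij = inE-image-intro H f j i (trans (H-sym j i) Hij)
  sub : ∀ u v → inE (image H f) u v ≡ true → inV (image H f) u ≡ true × inV (image H f) v ≡ true × G u v ≡ true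
  sub u v e with inE-image-elim H f u v e
  ... | i , j , refl , refl , Hij = inV-image-intro H f i , inV-image-intro H f j , f-hom i j Hij
  back : ∀ i j → inE (image H f) (f i) (f j) ≡ true → H i j ≡ true
  back i j e with inE-image-elim H f (f i) (f j) e
  ... | i′ , j′ , p , q , Hij = subst₂ (λ a b → H a b ≡ true) (f-inj i′ i p) (f-inj j′ j q) Hij

-- The vertices x, y, u₁ … u_f, w₁ … w_f span K_{f,f+2} together with an edge xy inside one of its parts.
NoBook : ∀ {n} → ℕ → Graph n → Set
NoBook {n} f G = ∀ x y (u w : Fin f → Fin n) → G x y ≡ true →
  (∀ i j → u i ≡ u j → i ≡ j) → (∀ i j → w i ≡ w j → i ≡ j) →
  (∀ i → u i ≢ x × u i ≢ y) → (∀ j → G (w j) x ≡ true × G (w j) y ≡ true) →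
  (∀ i j → G (w j) (u i) ≡ true) → ⊥

-- The critical edge: every book contains `F`

fin2 : Fin 2 → Bool
fin2 zero       = true
fin2 (suc zero) = false

fin2-inj : ∀ i j → fin2 i ≡ fin2 j → i ≡ j
fin2-inj zero       zero       _ = refl
fin2-inj zero       (suc zero) ()
fin2-inj (suc zero) zero       ()
fin2-inj (suc zero) (suc zero) _ = refl

xor-flip : ∀ a b c → a xor b ≡ a xor c → b ≡ c
xor-flip false b c eq = eq
xor-flip true true true eq = refl
xor-flip true false false eq = refl

2-colouring⇒χ≢3 : ∀ {f} (F : Graph f) → ChromaticNumber F 3 →
  (c : Fin f → Bool) → (∀ i j → F i j ≡ true → c i ≢ c j) → ⊥
2-colouring⇒χ≢3 F (_ , least) c proper with least 2 (toFin ∘ c , λ i j e eq → proper i j e (toFin-inj _ _ eq))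
  where
  toFin : Bool → Fin 2
  toFin true  = zero
  toFin false = suc zero
  toFin-inj : ∀ a b → toFin a ≡ toFin b → a ≡ b
  toFin-inj true  true  _ = refl
  toFin-inj false false _ = refl
... | s≤s (s≤s ())

record CriticalColouring {f} (F : Graph f) : Set where
  field
    e₁ e₂   : Fin f
    colour  : Fin f → Bool
    colour₁ : colour e₁ ≡ true
    colour₂ : colour e₂ ≡ true
    proper  : ∀ i j → F i j ≡ true → colour i ≡ colour j → (i ≡ e₁ × j ≡ e₂) ⊎ (i ≡ e₂ × j ≡ e₁)

module _ {f} (F : Graph f) (F-simple : IsSimple F) where
  deleteEdge-cases : ∀ u v i j → F i j ≡ true → deleteEdge F u v i j ≡ true ⊎ (i ≡ u × j ≡ v) ⊎ (i ≡ v × j ≡ u)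
  deleteEdge-cases u v i j e with i ≟ u | j ≟ v | i ≟ v | j ≟ u
  ... | yes p | yes q | _     | _     = inj₂ (inj₁ (p , q))
  ... | _     | _     | yes p | yes q = inj₂ (inj₂ (p , q))
  ... | yes _ | no _  | yes _ | no _  = inj₁ (∧-intro e refl)
  ... | yes _ | no _  | no _  | _     = inj₁ (∧-intro e refl)
  ... | no _  | _     | yes _ | no _  = inj₁ (∧-intro e refl)
  ... | no _  | _     | no _  | _     = inj₁ (∧-intro e refl)

  -- Without the critical edge `uv` the graph is 2-colourable, since `j < k ≤ 3`. If `u` and `v` had
  -- different colours, the colouring would be proper for `F` itself, against chromatic number 3; so
  -- `uv` is the only monochromatic edge.
  criticalColouring : ChromaticNumber F 3 → HasColorCriticalEdge F → CriticalColouring F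
  criticalColouring χF@(col3 , least3) (u , v , Fuv , k , j , (_ , leastk) , ((d , d-proper) , _) , j<k) = record
    -- The xor with `not (c u)` renames the colours so that `u` gets `true`.
    { e₁ = u ; e₂ = v ; colour = λ i → not (c u) xor c i
    ; colour₁ = norm (c u) ; colour₂ = trans (cong (not (c u) xor_) (sym cu≡cv)) (norm (c u))
    ; proper = λ i j e eq → case deleteEdge-cases u v i j e of λ where
        (inj₁ del) → ⊥-elim (c-proper i j del (xor-flip (not (c u)) _ _ eq))
        (inj₂ r)   → r }
    where
    c : Fin f → Bool
    c i = fin2 (Fin.inject≤ (d i) (≤-pred (≤-trans j<k (leastk 3 col3))))
    c-proper : ∀ i j → deleteEdge F u v i j ≡ true → c i ≢ c j
    c-proper i j e eq = d-proper i j e (Fin.inject≤-injective _ _ _ _ (fin2-inj _ _ eq))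
    norm : ∀ b → not b xor b ≡ true
    norm true  = refl
    norm false = refl
    cu≡cv : c u ≡ c v
    cu≡cv with c u Bool.≟ c v
    ... | yes eq = eq
    ... | no neq = ⊥-elim (2-colouring⇒χ≢3 F χF c λ i j e eq → case deleteEdge-cases u v i j e of λ where
        (inj₁ del)                   → c-proper i j del eq
        (inj₂ (inj₁ (refl , refl))) → neq eq
        (inj₂ (inj₂ (refl , refl))) → neq (sym eq))

-- The critical edge goes to `x`, `y`, the other vertices of its colour to the `u i`, the other
-- colour to the `w j`. Indexing both families by `Fin f` lets each vertex of `F` keep its own
-- index, so injectivity within a colour is immediate; between colours it follows from adjacency and
-- irreflexivity.
free⇒noBook : ∀ {f n} (F : Graph f) (G : Graph n) → IsSimple F → IsSimple G →
  CriticalColouring F → Free F G → NoBook f G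
free⇒noBook {f} {n} F G F-simple G-simple@(G-sym , _) cc free x y u w Gxy u-inj w-inj u-avoids w-xy w-u =
  free (image F g , image-isCopy F G g F-simple (mkHom (λ i j → g-inj i j (colour i) (colour j) refl refl)
                                                      (λ i j → g-hom i j (colour i) (colour j) refl refl)))
  where
  open CriticalColouring cc
  U : Fin f → Fin n
  U i with i ≟ e₁ | i ≟ e₂
  ... | yes _ | _     = x
  ... | no _  | yes _ = y
  ... | no _  | no _  = u i
  irr : ∀ {v} → G v v ≡ true → ⊥
  irr = irreflexive {G = G} G-simple
  U-inj : ∀ i j → U i ≡ U j → i ≡ j
  U-inj i j eq with i ≟ e₁ | i ≟ e₂ | j ≟ e₁ | j ≟ e₂
  ... | yes p | _     | yes q | _     = trans p (sym q)
  ... | yes p | _     | no _  | yes q = ⊥-elim (irr (subst (λ z → G z y ≡ true) eq Gxy))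
  ... | yes p | _     | no _  | no _  = ⊥-elim (proj₁ (u-avoids j) (sym eq))
  ... | no _  | yes p | yes q | _     = ⊥-elim (irr (subst (λ z → G x z ≡ true) eq Gxy))
  ... | no _  | yes p | no _  | yes q = trans p (sym q)
  ... | no _  | yes p | no _  | no _  = ⊥-elim (proj₂ (u-avoids j) (sym eq))
  ... | no _  | no _  | yes q | _     = ⊥-elim (proj₁ (u-avoids i) eq)
  ... | no _  | no _  | no _  | yes q = ⊥-elim (proj₂ (u-avoids i) eq)
  ... | no _  | no _  | no _  | no _  = u-inj i j eq
  w-U : ∀ i j → G (w j) (U i) ≡ true
  w-U i j with i ≟ e₁ | i ≟ e₂
  ... | yes _ | _     = proj₁ (w-xy j)
  ... | no _  | yes _ = proj₂ (w-xy j)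
  ... | no _  | no _  = w-u i j
  U-e₁ : U e₁ ≡ x
  U-e₁ with e₁ ≟ e₁
  ... | yes _ = refl
  ... | no ne = ⊥-elim (ne refl)
  e₁≡e₂⇒⊥ : F e₁ e₂ ≡ true → e₁ ≢ e₂
  e₁≡e₂⇒⊥ e eq with () ← trans (sym (subst (λ z → F z e₂ ≡ true) eq e)) (proj₂ F-simple e₂)
  U-e₂ : e₁ ≢ e₂ → U e₂ ≡ y
  U-e₂ ne with e₂ ≟ e₁ | e₂ ≟ e₂
  ... | yes p | _     = ⊥-elim (ne (sym p))
  ... | no _  | yes _ = refl
  ... | no _  | no n′ = ⊥-elim (n′ refl)
  g : Fin f → Fin n
  g i = if colour i then U i else w i
  g-inj : ∀ i j a b → colour i ≡ a → colour j ≡ b → g i ≡ g j → i ≡ j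
  g-inj i j true  true  ca cb eq rewrite ca | cb = U-inj i j eq
  g-inj i j true  false ca cb eq rewrite ca | cb = ⊥-elim (irr (subst (λ z → G (w j) z ≡ true) eq (w-U i j)))
  g-inj i j false true  ca cb eq rewrite ca | cb = ⊥-elim (irr (subst (λ z → G z (U j) ≡ true) eq (w-U j i)))
  g-inj i j false false ca cb eq rewrite ca | cb = w-inj i j eq
  same : ∀ i j → F i j ≡ true → colour i ≡ colour j → G (g i) (g j) ≡ true
  same i j e eq with proper i j e eq
  ... | inj₁ (refl , refl) rewrite colour₁ | colour₂ | U-e₁ | U-e₂ (e₁≡e₂⇒⊥ e) = Gxy
  ... | inj₂ (refl , refl) rewrite colour₁ | colour₂ | U-e₁ | U-e₂ (e₁≡e₂⇒⊥ (trans (proj₁ F-simple e₁ e₂) e)) = trans (G-sym y x) Gxy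
  g-hom : ∀ i j a b → colour i ≡ a → colour j ≡ b → F i j ≡ true → G (g i) (g j) ≡ true
  g-hom i j true  true  ca cb e = same i j e (trans ca (sym cb))
  g-hom i j true  false ca cb e rewrite ca | cb = trans (G-sym (U i) (w j)) (w-U i j)
  g-hom i j false true  ca cb e rewrite ca | cb = w-U j i
  g-hom i j false false ca cb e = same i j e (trans ca (sym cb))

-- Bicliques in dense pairs; neighbourhoods span few edges

remove : ∀ {n} → Fin n → (Fin n → Bool) → Fin n → Bool
remove x P y = P y ∧ not (x == y)

remove⊆ : ∀ {n} x (P : Fin n → Bool) y → remove x P y ≡ true → P y ≡ true
remove⊆ x P y r = proj₁ (∧-true r)

remove-≢ : ∀ {n} x (P : Fin n → Bool) y → remove x P y ≡ true → y ≢ x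
remove-≢ x P y r refl with () ← trans (sym (not-true (proj₂ (∧-true {P y} r)))) (==-refl y)

#-remove : ∀ {n} x (P : Fin n → Bool) → # P ≤ suc (# (remove x P))
#-remove x P = begin
  # P  ≤⟨ sum-mono (λ y → split (P y) (x == y)) ⟩
  sum (λ y → 𝟙 (x == y) + 𝟙 (remove x P y))  ≡⟨ sum-+ (λ y → 𝟙 (x == y)) (𝟙 ∘ remove x P) ⟩
  sum (λ y → 𝟙 (x == y)) + # (remove x P)  ≡⟨ cong (_+ # (remove x P)) (sum-δ₁ x) ⟩
  suc (# (remove x P))  ∎
  where
  open ≤-Reasoning
  split : ∀ a b → 𝟙 a ≤ 𝟙 b + 𝟙 (a ∧ not b)
  split false b     = z≤n
  split true  true  = s≤s z≤n
  split true  false = s≤s z≤n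

pick : ∀ {n} c (P : Fin n → Bool) → c ≤ # P →
  Σ (Fin c → Fin n) λ w → (∀ i j → w i ≡ w j → i ≡ j) × (∀ i → P (w i) ≡ true)
pick zero    P _   = (λ ()) , (λ ()) , (λ ())
pick {n} (suc c) P c≤P =
  let (x , Px)             = #-pos P (≤-trans (s≤s z≤n) c≤P)
      (w , w-inj , w-P) = pick c (remove x P) (≤-pred (≤-trans c≤P (#-remove x P)))
      w′ : Fin (suc c) → Fin n
      w′ = λ { zero → x ; (suc i) → w i }
      fresh : ∀ i → w i ≢ x
      fresh i = remove-≢ x P (w i) (w-P i)
  in w′ , (λ { zero zero _ → refl
             ; zero (suc j) eq → ⊥-elim (fresh j (sym eq))
             ; (suc i) zero eq → ⊥-elim (fresh i eq)
             ; (suc i) (suc j) eq → cong suc (w-inj i j eq) })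
     , λ { zero → Px ; (suc i) → remove⊆ x P (w i) (w-P i) }

-- The sides are asymmetric: `c` chosen vertices, and a linear set of common neighbours from which
-- any fixed number can later be picked.
record Biclique {n} (c K : ℕ) (G : Graph n) (P Q : Fin n → Bool) : Set where
  field
    u        : Fin c → Fin n
    u-inj    : ∀ i j → u i ≡ u j → i ≡ j
    u-Q      : ∀ i → Q (u i) ≡ true
    P′       : Fin n → Bool
    P′⊆P     : ∀ p → P′ p ≡ true → P p ≡ true
    complete : ∀ i p → P′ p ≡ true → G p (u i) ≡ true
    large    : n ≤ K * # P′

-- Here `k` is a reciprocal density. One greedy step shrinks `P` by a factor `k`, to density
-- `1 / (k * k)`; removing the chosen vertex from `Q` at most halves a density once `2 * k ≤ n`. The
-- value `k * k + 2 * k` dominates both new reciprocals.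
kst-n₀ kst-K : ℕ → ℕ → ℕ
kst-n₀ zero    k = 0
kst-n₀ (suc c) k = suc (2 * k + kst-n₀ c (k * k + 2 * k))
kst-K zero    k = k
kst-K (suc c) k = kst-K c (k * k + 2 * k)

-- Kővári–Sós–Turán by picking the vertices of one side greedily.
kst : ∀ c k {n} (G : Graph n) (P Q : Fin n → Bool) → kst-n₀ c k ≤ n → n ≤ k * # P →
  (∀ p → P p ≡ true → n ≤ k * # (λ q → G p q ∧ Q q)) → Biclique c (kst-K c k) G P Q
kst zero    k G P Q _ n≤P _ = record
  { u = λ () ; u-inj = λ () ; u-Q = λ () ; P′ = P ; P′⊆P = λ _ p → p ; complete = λ () ; large = n≤P }
kst (suc c) k {n} G P Q n₀≤n n≤P dense = record
  { u        = λ { zero → q ; (suc i) → B.u i }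
  ; u-inj    = λ { zero zero _ → refl
                 ; zero (suc j) eq → ⊥-elim (fresh j (sym eq))
                 ; (suc i) zero eq → ⊥-elim (fresh i eq)
                 ; (suc i) (suc j) eq → cong suc (B.u-inj i j eq) }
  ; u-Q      = λ { zero → Qq ; (suc i) → remove⊆ q Q (B.u i) (B.u-Q i) }
  ; P′       = B.P′
  ; P′⊆P     = λ p r → proj₁ (∧-true (B.P′⊆P p r))
  ; complete = λ { zero p r → proj₂ (∧-true (B.P′⊆P p r)) ; (suc i) p r → B.complete i p r }
  ; large    = B.large }
  where
  n>0 : 0 < n
  n>0 = ≤-trans (s≤s z≤n) n₀≤n
  2k≤n : 2 * k ≤ n
  2k≤n = ≤-trans (≤-trans (m≤m+n (2 * k) _) (n≤1+n _)) n₀≤n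
  -- Double counting the edges between `P` and `Q` gives `n * # P ≤ sum f`, so some `q` has
  -- `# P ≤ f q`; the indicator of `Q` in `f` forces this `q` into `Q`.
  f : Fin n → ℕ
  f q = k * (𝟙 (Q q) * # (λ p → P p ∧ G p q))
  f-sum : n * # P ≤ sum f
  f-sum = begin
    n * # P  ≡⟨ sym (sum-*ˡ n (𝟙 ∘ P)) ⟩
    sum (λ p → n * 𝟙 (P p))  ≤⟨ sum-mono (λ p → row p (P p) refl) ⟩
    sum (λ p → k * sum (λ q → 𝟙 (Q q) * 𝟙 (P p ∧ G p q)))  ≡⟨ sum-*ˡ k (λ p → sum (λ q → 𝟙 (Q q) * 𝟙 (P p ∧ G p q))) ⟩
    k * sum (λ p → sum (λ q → 𝟙 (Q q) * 𝟙 (P p ∧ G p q)))  ≡⟨ cong (k *_) (sum-comm₂ (λ p q → 𝟙 (Q q) * 𝟙 (P p ∧ G p q))) ⟩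
    k * sum (λ q → sum (λ p → 𝟙 (Q q) * 𝟙 (P p ∧ G p q)))  ≡⟨ cong (k *_) (sum-cong-≗ (λ q → sum-*ˡ (𝟙 (Q q)) (λ p → 𝟙 (P p ∧ G p q)))) ⟩
    k * sum (λ q → 𝟙 (Q q) * # (λ p → P p ∧ G p q))  ≡⟨ sym (sum-*ˡ k (λ q → 𝟙 (Q q) * # (λ p → P p ∧ G p q))) ⟩
    sum f  ∎
    where
    open ≤-Reasoning
    swap : ∀ a b → 𝟙 (a ∧ b) ≤ 𝟙 b * 𝟙 a
    swap true  true  = ≤-refl
    swap true  false = z≤n
    swap false b     = z≤n
    row : ∀ p b → P p ≡ b → n * 𝟙 b ≤ k * sum (λ q → 𝟙 (Q q) * 𝟙 (b ∧ G p q))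
    row p false _  = ≤-trans (≤-reflexive (*-zeroʳ n)) z≤n
    row p true  Pp = ≤-trans (≤-trans (≤-reflexive (*-identityʳ n)) (dense p Pp))
                             (*-monoʳ-≤ k (sum-mono (λ q → swap (G p q) (Q q))))
  avg : ∃ λ q → # P ≤ f q
  avg = sum-average (# P) f n>0 f-sum
  q : Fin n
  q = proj₁ avg
  P>0 : 0 < # P
  P>0 = proj₂ (*-pos {k} (≤-trans n>0 n≤P))
  Qq : Q q ≡ true
  Qq = 𝟙-pos (proj₁ (*-pos {𝟙 (Q q)} (proj₂ (*-pos {k} (≤-trans P>0 (proj₂ avg))))))
  P₁ : Fin n → Bool
  P₁ p = P p ∧ G p q
  k₁ : ℕ
  k₁ = k * k + 2 * k
  P₁-large : n ≤ k₁ * # P₁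
  P₁-large = begin
    n  ≤⟨ n≤P ⟩
    k * # P  ≤⟨ *-monoʳ-≤ k (proj₂ avg) ⟩
    k * (k * (𝟙 (Q q) * # P₁)) ≤⟨ *-monoʳ-≤ k (*-monoʳ-≤ k (≤-trans (*-monoˡ-≤ (# P₁) (𝟙≤1 (Q q))) (≤-reflexive (*-identityˡ (# P₁))))) ⟩
    k * (k * # P₁)  ≡⟨ sym (*-assoc k k (# P₁)) ⟩
    k * k * # P₁  ≤⟨ *-monoˡ-≤ (# P₁) (m≤m+n (k * k) (2 * k)) ⟩
    k₁ * # P₁  ∎
    where open ≤-Reasoning
  -- The degree into `Q` drops by at most one; when the old bound is added to itself, the loss
  -- `2 * k` is at most `n`.
  dense₁ : ∀ p → P₁ p ≡ true → n ≤ k₁ * # (λ z → G p z ∧ remove q Q z)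
  dense₁ p P₁p = ≤-trans (≤-by 0 (+-mono-≤ (+-mono-≤ d d) 2k≤n) (ring n k s)) (*-monoˡ-≤ s (m≤n+m (2 * k) (k * k)))
    where
    s = # (λ z → G p z ∧ remove q Q z)
    d : n ≤ k * suc s
    d = ≤-trans (dense p (proj₁ (∧-true P₁p))) (*-monoʳ-≤ k (≤-trans (#-remove q (λ z → G p z ∧ Q z))
          (s≤s (≤-reflexive (sum-cong-≗ (λ z → cong 𝟙 (∧-assoc (G p z) (Q z) (not (q == z)))))))))
    ring : ∀ n k s → 2 * k * s + (n + n + 2 * k) ≡ n + (k * suc s + k * suc s + n) + 0
    ring = solve-∀
  B : Biclique c (kst-K c k₁) G P₁ (remove q Q)
  B = kst c k₁ G P₁ (remove q Q) (≤-trans (≤-trans (m≤n+m _ (2 * k)) (n≤1+n _)) n₀≤n) P₁-large dense₁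
  module B = Biclique B
  fresh : ∀ i → B.u i ≢ q
  fresh i = remove-≢ q Q (B.u i) (B.u-Q i)

large⇒≥ : ∀ {n s} K f → suc (K * f) ≤ n → n ≤ K * s → f ≤ s
large⇒≥ {n} {s} K f Kf<n n≤Ks with f ≤? s
... | yes f≤s = f≤s
... | no f≰s  = ⊥-elim (<⇒≱ Kf<n (≤-trans n≤Ks (*-monoʳ-≤ K (<⇒≤ (≰⇒> f≰s)))))

book-n₀ : ℕ → ℕ → ℕ
book-n₀ f k = suc (kst-K f k * f) + kst-n₀ f k

-- The form in which `NoBook` is contradicted later: the biclique between `Q` and `P` supplies the
-- `u i` from `Q` and the `w j` from `P`, and the edge `xy` lies in the part of the `u i`.
noBook-dense : ∀ {n} f k (G : Graph n) → NoBook f G → book-n₀ f k ≤ n →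
  ∀ x y (P Q : Fin n → Bool) → G x y ≡ true →
  (∀ p → P p ≡ true → G p x ≡ true × G p y ≡ true) → (∀ q → Q q ≡ true → q ≢ x × q ≢ y) →
  n ≤ k * # P → (∀ p → P p ≡ true → n ≤ k * # (λ q → G p q ∧ Q q)) → ⊥
noBook-dense {n} f k G noBook n₀≤n x y P Q Gxy P-adj Q-avoids n≤P dense =
  let open Biclique (kst f k G P Q (≤-trans (m≤n+m (kst-n₀ f k) (suc (kst-K f k * f))) n₀≤n) n≤P dense)
      (w , w-inj , w-P′) = pick f P′ (large⇒≥ (kst-K f k) f (≤-trans (m≤m+n (suc (kst-K f k * f)) (kst-n₀ f k)) n₀≤n) large)
  in noBook x y u w Gxy u-inj w-inj (λ i → Q-avoids (u i) (u-Q i))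
       (λ j → P-adj (w j) (P′⊆P (w j) (w-P′ j))) (λ i j → complete i (w j) (w-P′ j))

tri-n₀ : ℕ → ℕ → ℕ
tri-n₀ f K = suc (kst-K (suc f) (2 * K) * f) + kst-n₀ (suc f) (2 * K)

-- Neighbours of `x` with codegree at least `n / L` number at most `n / L`, for otherwise a biclique
-- inside the neighbourhood of `x` would give a book. These and the remaining neighbours contribute
-- at most `n * n / L` each, and `L = 2 * K` absorbs the sum.
tri-small : ∀ {n} f K (G : Graph n) → IsSimple G → NoBook f G → tri-n₀ f K ≤ n → ∀ x → K * tri G x ≤ n * n
tri-small {n} f K G G-simple@(G-sym , _) noBook n₀≤n x =
  *-cancelˡ-≤ 2 (begin
    2 * (K * tri G x)  ≡⟨ sym (*-assoc 2 K (tri G x)) ⟩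
    L * tri G x  ≡⟨ sym (sum-*ˡ L (λ v → 𝟙 (G x v) * codeg G x v)) ⟩
    sum (λ v → L * (𝟙 (G x v) * codeg G x v))  ≤⟨ sum-mono (λ v → term v (G x v) refl) ⟩
    sum (λ v → L * n * 𝟙 (P v) + n)  ≡⟨ sum-+ (λ v → L * n * 𝟙 (P v)) (λ _ → n) ⟩
    sum (λ v → L * n * 𝟙 (P v)) + sum {n} (λ _ → n)  ≡⟨ cong₂ _+_ (sum-*ˡ (L * n) (𝟙 ∘ P)) (sum-const n n) ⟩
    L * n * # P + n * n  ≤⟨ +-monoˡ-≤ (n * n) (≤-trans (≤-reflexive (ring L n (# P))) (*-monoʳ-≤ n few)) ⟩
    n * n + n * n  ≡⟨ ring′ (n * n) ⟩
    2 * (n * n)  ∎)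
  where
  open ≤-Reasoning
  L : ℕ
  L = 2 * K
  P : Fin n → Bool
  P v = G x v ∧ ⌊ n ≤? L * codeg G x v ⌋
  ring : ∀ a b c → a * b * c ≡ b * (a * c)
  ring = solve-∀
  ring′ : ∀ a → a + a ≡ 2 * a
  ring′ = solve-∀
  term : ∀ v b → G x v ≡ b → L * (𝟙 b * codeg G x v) ≤ L * n * 𝟙 (b ∧ ⌊ n ≤? L * codeg G x v ⌋) + n
  term v false _ = ≤-trans (≤-reflexive (*-zeroʳ L)) z≤n
  term v true  _ with n ≤? L * codeg G x v
  ... | yes _ = ≤-trans (≤-trans (*-monoʳ-≤ L (≤-trans (≤-reflexive (*-identityˡ _)) (#≤n (λ z → G x z ∧ G v z))))
                                 (≤-reflexive (sym (*-identityʳ (L * n))))) (m≤m+n _ n)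
  ... | no n≰ = ≤-trans (≤-trans (≤-reflexive (cong (L *_) (*-identityˡ _))) (<⇒≤ (≰⇒> n≰))) (m≤n+m n _)
  -- `kst` is asked for `suc f` vertices because `u zero` becomes the end `y` of the added edge
  -- `xy`; the other `f` remain as the `u i`. The `w j` are adjacent to `x` since `P` lies in its
  -- neighbourhood.
  n≰LP : ¬ (n ≤ L * # P)
  n≰LP n≤LP =
    let open Biclique (kst (suc f) L G P (G x) (≤-trans (m≤n+m (kst-n₀ (suc f) L) (suc (kst-K (suc f) L * f))) n₀≤n) n≤LP dense)
        (w , w-inj , w-P′) = pick f P′ (large⇒≥ (kst-K (suc f) L) f (≤-trans (m≤m+n (suc (kst-K (suc f) L * f)) (kst-n₀ (suc f) L)) n₀≤n) large)
    in noBook x (u zero) (u ∘ suc) w (u-Q zero)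
         (λ i j eq → suc-injective (u-inj (suc i) (suc j) eq)) w-inj
         (λ i → (λ eq → irr (subst (λ z → G x z ≡ true) eq (u-Q (suc i)))) , λ eq → case u-inj (suc i) zero eq of λ ())
         (λ j → trans (G-sym (w j) x) (proj₁ (∧-true (P′⊆P (w j) (w-P′ j)))) , complete zero (w j) (w-P′ j))
         (λ i j → complete (suc i) (w j) (w-P′ j))
    where
    irr : ∀ {v} → G v v ≡ true → ⊥
    irr = irreflexive {G = G} G-simple
    dense : ∀ p → P p ≡ true → n ≤ L * # (λ q → G p q ∧ G x q)
    dense p Pp = ≤-trans (⌊⌋-sound (n ≤? _) (proj₂ (∧-true {G x p} Pp)))
                         (*-monoʳ-≤ L (≤-reflexive (sum-cong-≗ (λ q → cong 𝟙 (∧-comm (G x q) (G p q))))))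
  few : L * # P ≤ n
  few = <⇒≤ (≰⇒> n≰LP)

-- Embeddings of `H` into `G` compared with those into a cut

isHom? : ∀ {h n} (H : Graph h) (G : Graph n) (f : Fin h → Fin n) → Dec (IsHom H G f)
isHom? H G f with all? (λ i → all? λ j → (f i ≟ f j) →-dec (i ≟ j))
                | all? (λ i → all? λ j → (H i j Bool.≟ true) →-dec (G (f i) (f j) Bool.≟ true))
... | yes p | yes q = yes (mkHom p q)
... | no ¬p | _     = no λ k → ¬p (IsHom.inj k)
... | yes _ | no ¬q = no λ k → ¬q (IsHom.hom k)

homᵇ : ∀ {h n} → Graph h → Graph n → Vec (Fin n) h → Bool
homᵇ H G v = ⌊ isHom? H G (lookup v) ⌋

homᵇ-sound : ∀ {h n} (H : Graph h) (G : Graph n) v → homᵇ H G v ≡ true → IsHom H G (lookup v)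
homᵇ-sound H G v = ⌊⌋-sound (isHom? H G (lookup v))

homᵇ-complete : ∀ {h n} (H : Graph h) (G : Graph n) v → IsHom H G (lookup v) → homᵇ H G v ≡ true
homᵇ-complete H G v = ⌊⌋-complete (isHom? H G (lookup v))

emb : ∀ {h n} → Graph h → Graph n → ℕ
emb {h} H G = ∑V h λ v → 𝟙 (homᵇ H G v)

cut : ∀ {n} → (Fin n → Bool) → Graph n
cut σ i j = σ i xor σ j

-- Ordered pairs are counted: for simple `G`, every edge inside a part and every absent pair across
-- counts twice.
inner missing : ∀ {n} → Graph n → (Fin n → Bool) → ℕ
inner   G σ = sum λ u → # (λ v → G u v ∧ not (σ u xor σ v))
missing G σ = sum λ u → # (λ v → (σ u xor σ v) ∧ not (G u v))

prod-update : ∀ {h} (i : Fin h) a (f : Fin h → ℕ) → prod (λ l → if i == l then a else f l) * f i ≡ a * prod f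
prod-update {suc h} zero a f = ring a (f zero) (prod (f ∘ suc))
  where
  ring : ∀ a x y → a * y * x ≡ a * (x * y)
  ring = solve-∀
prod-update {suc h} (suc i) a f = begin
  f zero * prod (λ l → if suc i == suc l then a else f (suc l)) * f (suc i)
    ≡⟨ cong (λ z → f zero * z * f (suc i)) (prod-cong (λ l → cong (if_then a else f (suc l)) (suc-== i l))) ⟩
  f zero * prod (λ l → if i == l then a else f (suc l)) * f (suc i)
    ≡⟨ *-assoc (f zero) _ (f (suc i)) ⟩
  f zero * (prod (λ l → if i == l then a else f (suc l)) * f (suc i))
    ≡⟨ cong (f zero *_) (prod-update i a (f ∘ suc)) ⟩
  f zero * (a * prod (f ∘ suc))
    ≡⟨ ring (f zero) a (prod (f ∘ suc)) ⟩
  a * (f zero * prod (f ∘ suc))  ∎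
  where
  open ≡-Reasoning
  ring : ∀ x a y → x * (a * y) ≡ a * (x * y)
  ring = solve-∀

prod-const : ∀ h c → prod {h} (λ _ → c) ≡ c ^ h
prod-const zero    c = refl
prod-const (suc h) c = cong (c *_) (prod-const h c)

prod-two : ∀ {h} (ρ : Fin h → Bool) a b → prod (λ l → if ρ l then a else b) ≡ a ^ # ρ * b ^ # (not ∘ ρ)
prod-two {zero}  ρ a b = refl
prod-two {suc h} ρ a b with ρ zero
... | true  = trans (cong (a *_) (prod-two (ρ ∘ suc) a b)) (sym (*-assoc a _ _))
... | false = trans (cong (b *_) (prod-two (ρ ∘ suc) a b)) (ring b (a ^ # (ρ ∘ suc)) (b ^ # (not ∘ ρ ∘ suc)))
  where
  ring : ∀ b x y → b * (x * y) ≡ x * (b * y)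
  ring = solve-∀

^-distrib-* : ∀ h a b → (a * b) ^ h ≡ a ^ h * b ^ h
^-distrib-* zero    a b = refl
^-distrib-* (suc h) a b = trans (cong (a * b *_) (^-distrib-* h a b)) (ring a b (a ^ h) (b ^ h))
  where
  ring : ∀ a b x y → a * b * (x * y) ≡ a * x * (b * y)
  ring = solve-∀

InjIn : ∀ {h n} → (Fin h → Fin n → Bool) → Vec (Fin n) h → Set
InjIn S v = (∀ i j → lookup v i ≡ lookup v j → i ≡ j) × (∀ l → S l (lookup v l) ≡ true)

injIn? : ∀ {h n} (S : Fin h → Fin n → Bool) (v : Vec (Fin n) h) → Dec (InjIn S v)
injIn? S v = (all? λ i → all? λ j → (lookup v i ≟ lookup v j) →-dec (i ≟ j)) ×-dec (all? λ l → S l (lookup v l) Bool.≟ true)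

-- Coordinates are chosen greedily. Each choice removes at most one element from every later set:
-- slack `h` tolerates all these removals, and a set disjoint from the others loses nothing. The
-- second alternative accommodates the singletons at the ends of a prescribed edge.
inj-count : ∀ {n} h (S : Fin h → Fin n → Bool) (s : Fin h → ℕ) →
  (∀ l → s l + h ≤ # (S l) ⊎ (s l ≤ # (S l) × (∀ l′ x → l′ ≢ l → S l x ≡ true → S l′ x ≡ true → ⊥))) →
  prod s ≤ ∑V h (λ v → 𝟙 ⌊ injIn? S v ⌋)
inj-count zero S s _ = true⇒1≤𝟙 (⌊⌋-complete (injIn? S []) ((λ ()) , (λ ())))
inj-count {n} (suc h) S s cond = begin
  s zero * prod (s ∘ suc)  ≤⟨ *-monoˡ-≤ (prod (s ∘ suc)) s₀ ⟩
  # (S zero) * prod (s ∘ suc)  ≡⟨ sym (sum-*ʳ (prod (s ∘ suc)) (𝟙 ∘ S zero)) ⟩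
  sum (λ x → 𝟙 (S zero x) * prod (s ∘ suc))  ≤⟨ sum-mono (λ x → step x (S zero x) refl) ⟩
  sum (λ x → ∑V h (λ v → 𝟙 ⌊ injIn? S (x ∷ v) ⌋))  ∎
  where
  open ≤-Reasoning
  s₀ : s zero ≤ # (S zero)
  s₀ with cond zero
  ... | inj₁ big        = ≤-trans (m≤m+n (s zero) (suc h)) big
  ... | inj₂ (ok , _) = ok
  S′ : Fin n → Fin h → Fin n → Bool
  S′ x l = remove x (S (suc l))
  cond′ : ∀ x → S zero x ≡ true → ∀ l →
    s (suc l) + h ≤ # (S′ x l) ⊎ (s (suc l) ≤ # (S′ x l) × (∀ l′ y → l′ ≢ l → S′ x l y ≡ true → S′ x l′ y ≡ true → ⊥))
  cond′ x Sx l with cond (suc l)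
  ... | inj₁ big = inj₁ (≤-pred (≤-trans (≤-trans (≤-reflexive (sym (+-suc (s (suc l)) h))) big) (#-remove x (S (suc l)))))
  ... | inj₂ (ok , disj) = inj₂ (≤-trans ok (#-mono (S (suc l)) (S′ x l) (λ y Sy → ∧-intro Sy (cong not (==-≢ (λ { refl → disj zero x (λ ()) Sy Sx }))))) ,
          λ l′ y ne r r′ → disj (suc l′) y (ne ∘ suc-injective) (remove⊆ x (S (suc l)) y r) (remove⊆ x (S (suc l′)) y r′))
  extend : ∀ x v → S zero x ≡ true → InjIn (S′ x) v → InjIn S (x ∷ v)
  extend x v Sx (v-inj , v-S) = xv-inj , λ { zero → Sx ; (suc l) → remove⊆ x (S (suc l)) (lookup v l) (v-S l) }
    where
    fresh : ∀ l → lookup v l ≢ x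
    fresh l = remove-≢ x (S (suc l)) (lookup v l) (v-S l)
    xv-inj : ∀ i j → lookup (x ∷ v) i ≡ lookup (x ∷ v) j → i ≡ j
    xv-inj zero    zero    _  = refl
    xv-inj zero    (suc j) eq = ⊥-elim (fresh j (sym eq))
    xv-inj (suc i) zero    eq = ⊥-elim (fresh i eq)
    xv-inj (suc i) (suc j) eq = cong suc (v-inj i j eq)
  step : ∀ x b → S zero x ≡ b → 𝟙 b * prod (s ∘ suc) ≤ ∑V h (λ v → 𝟙 ⌊ injIn? S (x ∷ v) ⌋)
  step x false _  = z≤n
  step x true  Sx = ≤-trans (≤-reflexive (*-identityˡ _)) (≤-trans (inj-count h (S′ x) (s ∘ suc) (cond′ x Sx))
    (∑V-mono h (λ v → 𝟙-mono (λ r → ⌊⌋-complete (injIn? S (x ∷ v)) (extend x v Sx (⌊⌋-sound (injIn? (S′ x) v) r))))))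

side : ∀ {n} → (Fin n → Bool) → Bool → Fin n → Bool
side σ c x = not (c xor σ x)

#-side : ∀ {n} (σ : Fin n → Bool) {m} → m ≤ # σ → m ≤ # (not ∘ σ) → ∀ c → m ≤ # (side σ c)
#-side σ m≤σ m≤σ′ true  = ≤-trans m≤σ (#-mono σ (side σ true) λ x e → cong (λ b → not (not b)) e)
#-side σ m≤σ m≤σ′ false = m≤σ′

side-eq : ∀ c b → not (c xor b) ≡ true → b ≡ c
side-eq true  true  _ = refl
side-eq false false _ = refl

record Bipartite {h} (H : Graph h) : Set where
  field
    χ         : Fin h → Bool
    proper    : ∀ i j → H i j ≡ true → χ i xor χ j ≡ true
    i₀ j₀     : Fin h
    i₀j₀-edge : H i₀ j₀ ≡ true

  i≢j : ∀ {i j} → H i j ≡ true → i ≢ j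
  i≢j {i} e refl with () ← trans (sym (proper i i e)) (xor-same (χ i))

module _ {h : ℕ} {H : Graph h} (bip : Bipartite H) {n : ℕ} (G : Graph n) (σ : Fin n → Bool) where
  open Bipartite bip
  private
    T = cut σ

    lostᵇ extraᵇ : Vec (Fin n) h → Bool
    lostᵇ  v = homᵇ H T v ∧ not (homᵇ H G v)
    extraᵇ v = homᵇ H G v ∧ not (homᵇ H T v)

    lost extra : ℕ
    lost  = ∑V h (𝟙 ∘ lostᵇ)
    extra = ∑V h (𝟙 ∘ extraᵇ)

  emb-exchange : emb H G + lost ≤ emb H T + extra
  emb-exchange = begin
    emb H G + lost  ≡⟨ sym (∑V-+ h (𝟙 ∘ homᵇ H G) (𝟙 ∘ lostᵇ)) ⟩
    ∑V h (λ v → 𝟙 (homᵇ H G v) + 𝟙 (lostᵇ v))  ≤⟨ ∑V-mono h (λ v → bool (homᵇ H G v) (homᵇ H T v)) ⟩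
    ∑V h (λ v → 𝟙 (homᵇ H T v) + 𝟙 (extraᵇ v))  ≡⟨ ∑V-+ h (𝟙 ∘ homᵇ H T) (𝟙 ∘ extraᵇ) ⟩
    emb H T + extra  ∎
    where
    open ≤-Reasoning
    bool : ∀ a b → 𝟙 a + 𝟙 (b ∧ not a) ≤ 𝟙 b + 𝟙 (a ∧ not b)
    bool true  true  = ≤-refl
    bool true  false = ≤-refl
    bool false true  = ≤-refl
    bool false false = ≤-refl

  -- An embedding into `G` that is not one into the cut sends some edge `ij` of `H` inside a part:
  -- at most `h * h` choices of `ij`, `inner G σ` of its image, and `n ^ (h - 2)` of the rest.
  extra≤ : extra * (n * n) ≤ h * (h * (inner G σ * n ^ h))
  extra≤ = begin
    extra * (n * n)
      ≤⟨ *-monoˡ-≤ (n * n) (∑V-mono h pointwise) ⟩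
    ∑V h (λ v → sum λ i → sum λ j → 𝟙 (H i j) * φ (lookup v i) (lookup v j)) * (n * n)
      ≡⟨ cong (_* (n * n)) (trans (∑V-sum h (λ i v → sum λ j → 𝟙 (H i j) * φ (lookup v i) (lookup v j)))
                           (sum-cong-≗ λ i → ∑V-sum h (λ j v → 𝟙 (H i j) * φ (lookup v i) (lookup v j)))) ⟩
    sum (λ i → sum λ j → ψ i j) * (n * n)
      ≡⟨ trans (sym (sum-*ʳ (n * n) (λ i → sum (ψ i)))) (sum-cong-≗ λ i → sym (sum-*ʳ (n * n) (ψ i))) ⟩
    sum (λ i → sum λ j → ψ i j * (n * n))
      ≤⟨ sum-≤-const (λ i → sum-≤-const λ j → bound i j (H i j) refl) ⟩
    h * (h * (inner G σ * n ^ h))  ∎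
    where
    open ≤-Reasoning
    φ : Fin n → Fin n → ℕ
    φ u v = 𝟙 (G u v ∧ not (σ u xor σ v))
    ψ : Fin h → Fin h → ℕ
    ψ i j = ∑V h λ v → 𝟙 (H i j) * φ (lookup v i) (lookup v j)
    bound : ∀ i j b → H i j ≡ b → ∑V h (λ v → 𝟙 b * φ (lookup v i) (lookup v j)) * (n * n) ≤ inner G σ * n ^ h
    bound i j false _ = ≤-trans (≤-reflexive (cong (_* (n * n)) (trans (∑V-const {n} h 0) (*-zeroʳ (n ^ h))))) z≤n
    bound i j true  e = ≤-reflexive (trans (cong (_* (n * n)) (∑V-cong h (λ v → *-identityˡ (φ (lookup v i) (lookup v j))))) (∑V-pair h (i≢j e) φ))
    pointwise : ∀ v → 𝟙 (extraᵇ v) ≤ sum λ i → sum λ j → 𝟙 (H i j) * φ (lookup v i) (lookup v j)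
    pointwise v = 01-≤ (𝟙≤1 (extraᵇ v)) λ pos →
      let (gh , nth)  = ∧-true (𝟙-pos pos)
          G-hom       = homᵇ-sound H G v gh
          Bad : Fin h → Fin h → Set
          Bad i j = H i j ≡ true × σ (lookup v i) xor σ (lookup v j) ≡ false
          bad? : Dec (∃ λ i → ∃ λ j → Bad i j)
          bad? = any? λ i → any? λ j → (H i j Bool.≟ true) ×-dec (σ (lookup v i) xor σ (lookup v j) Bool.≟ false)
      in case bad? of λ where
        (yes (i , j , e , s)) → ≤-trans
          (*-mono-≤ (true⇒1≤𝟙 e) (true⇒1≤𝟙 (∧-intro (IsHom.hom G-hom i j e) (cong not s))))
          (≤-trans (term≤sum (λ j → 𝟙 (H i j) * φ (lookup v i) (lookup v j)) j)
                   (term≤sum (λ i → sum λ j → 𝟙 (H i j) * φ (lookup v i) (lookup v j)) i))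
        (no none) → case trans (sym (not-true nth)) (homᵇ-complete H T v (mkHom (IsHom.inj G-hom)
          (λ i j e → ¬-not (λ s → none (i , j , e , s))))) of λ ()

  -- A missing pair `u`, `v` destroys the embeddings into the cut with `i₀` at `u` and `j₀` at `v`;
  -- the other vertices go greedily to the sides dictated by `χ`, in at least `s ^ (h - 2)` ways.
  -- The slack consists of `h` for `inj-count` and 2 for avoiding `u` and `v`.
  lost≥ : ∀ s → s + h + 2 ≤ # σ → s + h + 2 ≤ # (not ∘ σ) → missing G σ * s ^ h ≤ lost * (s * s)
  lost≥ s large large′ = begin
    missing G σ * s ^ h  ≡⟨ cong (missing G σ *_) (sym Πs) ⟩
    missing G σ * (prod ss * (s * s))  ≡⟨ sym (*-assoc (missing G σ) (prod ss) (s * s)) ⟩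
    missing G σ * prod ss * (s * s)  ≤⟨ *-monoˡ-≤ (s * s) main ⟩
    lost * (s * s)  ∎
    where
    open ≤-Reasoning
    miss : Fin n → Fin n → Bool
    miss u v = (σ u xor σ v) ∧ not (G u v)
    s₁ ss : Fin h → ℕ
    s₁ l = if j₀ == l then 1 else s
    ss l = if i₀ == l then 1 else s₁ l
    s₁i₀ : s₁ i₀ ≡ s
    s₁i₀ = cong (if_then 1 else s) (==-≢ (i≢j i₀j₀-edge ∘ sym))
    Πs : prod ss * (s * s) ≡ s ^ h
    Πs = begin-equality
      prod ss * (s * s)  ≡⟨ sym (*-assoc (prod ss) s s) ⟩
      prod ss * s * s  ≡⟨ cong (λ z → prod ss * z * s) (sym s₁i₀) ⟩
      prod ss * s₁ i₀ * s  ≡⟨ cong (_* s) (prod-update i₀ 1 s₁) ⟩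
      1 * prod s₁ * s  ≡⟨ cong (_* s) (*-identityˡ (prod s₁)) ⟩
      prod s₁ * s  ≡⟨ prod-update j₀ 1 (λ _ → s) ⟩
      1 * prod {h} (λ _ → s)  ≡⟨ trans (*-identityˡ (prod {h} (λ _ → s))) (prod-const h s) ⟩
      s ^ h  ∎
    -- The orientation is fixed by placing `i₀` at `u`: vertices coloured like `i₀` go to the side
    -- of `u`.
    col : Fin n → Fin h → Bool
    col u l = (χ l xor χ i₀) xor σ u
    free : Fin n → Fin n → Fin h → Fin n → Bool
    free u v l = remove v (remove u (side σ (col u l)))
    S : Fin n → Fin n → Fin h → Fin n → Bool
    S u v l x = if i₀ == l then u == x else (if j₀ == l then v == x else free u v l x)
    free-large : ∀ u v l → s + h ≤ # (free u v l)
    free-large u v l = ≤-pred (≤-pred (begin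
      suc (suc (s + h))  ≡⟨ +-comm 2 (s + h) ⟩
      s + h + 2  ≤⟨ #-side σ large large′ (col u l) ⟩
      # (side σ (col u l))  ≤⟨ #-remove u (side σ (col u l)) ⟩
      suc (# (remove u (side σ (col u l))))  ≤⟨ s≤s (#-remove v (remove u (side σ (col u l)))) ⟩
      suc (suc (# (free u v l)))  ∎))
    miss⇒≢ : ∀ {u v} → miss u v ≡ true → u ≢ v
    miss⇒≢ {u} m refl with () ← trans (sym (proj₁ (∧-true m))) (xor-same (σ u))
    free-≢u : ∀ u v l x → free u v l x ≡ true → (u == x) ≡ true → ⊥
    free-≢u u v l x r e = remove-≢ u (side σ (col u l)) x (remove⊆ v (remove u (side σ (col u l))) x r) (sym (==-sound e))
    free-≢v : ∀ u v l x → free u v l x ≡ true → (v == x) ≡ true → ⊥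
    free-≢v u v l x r e = remove-≢ v (remove u (side σ (col u l))) x r (sym (==-sound e))
    cond : ∀ u v → miss u v ≡ true → ∀ l →
      ss l + h ≤ # (S u v l) ⊎ (ss l ≤ # (S u v l) × (∀ l′ x → l′ ≢ l → S u v l x ≡ true → S u v l′ x ≡ true → ⊥))
    cond u v m l with i₀ ≟ l | j₀ ≟ l
    ... | yes refl | _ = inj₂ (≤-reflexive (sym (sum-δ₁ u)) , disj)
      where
      disj : ∀ l′ x → l′ ≢ i₀ → (u == x) ≡ true → S u v l′ x ≡ true → ⊥
      disj l′ x ne e r with i₀ ≟ l′ | j₀ ≟ l′
      ... | yes p | _     = ne (sym p)
      ... | no _  | yes _ = miss⇒≢ m (trans (==-sound e) (sym (==-sound r)))
      ... | no _  | no _  = free-≢u u v l′ x r e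
    ... | no _ | yes refl = inj₂ (≤-reflexive (sym (sum-δ₁ v)) , disj)
      where
      disj : ∀ l′ x → l′ ≢ j₀ → (v == x) ≡ true → S u v l′ x ≡ true → ⊥
      disj l′ x ne e r with i₀ ≟ l′ | j₀ ≟ l′
      ... | yes _ | _     = miss⇒≢ m (trans (==-sound r) (sym (==-sound e)))
      ... | no _  | yes p = ne (sym p)
      ... | no _  | no _  = free-≢v u v l′ x r e
    ... | no _ | no _ = inj₁ (free-large u v l)
    X : Vec (Fin n) h → ℕ
    X w = 𝟙 (lostᵇ w)
    term : Fin n → Fin n → Vec (Fin n) h → ℕ
    term u v w = 𝟙 (miss u v) * 𝟙 ⌊ injIn? (S u v) w ⌋
    xor-cancel : ∀ a b c d → ((a xor b) xor c) xor ((d xor b) xor c) ≡ a xor d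
    xor-cancel true  true  true  true  = refl
    xor-cancel true  true  true  false = refl
    xor-cancel true  true  false true  = refl
    xor-cancel true  true  false false = refl
    xor-cancel true  false true  true  = refl
    xor-cancel true  false true  false = refl
    xor-cancel true  false false true  = refl
    xor-cancel true  false false false = refl
    xor-cancel false true  true  true  = refl
    xor-cancel false true  true  false = refl
    xor-cancel false true  false true  = refl
    xor-cancel false true  false false = refl
    xor-cancel false false true  true  = refl
    xor-cancel false false true  false = refl
    xor-cancel false false false true  = refl
    xor-cancel false false false false = refl
    xor-swap-true : ∀ a b c d → a xor b ≡ true → c xor d ≡ true → d ≡ (b xor a) xor c
    xor-swap-true true  false true  false _ _ = refl
    xor-swap-true true  false false true  _ _ = refl
    xor-swap-true false true  true  false _ _ = refl
    xor-swap-true false true  false true  _ _ = refl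
    -- A lost map is charged only to its pair of values at `i₀` and `j₀`, so the sum over `u` and
    -- `v` collapses by `sum-δ`.
    term≤ : ∀ u v w → term u v w ≤ 𝟙 (lookup w i₀ == u) * (𝟙 (lookup w j₀ == v) * X w)
    term≤ u v w = 01-≤ (*-mono-≤ (𝟙≤1 (miss u v)) (𝟙≤1 ⌊ injIn? (S u v) w ⌋)) λ pos →
      let (p₁ , p₂)       = *-pos {𝟙 (miss u v)} pos
          m               = 𝟙-pos p₁
          (w-inj , w-S)   = ⌊⌋-sound (injIn? (S u v) w) (𝟙-pos p₂)
          at-i₀ : u ≡ lookup w i₀
          at-i₀ = ==-sound (subst (λ b → (if b then u == lookup w i₀ else (if j₀ == i₀ then v == lookup w i₀ else free u v i₀ (lookup w i₀))) ≡ true)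
                                  (==-refl i₀) (w-S i₀))
          at-j₀ : v ≡ lookup w j₀
          at-j₀ = ==-sound (subst₂ (λ a b → (if a then u == lookup w j₀ else (if b then v == lookup w j₀ else free u v j₀ (lookup w j₀))) ≡ true)
                                  (==-≢ (i≢j i₀j₀-edge)) (==-refl j₀) (w-S j₀))
          w-col : ∀ l → σ (lookup w l) ≡ col u l
          w-col l = colour u v w m at-i₀ at-j₀ l (w-S l)
          T-hom : IsHom H T (lookup w)
          T-hom = mkHom w-inj λ i j e → trans (cong₂ _xor_ (w-col i) (w-col j)) (trans (xor-cancel (χ i) (χ i₀) (σ u) (χ j)) (proper i j e))
          not-G : homᵇ H G w ≡ false
          not-G = ⌊⌋-refute (isHom? H G (lookup w)) λ k →
            case trans (sym (IsHom.hom k i₀ j₀ i₀j₀-edge))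
                       (trans (cong₂ G (sym at-i₀) (sym at-j₀)) (not-true (proj₂ (∧-true {σ u xor σ v} m)))) of λ ()
      in *-mono-≤ (true⇒1≤𝟙 (trans (cong (lookup w i₀ ==_) at-i₀) (==-refl _)))
           (*-mono-≤ (true⇒1≤𝟙 (trans (cong (lookup w j₀ ==_) at-j₀) (==-refl _)))
             (true⇒1≤𝟙 (∧-intro (homᵇ-complete H T w T-hom) (cong not not-G))))
      where
      colour : ∀ u v w → miss u v ≡ true → u ≡ lookup w i₀ → v ≡ lookup w j₀ → ∀ l → S u v l (lookup w l) ≡ true → σ (lookup w l) ≡ col u l
      colour u v w m eu ev l r with i₀ ≟ l | j₀ ≟ l
      ... | yes refl | _ = trans (cong σ (sym eu)) (sym (cong (_xor σ u) (xor-same (χ i₀))))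
      ... | no _ | yes refl = trans (cong σ (sym ev)) (xor-swap-true (χ i₀) (χ j₀) (σ u) (σ v) (proper i₀ j₀ i₀j₀-edge) (proj₁ (∧-true m)))
      ... | no _ | no _ = side-eq (col u l) (σ (lookup w l))
              (remove⊆ u (side σ (col u l)) _ (remove⊆ v (remove u (side σ (col u l))) _ r))
    main : missing G σ * prod ss ≤ lost
    main = begin
      missing G σ * prod ss
        ≡⟨ trans (sym (sum-*ʳ (prod ss) (λ u → # (miss u)))) (sum-cong-≗ λ u → sym (sum-*ʳ (prod ss) (λ v → 𝟙 (miss u v)))) ⟩
      sum (λ u → sum λ v → 𝟙 (miss u v) * prod ss)
        ≤⟨ sum-mono (λ u → sum-mono λ v → each u v (miss u v) refl) ⟩
      sum (λ u → sum λ v → 𝟙 (miss u v) * ∑V h (λ w → 𝟙 ⌊ injIn? (S u v) w ⌋))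
        ≡⟨ sum-cong-≗ (λ u → sum-cong-≗ λ v → sym (∑V-*ˡ h (𝟙 (miss u v)) (λ w → 𝟙 ⌊ injIn? (S u v) w ⌋))) ⟩
      sum (λ u → sum λ v → ∑V h (term u v))
        ≡⟨ sum-cong-≗ (λ u → sym (∑V-sum h (term u))) ⟩
      sum (λ u → ∑V h (λ w → sum λ v → term u v w))
        ≡⟨ sym (∑V-sum h (λ u w → sum λ v → term u v w)) ⟩
      ∑V h (λ w → sum λ u → sum λ v → term u v w)
        ≤⟨ ∑V-mono h (λ w → sum-mono λ u → sum-mono λ v → term≤ u v w) ⟩
      ∑V h (λ w → sum λ u → sum λ v → 𝟙 (lookup w i₀ == u) * (𝟙 (lookup w j₀ == v) * X w))
        ≡⟨ ∑V-cong h (λ w → trans (sum-cong-≗ λ u → sum-*ˡ (𝟙 (lookup w i₀ == u)) (λ v → 𝟙 (lookup w j₀ == v) * X w))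
                            (trans (sum-δ (lookup w i₀) (λ _ → sum λ v → 𝟙 (lookup w j₀ == v) * X w))
                                   (sum-δ (lookup w j₀) (λ _ → X w)))) ⟩
      lost  ∎
      where
      each : ∀ u v b → miss u v ≡ b → 𝟙 b * prod ss ≤ 𝟙 b * ∑V h (λ w → 𝟙 ⌊ injIn? (S u v) w ⌋)
      each u v false _ = z≤n
      each u v true  m = *-monoʳ-≤ 1 (inj-count h (S u v) ss (cond u v m))

  -- The ratio of `n ^ h` to `s ^ h` is at most `g ^ h`, so the factor `h * h * g ^ h` between the
  -- inner and the missing pairs suffices for `extra ≤ lost`.
  emb≤cut : ∀ s g → 0 < n → s + h + 2 ≤ # σ → s + h + 2 ≤ # (not ∘ σ) → n ≤ g * s →
    h * h * g ^ h * inner G σ ≤ missing G σ → emb H G ≤ emb H (cut σ)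
  emb≤cut s g n>0 large large′ n≤gs few = +-cancelʳ-≤ extra (emb H G) (emb H T) (≤-trans (+-monoʳ-≤ (emb H G) extra≤lost) emb-exchange)
    where
    open ≤-Reasoning
    ring₁ : ∀ h e n → h * (h * (e * n)) ≡ h * h * e * n
    ring₁ = solve-∀
    ring₂ : ∀ h e g s → h * h * e * (g * s) ≡ h * h * g * e * s
    ring₂ = solve-∀
    s≤n : s ≤ n
    s≤n = ≤-trans (≤-trans (m≤m+n s h) (m≤m+n (s + h) 2)) (≤-trans large (#≤n σ))
    extra≤lost : extra ≤ lost
    extra≤lost = *-cancelʳ-≤ extra lost (n * n) {{>-nonZero (*-mono-≤ n>0 n>0)}} (begin
      extra * (n * n)  ≤⟨ extra≤ ⟩
      h * (h * (inner G σ * n ^ h))  ≡⟨ ring₁ h (inner G σ) (n ^ h) ⟩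
      h * h * inner G σ * n ^ h  ≤⟨ *-monoʳ-≤ (h * h * inner G σ) (≤-trans (^-monoˡ-≤ h n≤gs) (≤-reflexive (^-distrib-* h g s))) ⟩
      h * h * inner G σ * (g ^ h * s ^ h)  ≡⟨ ring₂ h (inner G σ) (g ^ h) (s ^ h) ⟩
      h * h * g ^ h * inner G σ * s ^ h  ≤⟨ *-monoˡ-≤ (s ^ h) few ⟩
      missing G σ * s ^ h  ≤⟨ lost≥ s large large′ ⟩
      lost * (s * s)  ≤⟨ *-monoʳ-≤ lost (*-mono-≤ s≤n s≤n) ⟩
      lost * (n * n)  ∎)

  -- The two products count the maps whose sides follow `χ` or its complement. Such a map is an
  -- embedding unless two vertices collide, and each of at most `h * h` pairs collides in
  -- `n ^ (h - 1)` maps.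
  homs-cut : let p = # χ ; q = # (not ∘ χ) ; a = # σ ; b = # (not ∘ σ) in
    (a ^ p * b ^ q + a ^ q * b ^ p) * (n * n) ≤ emb H (cut σ) * (n * n) + h * (h * (n * n ^ h))
  homs-cut = begin
    (a ^ p * b ^ q + a ^ q * b ^ p) * (n * n)
      ≡⟨ cong (_* (n * n)) (sym (cong₂ _+_ (count χ) (trans (count (not ∘ χ)) (cong (λ z → a ^ q * b ^ z) (sum-cong-≗ (λ l → cong 𝟙 (not-involutive (χ l)))))))) ⟩
    (∑V h (λ v → Π₁ χ v) + ∑V h (λ v → Π₁ (not ∘ χ) v)) * (n * n)
      ≡⟨ cong (_* (n * n)) (sym (∑V-+ h (Π₁ χ) (Π₁ (not ∘ χ)))) ⟩
    ∑V h (λ v → Π₁ χ v + Π₁ (not ∘ χ) v) * (n * n)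
      ≤⟨ *-monoˡ-≤ (n * n) (∑V-mono h pointwise) ⟩
    ∑V h (λ v → 𝟙 (homᵇ H T v) + coll v) * (n * n)
      ≡⟨ cong (_* (n * n)) (∑V-+ h (𝟙 ∘ homᵇ H T) coll) ⟩
    (emb H T + ∑V h coll) * (n * n)
      ≡⟨ *-distribʳ-+ (n * n) (emb H T) (∑V h coll) ⟩
    emb H T * (n * n) + ∑V h coll * (n * n)
      ≡⟨ cong (λ z → emb H T * (n * n) + z * (n * n)) (trans (∑V-sum h (λ i v → sum (cc v i))) (sum-cong-≗ λ i → ∑V-sum h (λ j v → cc v i j))) ⟩
    emb H T * (n * n) + sum (λ i → sum λ j → ∑V h (λ v → cc v i j)) * (n * n)
      ≡⟨ cong (emb H T * (n * n) +_) (trans (sym (sum-*ʳ (n * n) (λ i → sum λ j → ∑V h (λ v → cc v i j)))) (sum-cong-≗ λ i → sym (sum-*ʳ (n * n) (λ j → ∑V h (λ v → cc v i j))))) ⟩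
    emb H T * (n * n) + sum (λ i → sum λ j → ∑V h (λ v → cc v i j) * (n * n))
      ≤⟨ +-monoʳ-≤ (emb H T * (n * n)) (sum-≤-const (λ i → sum-≤-const λ j → bound i j)) ⟩
    emb H T * (n * n) + h * (h * (n * n ^ h))  ∎
    where
    open ≤-Reasoning
    p = # χ
    q = # (not ∘ χ)
    a = # σ
    b = # (not ∘ σ)
    Π₁ : (Fin h → Bool) → Vec (Fin n) h → ℕ
    Π₁ ρ v = prod λ l → 𝟙 (side σ (ρ l) (lookup v l))
    #side : ∀ c → # (side σ c) ≡ (if c then a else b)
    #side true  = sum-cong-≗ (λ x → cong 𝟙 (not-involutive (σ x)))
    #side false = refl
    count : ∀ ρ → ∑V h (Π₁ ρ) ≡ a ^ # ρ * b ^ # (not ∘ ρ)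
    count ρ = trans (∑V-prod h (λ l x → 𝟙 (side σ (ρ l) x))) (trans (prod-cong (λ l → #side (ρ l))) (prod-two ρ a b))
    cc : Vec (Fin n) h → Fin h → Fin h → ℕ
    cc v i j = 𝟙 (not (i == j)) * 𝟙 (lookup v i == lookup v j)
    coll : Vec (Fin n) h → ℕ
    coll v = sum λ i → sum λ j → cc v i j
    bound : ∀ i j → ∑V h (λ v → cc v i j) * (n * n) ≤ n * n ^ h
    bound i j with i ≟ j
    ... | yes _ = ≤-trans (≤-reflexive (cong (_* (n * n)) (trans (∑V-const {n} h 0) (*-zeroʳ (n ^ h))))) z≤n
    ... | no ne = ≤-reflexive (trans (cong (_* (n * n)) (∑V-cong h (λ v → *-identityˡ (𝟙 (lookup v i == lookup v j)))))
                    (trans (∑V-pair h ne (λ x y → 𝟙 (x == y)))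
                           (cong (_* n ^ h) (trans (sum-cong-≗ {n} {λ x → sum (λ y → 𝟙 (x == y))} {λ _ → 1} sum-δ₁) (trans (sum-const n 1) (*-identityʳ n))))))
    Π₁≤1 : ∀ ρ v → Π₁ ρ v ≤ 1
    Π₁≤1 ρ v = prod-≤1 _ (λ l → 𝟙≤1 (side σ (ρ l) (lookup v l)))
    sides : ∀ ρ v → 0 < Π₁ ρ v → ∀ l → σ (lookup v l) ≡ ρ l
    sides ρ v pos l = side-eq (ρ l) (σ (lookup v l)) (𝟙-pos (prod-pos (λ l → 𝟙 (side σ (ρ l) (lookup v l))) pos l))
    hom-or-coll : ∀ v → (∀ i j → H i j ≡ true → σ (lookup v i) xor σ (lookup v j) ≡ true) → 1 ≤ 𝟙 (homᵇ H T v) + coll v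
    hom-or-coll v v-hom with any? (λ i → any? λ j → ¬? (i ≟ j) ×-dec (lookup v i ≟ lookup v j))
    ... | yes (i , j , ne , eq) = ≤-trans
      (*-mono-≤ (true⇒1≤𝟙 (cong not (==-≢ ne))) (true⇒1≤𝟙 (trans (cong (lookup v i ==_) (sym eq)) (==-refl (lookup v i)))))
      (≤-trans (term≤sum (cc v i) j) (≤-trans (term≤sum (λ i → sum (cc v i)) i) (m≤n+m (coll v) (𝟙 (homᵇ H T v)))))
    ... | no none = ≤-trans (true⇒1≤𝟙 (homᵇ-complete H T v (mkHom v-inj v-hom))) (m≤m+n _ (coll v))
      where
      v-inj : ∀ i j → lookup v i ≡ lookup v j → i ≡ j
      v-inj i j eq with i ≟ j
      ... | yes p = p
      ... | no ne = ⊥-elim (none (i , j , ne , eq))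
    not-xor-not : ∀ a b → not a xor not b ≡ a xor b
    not-xor-not true  b = refl
    not-xor-not false true  = refl
    not-xor-not false false = refl
    pointwise : ∀ v → Π₁ χ v + Π₁ (not ∘ χ) v ≤ 𝟙 (homᵇ H T v) + coll v
    pointwise v with Π₁ χ v in eq | Π₁≤1 χ v | Π₁ (not ∘ χ) v in eq′ | Π₁≤1 (not ∘ χ) v
    ... | zero  | _       | zero  | _       = z≤n
    ... | suc _ | s≤s z≤n | zero  | _       = hom-or-coll v λ i j e →
          trans (cong₂ _xor_ (sides χ v (subst (0 <_) (sym eq) (s≤s z≤n)) i) (sides χ v (subst (0 <_) (sym eq) (s≤s z≤n)) j)) (proper i j e)
    ... | zero  | _       | suc _ | s≤s z≤n = hom-or-coll v λ i j e →
          trans (cong₂ _xor_ (sides (not ∘ χ) v (subst (0 <_) (sym eq′) (s≤s z≤n)) i) (sides (not ∘ χ) v (subst (0 <_) (sym eq′) (s≤s z≤n)) j))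
                (trans (not-xor-not (χ i) (χ j)) (proper i j e))
    -- No map is counted in both products: `i₀` would lie on both sides.
    ... | suc _ | _       | suc _ | _       = ⊥-elim (not-¬ {χ i₀} refl
          (trans (sym (sides χ v (subst (0 <_) (sym eq) (s≤s z≤n)) i₀)) (sides (not ∘ χ) v (subst (0 <_) (sym eq′) (s≤s z≤n)) i₀)))

-- AM-GM without roots

-- Weighted AM-GM with `z` taken once and `w` taken `m` times. The induction step is the
-- rearrangement inequality for `z`, `w` and their powers.
young : ∀ m z w → suc m * (z * w ^ m) ≤ z ^ suc m + m * w ^ suc m
young zero z w = ≤-reflexive (ring z)
  where
  ring : ∀ z → 1 * (z * 1) ≡ z * 1 + 0
  ring = solve-∀
young (suc m) z w = begin
  suc (suc m) * (z * (w * w ^ m))  ≡⟨ ring₁ m z w (w ^ m) ⟩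
  w * (suc m * (z * w ^ m)) + z * (w * w ^ m)  ≤⟨ +-monoˡ-≤ _ (*-monoʳ-≤ w (young m z w)) ⟩
  w * (z ^ suc m + m * w ^ suc m) + z * (w * w ^ m)  ≡⟨ ring₂ m z w (z ^ suc m) (w ^ suc m) ⟩
  (w * z ^ suc m + z * w ^ suc m) + m * (w * w ^ suc m)  ≤⟨ +-monoˡ-≤ (m * (w * w ^ suc m)) (rearrange (suc m)) ⟩
  (z * z ^ suc m + w * w ^ suc m) + m * (w * w ^ suc m)  ≡⟨ ring₃ m (z * z ^ suc m) (w * w ^ suc m) ⟩
  z * z ^ suc m + suc m * (w * w ^ suc m)  ∎
  where
  open ≤-Reasoning
  ring₁ : ∀ m z w x → suc (suc m) * (z * (w * x)) ≡ w * (suc m * (z * x)) + z * (w * x)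
  ring₁ = solve-∀
  ring₂ : ∀ m z w x y → w * (x + m * y) + z * y ≡ (w * x + z * y) + m * (w * y)
  ring₂ = solve-∀
  ring₃ : ∀ m x y → x + y + m * y ≡ x + suc m * y
  ring₃ = solve-∀
  rearr : ∀ {z w a b} → z ≤ w → a ≤ b → w * a + z * b ≤ z * a + w * b
  rearr {z} {w} {a} {b} z≤w a≤b with m≤n⇒∃[o]m+o≡n z≤w | m≤n⇒∃[o]m+o≡n a≤b
  ... | c , refl | e , refl = ≤-trans (m≤m+n _ (c * e)) (≤-reflexive (ring z c a e))
    where
    ring : ∀ z c a e → (z + c) * a + z * (a + e) + c * e ≡ z * a + (z + c) * (a + e)
    ring = solve-∀
  rearrange : ∀ k → w * z ^ k + z * w ^ k ≤ z * z ^ k + w * w ^ k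
  rearrange k with ≤-total z w
  ... | inj₁ z≤w = rearr z≤w (^-monoˡ-≤ k z≤w)
  ... | inj₂ w≤z = ≤-trans (≤-reflexive (+-comm (w * z ^ k) (z * w ^ k)))
                     (≤-trans (rearr w≤z (^-monoˡ-≤ k w≤z)) (≤-reflexive (+-comm (w * w ^ k) (z * z ^ k))))

-- Stated for `# S`-th powers, so that no roots occur. In the induction the bound for the remaining
-- indices is multiplied by `z₀`, and `young` splits each mixed term into pure powers.
amgm : ∀ {h} (S : Fin h → Bool) (z : Fin h → ℕ) →
  # S * prod (λ l → if S l then z l else 1) ≤ sum (λ l → 𝟙 (S l) * z l ^ # S)
amgm {zero}  S z = z≤n
amgm {suc h} S z with S zero
... | false = ≤-trans (≤-reflexive (cong (# (S ∘ suc) *_) (*-identityˡ _))) (amgm (S ∘ suc) (z ∘ suc))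
... | true  = step (# (S ∘ suc)) refl
  where
  open ≤-Reasoning
  S′ = S ∘ suc
  z₀ = z zero
  P = prod (λ l → if S′ l then z (suc l) else 1)
  P≡1 : # S′ ≡ 0 → P ≡ 1
  P≡1 eq = prod-one _ λ l → cong (if_then z (suc l) else 1) (none l)
    where
    none : ∀ l → S′ l ≡ false
    none l with S′ l in e
    ... | false = refl
    ... | true with () ← ≤-trans (true⇒1≤𝟙 e) (≤-trans (term≤sum (𝟙 ∘ S′) l) (≤-reflexive eq))
  step : ∀ m → # S′ ≡ m → suc m * (z₀ * P) ≤ 1 * z₀ ^ suc m + sum (λ l → 𝟙 (S′ l) * z (suc l) ^ suc m)
  step zero eq = begin
    1 * (z₀ * P)  ≡⟨ cong (λ t → 1 * (z₀ * t)) (P≡1 eq) ⟩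
    1 * (z₀ * 1)  ≤⟨ m≤m+n _ _ ⟩
    1 * z₀ ^ 1 + sum (λ l → 𝟙 (S′ l) * z (suc l) ^ 1)  ∎
  step (suc k) eq = *-cancelˡ-≤ (suc k) (begin
    suc k * (suc (suc k) * (z₀ * P))  ≡⟨ ring₁ (suc k) z₀ P ⟩
    suc (suc k) * z₀ * (suc k * P)  ≤⟨ *-monoʳ-≤ (suc (suc k) * z₀) ih ⟩
    suc (suc k) * z₀ * sum (λ l → 𝟙 (S′ l) * z (suc l) ^ suc k)
      ≡⟨ sym (sum-*ˡ (suc (suc k) * z₀) (λ l → 𝟙 (S′ l) * z (suc l) ^ suc k)) ⟩
    sum (λ l → suc (suc k) * z₀ * (𝟙 (S′ l) * z (suc l) ^ suc k))
      ≤⟨ sum-mono (λ l → ≤-trans (≤-reflexive (ring₂ (suc (suc k)) z₀ (𝟙 (S′ l)) (z (suc l) ^ suc k)))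
                                 (≤-trans (*-monoʳ-≤ (𝟙 (S′ l)) (young (suc k) z₀ (z (suc l))))
                                          (≤-reflexive (ring₃ (suc k) (𝟙 (S′ l)) (z₀ ^ suc (suc k)) (z (suc l) ^ suc (suc k)))))) ⟩
    sum (λ l → z₀ ^ suc (suc k) * 𝟙 (S′ l) + suc k * (𝟙 (S′ l) * z (suc l) ^ suc (suc k)))
      ≡⟨ trans (sum-+ (λ l → z₀ ^ suc (suc k) * 𝟙 (S′ l)) (λ l → suc k * (𝟙 (S′ l) * z (suc l) ^ suc (suc k))))
               (cong₂ _+_ (trans (sum-*ˡ (z₀ ^ suc (suc k)) (𝟙 ∘ S′)) (cong (z₀ ^ suc (suc k) *_) eq))
                          (sum-*ˡ (suc k) (λ l → 𝟙 (S′ l) * z (suc l) ^ suc (suc k)))) ⟩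
    z₀ ^ suc (suc k) * suc k + suc k * sum (λ l → 𝟙 (S′ l) * z (suc l) ^ suc (suc k))
      ≡⟨ ring₄ (suc k) (z₀ ^ suc (suc k)) (sum (λ l → 𝟙 (S′ l) * z (suc l) ^ suc (suc k))) ⟩
    suc k * (1 * z₀ ^ suc (suc k) + sum (λ l → 𝟙 (S′ l) * z (suc l) ^ suc (suc k)))  ∎)
    where
    ih : suc k * P ≤ sum (λ l → 𝟙 (S′ l) * z (suc l) ^ suc k)
    ih = subst (λ m → m * P ≤ sum (λ l → 𝟙 (S′ l) * z (suc l) ^ m)) eq (amgm S′ (z ∘ suc))
    ring₁ : ∀ k z p → k * (suc k * (z * p)) ≡ suc k * z * (k * p)
    ring₁ = solve-∀
    ring₂ : ∀ k z s x → k * z * (s * x) ≡ s * (k * (z * x))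
    ring₂ = solve-∀
    ring₃ : ∀ k s x y → s * (x + k * y) ≡ x * s + k * (s * y)
    ring₃ = solve-∀
    ring₄ : ∀ k x y → x * k + k * y ≡ k * (1 * x + y)
    ring₄ = solve-∀

-- The index i only matters when S is empty.
amgm′ : ∀ {h} (S : Fin h → Bool) (i : Fin h) →
  Σ (Fin h → Bool) λ S° → 1 ≤ # S° × (∀ l → S° l ≡ true → S l ≡ true ⊎ i ≡ l) ×
    (∀ z → # S° * prod (λ l → if S l then z l else 1) ≤ sum (λ l → 𝟙 (S° l) * z l ^ # S))
amgm′ S i with # S in eq
... | suc m = S , subst (1 ≤_) (sym eq) (s≤s z≤n) , (λ l → inj₁) , λ z → subst (λ m → # S * prod (λ l → if S l then z l else 1) ≤ sum (λ l → 𝟙 (S l) * z l ^ m)) eq (amgm S z)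
... | zero  = (i ==_) , ≤-reflexive (sym (sum-δ₁ i)) , (λ l e → inj₂ (==-sound e)) , λ z → ≤-reflexive (begin
    # (i ==_) * prod (λ l → if S l then z l else 1)  ≡⟨ cong₂ _*_ (sum-δ₁ i) (prod-one _ λ l → cong (if_then z l else 1) (none l)) ⟩
    1  ≡⟨ sym (sum-δ i (λ _ → 1)) ⟩
    sum (λ l → 𝟙 (i == l) * 1)  ∎)
  where
  open ≡-Reasoning
  none : ∀ l → S l ≡ false
  none l with S l in e
  ... | false = refl
  ... | true with () ← ≤-trans (true⇒1≤𝟙 e) (≤-trans (term≤sum (𝟙 ∘ S) l) (≤-reflexive eq))

-- Embeddings of `H` bounded by a sum over edges

record DominatingBiclique {h} (H : Graph h) : Set where
  field
    bipartite : Bipartite H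
  open Bipartite bipartite public
  field
    κ          : Fin h → Bool
    κ-complete : ∀ i j → κ i ≡ true → κ j ≡ true → χ i ≡ true → χ j ≡ false → H i j ≡ true
    nb         : Fin h → Fin h
    κ-nb       : ∀ l → κ (nb l) ≡ true
    nb-edge    : ∀ l → H l (nb l) ≡ true
    χi₀        : χ i₀ ≡ true

  χj₀ : χ j₀ ≡ false
  χj₀ = trans (xor≡true {χ i₀} (proper i₀ j₀ i₀j₀-edge)) (cong not χi₀)

-- Homomorphisms of a double star: adjacent centres `u` and `v`, with `p` leaves at `v` and `q`
-- leaves at `u`. An edge of `H` leaves `p` and `q` further vertices in the two colours.
edgeWeight : ∀ {n} → Graph n → ℕ → ℕ → ℕ
edgeWeight G p q = sum λ u → sum λ v → 𝟙 (G u v) * (deg G v ^ p * deg G u ^ q)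

module _ {h : ℕ} {H : Graph h} (dom : DominatingBiclique H) {n : ℕ} (G : Graph n) (G-simple : IsSimple G) (z₀ : Fin n)
  (p q : ℕ) (p≡ : # (DominatingBiclique.χ dom) ≡ suc p) (q≡ : # (not ∘ DominatingBiclique.χ dom) ≡ suc q) where
  open DominatingBiclique dom
  private
    d : Fin n → ℕ
    d = deg G
    G-sym = proj₁ G-simple

    Biclique-hom : Vec (Fin n) h → Set
    Biclique-hom g = ∀ i j → κ i ≡ true × κ j ≡ true × χ i ≡ true × χ j ≡ false → G (lookup g i) (lookup g j) ≡ true
    bic? : ∀ g → Dec (Biclique-hom g)
    bic? g = all? λ i → all? λ j →
      ((κ i Bool.≟ true) ×-dec (κ j Bool.≟ true) ×-dec (χ i Bool.≟ true) ×-dec (χ j Bool.≟ false)) →-dec (G (lookup g i) (lookup g j) Bool.≟ true)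
    kb : Vec (Fin n) h → ℕ
    kb g = 𝟙 ⌊ bic? g ⌋

    off : Vec (Fin n) h → Fin h → ℕ
    off g l = if κ l then 1 else 𝟙 (z₀ == lookup g l)
    A B : Fin h → Bool
    A l = not (κ l) ∧ χ l
    B l = not (κ l) ∧ not (χ l)
    nbd : Vec (Fin n) h → Fin h → ℕ
    nbd g l = d (lookup g (nb l))
    pend : Vec (Fin n) h → ℕ
    pend g = prod λ l → if κ l then 1 else 𝟙 (z₀ == lookup g l) * nbd g l

    α = # A
    β = # B

    -- A homomorphism f of H is split into its restriction g to the biclique (set to z₀ elsewhere)
    -- and the images of the other vertices, which are neighbours of vertices g (nb l).
    emb≤pend : emb H G ≤ ∑V h λ g → kb g * pend g
    emb≤pend = begin
      emb H G
        ≡⟨ ∑V-cong h (λ f → sym (trans (cong (𝟙 (homᵇ H G f) *_) (masks f)) (*-identityʳ _))) ⟩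
      ∑V h (λ f → 𝟙 (homᵇ H G f) * ∑V h (λ g → prod λ l → 𝟙 (mask f l == lookup g l)))
        ≡⟨ ∑V-cong h (λ f → sym (∑V-*ˡ h (𝟙 (homᵇ H G f)) (λ g → prod λ l → 𝟙 (mask f l == lookup g l)))) ⟩
      ∑V h (λ f → ∑V h λ g → 𝟙 (homᵇ H G f) * prod λ l → 𝟙 (mask f l == lookup g l))
        ≤⟨ ∑V-mono h (λ f → ∑V-mono h λ g → pointwise f g) ⟩
      ∑V h (λ f → ∑V h λ g → kb g * prod λ l → W g l (lookup f l))
        ≡⟨ ∑V-comm h h (λ f g → kb g * prod λ l → W g l (lookup f l)) ⟩
      ∑V h (λ g → ∑V h λ f → kb g * prod λ l → W g l (lookup f l))
        ≡⟨ ∑V-cong h (λ g → trans (∑V-*ˡ h (kb g) (λ f → prod λ l → W g l (lookup f l)))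
                                  (cong (kb g *_) (trans (∑V-prod h (W g)) (prod-cong (W-sum g))))) ⟩
      ∑V h (λ g → kb g * pend g)  ∎
      where
      open ≤-Reasoning
      mask : Vec (Fin n) h → Fin h → Fin n
      mask f l = if κ l then lookup f l else z₀
      masks : ∀ f → ∑V h (λ g → prod λ l → 𝟙 (mask f l == lookup g l)) ≡ 1
      masks f = trans (∑V-prod h (λ l x → 𝟙 (mask f l == x))) (prod-one _ λ l → sum-δ₁ (mask f l))
      W : Vec (Fin n) h → Fin h → Fin n → ℕ
      W g l x = if κ l then 𝟙 (lookup g l == x) else 𝟙 (z₀ == lookup g l) * 𝟙 (G (lookup g (nb l)) x)
      W-sum : ∀ g l → sum (W g l) ≡ (if κ l then 1 else 𝟙 (z₀ == lookup g l) * nbd g l)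
      W-sum g l with κ l
      ... | true  = sum-δ₁ (lookup g l)
      ... | false = sum-*ˡ (𝟙 (z₀ == lookup g l)) (λ x → 𝟙 (G (lookup g (nb l)) x))
      pointwise : ∀ f g → 𝟙 (homᵇ H G f) * (prod λ l → 𝟙 (mask f l == lookup g l)) ≤ kb g * prod λ l → W g l (lookup f l)
      pointwise f g = 01-≤ (*-mono-≤ (𝟙≤1 (homᵇ H G f)) (prod-≤1 _ λ l → 𝟙≤1 (mask f l == lookup g l))) λ pos →
        let (p₁ , p₂) = *-pos {𝟙 (homᵇ H G f)} pos
            f-hom     = IsHom.hom (homᵇ-sound H G f (𝟙-pos p₁))
            same : ∀ l → mask f l ≡ lookup g l
            same l = ==-sound (𝟙-pos (prod-pos (λ l → 𝟙 (mask f l == lookup g l)) p₂ l))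
            same-κ : ∀ l → κ l ≡ true → lookup f l ≡ lookup g l
            same-κ l k = trans (sym (cong (if_then lookup f l else z₀) k)) (same l)
        in *-mono-≤ (true⇒1≤𝟙 (⌊⌋-complete (bic? g) λ { i j (ki , kj , ci , cj) →
               trans (cong₂ G (sym (same-κ i ki)) (sym (same-κ j kj))) (f-hom i j (κ-complete i j ki kj ci cj)) }))
             (prod-≥1 (λ l → W g l (lookup f l)) λ l → W≥1 f g l (κ l) refl (same l)
               (trans (cong (λ z → G z (lookup f l)) (sym (same-κ (nb l) (κ-nb l)))) (trans (G-sym _ _) (f-hom l (nb l) (nb-edge l)))))
        where
        W≥1 : ∀ f g l b → κ l ≡ b → (if κ l then lookup f l else z₀) ≡ lookup g l → G (lookup g (nb l)) (lookup f l) ≡ true → 1 ≤ W g l (lookup f l)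
        W≥1 f g l true  k s e rewrite k = true⇒1≤𝟙 (trans (cong (lookup g l ==_) s) (==-refl (lookup g l)))
        W≥1 f g l false k s e rewrite k = *-mono-≤ (true⇒1≤𝟙 (trans (cong (z₀ ==_) (sym s)) (==-refl z₀))) (true⇒1≤𝟙 e)

    pend-split : ∀ g → pend g ≡ prod (off g) * (prod (λ l → if A l then nbd g l else 1) * prod (λ l → if B l then nbd g l else 1))
    pend-split g = begin
      pend g
        ≡⟨ prod-cong (λ l → cases (κ l) (χ l) (𝟙 (z₀ == lookup g l)) (nbd g l)) ⟩
      prod (λ l → off g l * ((if A l then nbd g l else 1) * (if B l then nbd g l else 1)))
        ≡⟨ trans (prod-distrib-* (off g) (λ l → (if A l then nbd g l else 1) * (if B l then nbd g l else 1)))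
                 (cong (prod (off g) *_) (prod-distrib-* (λ l → if A l then nbd g l else 1) (λ l → if B l then nbd g l else 1))) ⟩
      prod (off g) * (prod (λ l → if A l then nbd g l else 1) * prod (λ l → if B l then nbd g l else 1))  ∎
      where
      open ≡-Reasoning
      cases : ∀ k c o x → (if k then 1 else o * x) ≡ (if k then 1 else o) * ((if not k ∧ c then x else 1) * (if not k ∧ not c then x else 1))
      cases true  c     o x = refl
      cases false true  o x = cong (o *_) (sym (*-identityʳ x))
      cases false false o x = cong (o *_) (sym (*-identityˡ x))

    -- After AM-GM all outer vertices hang at one biclique vertex of each colour, `i` and `j`. With
    -- these at `u` and `v`, every other biclique vertex of colour `true` lies in the neighbourhood
    -- of `v` and every other one of colour `false` in that of `u`, so the exponents add up to `p`
    -- and `q`.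
    core : ∀ i j → κ i ≡ true → κ j ≡ true → χ i ≡ true → χ j ≡ false →
      ∑V h (λ g → kb g * prod (off g) * (d (lookup g j) ^ α * d (lookup g i) ^ β)) ≤ edgeWeight G p q
    core i j κi κj χi χj = begin
      ∑V h (λ g → kb g * prod (off g) * (d (lookup g j) ^ α * d (lookup g i) ^ β))
        ≤⟨ ∑V-mono h pointwise ⟩
      ∑V h (λ g → sum λ u → sum λ v → coef u v * prod λ l → W u v l (lookup g l))
        ≡⟨ trans (∑V-sum h (λ u g → sum λ v → coef u v * prod λ l → W u v l (lookup g l)))
                 (sum-cong-≗ λ u → trans (∑V-sum h (λ v g → coef u v * prod λ l → W u v l (lookup g l)))
                 (sum-cong-≗ λ v → trans (∑V-*ˡ h (coef u v) (λ g → prod λ l → W u v l (lookup g l)))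
                                         (cong (coef u v *_) (trans (∑V-prod h (W u v)) (prod-cong (W-sum u v)))))) ⟩
      sum (λ u → sum λ v → coef u v * prod (c u v))
        ≡⟨ sum-cong-≗ (λ u → sum-cong-≗ λ v → weigh u v (G u v) refl) ⟩
      edgeWeight G p q  ∎
      where
      open ≤-Reasoning
      coef : Fin n → Fin n → ℕ
      coef u v = 𝟙 (G u v) * (d v ^ α * d u ^ β)
      W : Fin n → Fin n → Fin h → Fin n → ℕ
      W u v l x = if i == l then 𝟙 (u == x) else (if j == l then 𝟙 (v == x) else
                  (if κ l then (if χ l then 𝟙 (G v x) else 𝟙 (G u x)) else 𝟙 (z₀ == x)))
      c₂ c₁ c : Fin n → Fin n → Fin h → ℕ
      c₂ u v l = if κ l then (if χ l then d v else d u) else 1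
      c₁ u v l = if j == l then 1 else c₂ u v l
      c  u v l = if i == l then 1 else c₁ u v l
      W-sum : ∀ u v l → sum (W u v l) ≡ c u v l
      W-sum u v l with i == l | j == l | κ l | χ l
      ... | true  | _     | _     | _     = sum-δ₁ u
      ... | false | true  | _     | _     = sum-δ₁ v
      ... | false | false | true  | true  = refl
      ... | false | false | true  | false = refl
      ... | false | false | false | _     = sum-δ₁ z₀
      i≢j′ : i ≢ j
      i≢j′ refl with () ← trans (sym χi) χj
      pointwise : ∀ g → kb g * prod (off g) * (d (lookup g j) ^ α * d (lookup g i) ^ β)
                      ≤ sum λ u → sum λ v → coef u v * prod λ l → W u v l (lookup g l)
      pointwise g = ≤-trans
        (≤-trans (*-monoˡ-≤ (d (lookup g j) ^ α * d (lookup g i) ^ β)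
          (01-≤ {b = 𝟙 (G u v) * (prod λ l → W u v l (lookup g l))}
            (*-mono-≤ (𝟙≤1 ⌊ bic? g ⌋) (prod-≤1 (off g) off≤1)) unit))
          (≤-reflexive (ring (𝟙 (G u v)) (prod λ l → W u v l (lookup g l)) (d v ^ α * d u ^ β))))
        (≤-trans (term≤sum (λ v → coef u v * prod λ l → W u v l (lookup g l)) v)
                 (term≤sum (λ u → sum λ v → coef u v * prod λ l → W u v l (lookup g l)) u))
        where
        u v : Fin n
        u = lookup g i
        v = lookup g j
        ring : ∀ a b x → a * b * x ≡ a * x * b
        ring = solve-∀
        off≤1 : ∀ l → off g l ≤ 1
        off≤1 l with κ l
        ... | true  = ≤-refl
        ... | false = 𝟙≤1 (z₀ == lookup g l)
        unit : 0 < kb g * prod (off g) → 1 ≤ 𝟙 (G u v) * prod λ l → W u v l (lookup g l)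
        unit pos = *-mono-≤ (true⇒1≤𝟙 (bic i j (κi , κj , χi , χj))) (prod-≥1 (λ l → W u v l (lookup g l)) W≥1)
          where
          bic : Biclique-hom g
          bic = ⌊⌋-sound (bic? g) (𝟙-pos (proj₁ (*-pos {kb g} pos)))
          off>0 : ∀ l → 0 < off g l
          off>0 = prod-pos (off g) (proj₂ (*-pos {kb g} pos))
          W≥1 : ∀ l → 1 ≤ W u v l (lookup g l)
          W≥1 l with i ≟ l | j ≟ l | κ l in κl | χ l in χl | off>0 l
          ... | yes refl | _        | _     | _     | _ = true⇒1≤𝟙 (==-refl u)
          ... | no _     | yes refl | _     | _     | _ = true⇒1≤𝟙 (==-refl v)
          ... | no _     | no _     | true  | true  | _ = true⇒1≤𝟙 (trans (G-sym v (lookup g l)) (bic l j (κl , κj , χl , χj)))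
          ... | no _     | no _     | true  | false | _ = true⇒1≤𝟙 (bic i l (κi , κl , χi , χl))
          ... | no _     | no _     | false | _     | o = o
      -- Multiplying by `d v * d u` restores the factors that `c` sets to 1 at `i` and `j`; the edge
      -- `uv` makes both degrees positive, so they can be cancelled again.
      weigh : ∀ u v b → G u v ≡ b → 𝟙 b * (d v ^ α * d u ^ β) * prod (c u v) ≡ 𝟙 b * (d v ^ p * d u ^ q)
      weigh u v false _ = refl
      weigh u v true  e = trans (cong (_* prod (c u v)) (*-identityˡ (d v ^ α * d u ^ β)))
        (trans (*-cancelʳ-≡ _ _ (d v * d u) {{>-nonZero (*-mono-≤ dv>0 du>0)}} exact) (sym (*-identityˡ (d v ^ p * d u ^ q))))
        where
        du>0 : 0 < d u
        du>0 = ≤-trans (true⇒1≤𝟙 e) (term≤sum (𝟙 ∘ G u) v)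
        dv>0 : 0 < d v
        dv>0 = ≤-trans (true⇒1≤𝟙 (trans (G-sym v u) e)) (term≤sum (𝟙 ∘ G v) u)
        c₁i : c₁ u v i ≡ d v
        c₁i rewrite ==-≢ (i≢j′ ∘ sym) | κi | χi = refl
        c₂j : c₂ u v j ≡ d u
        c₂j rewrite κj | χj = refl
        prod-c : prod (c u v) * d v * d u ≡ prod (c₂ u v)
        prod-c = begin-equality
          prod (c u v) * d v * d u  ≡⟨ cong (λ t → prod (c u v) * t * d u) (sym c₁i) ⟩
          prod (c u v) * c₁ u v i * d u  ≡⟨ cong (_* d u) (trans (prod-update i 1 (c₁ u v)) (*-identityˡ (prod (c₁ u v)))) ⟩
          prod (c₁ u v) * d u  ≡⟨ cong (prod (c₁ u v) *_) (sym c₂j) ⟩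
          prod (c₁ u v) * c₂ u v j  ≡⟨ trans (prod-update j 1 (c₂ u v)) (*-identityˡ (prod (c₂ u v))) ⟩
          prod (c₂ u v)  ∎
        power : ∀ (S : Fin h → Bool) x → prod (λ l → if S l then x else 1) ≡ x ^ # S
        power S x = trans (prod-two S x 1) (trans (cong (x ^ # S *_) (^-zeroˡ (# (not ∘ S)))) (*-identityʳ (x ^ # S)))
        cases : ∀ k χ x y → (if k then (if χ then x else y) else 1) * ((if not k ∧ χ then x else 1) * (if not k ∧ not χ then y else 1)) ≡ (if χ then x else y)
        cases true  true  x y = *-identityʳ x
        cases true  false x y = *-identityʳ y
        cases false true  x y = trans (*-identityˡ _) (*-identityʳ x)
        cases false false x y = trans (*-identityˡ _) (*-identityˡ y)
        combine : prod (c₂ u v) * (d v ^ α * d u ^ β) ≡ d v ^ suc p * d u ^ suc q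
        combine = begin-equality
          prod (c₂ u v) * (d v ^ α * d u ^ β)
            ≡⟨ cong (prod (c₂ u v) *_) (sym (cong₂ _*_ (power A (d v)) (power B (d u)))) ⟩
          prod (c₂ u v) * (prod (λ l → if A l then d v else 1) * prod (λ l → if B l then d u else 1))
            ≡⟨ sym (trans (prod-distrib-* (c₂ u v) (λ l → (if A l then d v else 1) * (if B l then d u else 1)))
                          (cong (prod (c₂ u v) *_) (prod-distrib-* (λ l → if A l then d v else 1) (λ l → if B l then d u else 1)))) ⟩
          prod (λ l → c₂ u v l * ((if A l then d v else 1) * (if B l then d u else 1)))
            ≡⟨ prod-cong (λ l → cases (κ l) (χ l) (d v) (d u)) ⟩
          prod (λ l → if χ l then d v else d u)
            ≡⟨ trans (prod-two χ (d v) (d u)) (cong₂ (λ s t → d v ^ s * d u ^ t) p≡ q≡) ⟩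
          d v ^ suc p * d u ^ suc q  ∎
        exact : d v ^ α * d u ^ β * prod (c u v) * (d v * d u) ≡ d v ^ p * d u ^ q * (d v * d u)
        exact = begin-equality
          d v ^ α * d u ^ β * prod (c u v) * (d v * d u)  ≡⟨ reorder (d v ^ α * d u ^ β) (prod (c u v)) (d v) (d u) ⟩
          prod (c u v) * d v * d u * (d v ^ α * d u ^ β)  ≡⟨ cong (_* (d v ^ α * d u ^ β)) prod-c ⟩
          prod (c₂ u v) * (d v ^ α * d u ^ β)  ≡⟨ combine ⟩
          d v * d v ^ p * (d u * d u ^ q)  ≡⟨ reorder′ (d v) (d v ^ p) (d u) (d u ^ q) ⟩
          d v ^ p * d u ^ q * (d v * d u)  ∎
          where
          reorder : ∀ x c s t → x * c * (s * t) ≡ c * s * t * x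
          reorder = solve-∀
          reorder′ : ∀ s x t y → s * x * (t * y) ≡ x * y * (s * t)
          reorder′ = solve-∀

  -- The outer vertices of one colour contribute a product of degrees at various biclique vertices.
  -- AM-GM replaces it by an average of pure powers, and each choice of one power per colour is an
  -- instance of `core`. If a colour has no outer vertices, `A°` or `B°` is the singleton of `i₀` or
  -- `j₀`, so no average is empty.
  emb≤edgeWeight : emb H G ≤ edgeWeight G p q
  emb≤edgeWeight =
    let (A° , A°≥1 , A°⊆ , A-amgm) = amgm′ A i₀
        (B° , B°≥1 , B°⊆ , B-amgm) = amgm′ B j₀
        a = # A°
        b = # B°
        χA : ∀ l → A° l ≡ true → χ l ≡ true
        χA l e = case A°⊆ l e of λ { (inj₁ Al) → proj₂ (∧-true {not (κ l)} Al) ; (inj₂ refl) → χi₀ }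
        χB : ∀ l → B° l ≡ true → χ l ≡ false
        χB l e = case B°⊆ l e of λ { (inj₁ Bl) → not-true (proj₂ (∧-true {not (κ l)} Bl)) ; (inj₂ refl) → χj₀ }
        X : Fin h → Fin h → Vec (Fin n) h → ℕ
        X l m g = kb g * prod (off g) * (nbd g l ^ α * nbd g m ^ β)
        per-g : ∀ g → a * b * (kb g * pend g) ≤ sum λ l → sum λ m → 𝟙 (A° l) * 𝟙 (B° m) * X l m g
        per-g g = begin
          a * b * (kb g * pend g)
            ≡⟨ cong (λ t → a * b * (kb g * t)) (pend-split g) ⟩
          a * b * (kb g * (prod (off g) * (ΠA g * ΠB g)))
            ≡⟨ ring₁ a b (kb g) (prod (off g)) (ΠA g) (ΠB g) ⟩
          kb g * prod (off g) * (a * ΠA g * (b * ΠB g))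
            ≤⟨ *-monoʳ-≤ (kb g * prod (off g)) (*-mono-≤ (A-amgm (nbd g)) (B-amgm (nbd g))) ⟩
          kb g * prod (off g) * (sum (λ l → 𝟙 (A° l) * nbd g l ^ α) * sum (λ m → 𝟙 (B° m) * nbd g m ^ β))
            ≡⟨ cong (kb g * prod (off g) *_) (trans (sym (sum-*ʳ (sum (λ m → 𝟙 (B° m) * nbd g m ^ β)) (λ l → 𝟙 (A° l) * nbd g l ^ α)))
                   (sum-cong-≗ λ l → sym (sum-*ˡ (𝟙 (A° l) * nbd g l ^ α) (λ m → 𝟙 (B° m) * nbd g m ^ β)))) ⟩
          kb g * prod (off g) * sum (λ l → sum λ m → 𝟙 (A° l) * nbd g l ^ α * (𝟙 (B° m) * nbd g m ^ β))
            ≡⟨ sym (trans (sum-cong-≗ λ l → sum-*ˡ (kb g * prod (off g)) (λ m → 𝟙 (A° l) * nbd g l ^ α * (𝟙 (B° m) * nbd g m ^ β)))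
                          (sum-*ˡ (kb g * prod (off g)) (λ l → sum λ m → 𝟙 (A° l) * nbd g l ^ α * (𝟙 (B° m) * nbd g m ^ β)))) ⟩
          sum (λ l → sum λ m → kb g * prod (off g) * (𝟙 (A° l) * nbd g l ^ α * (𝟙 (B° m) * nbd g m ^ β)))
            ≡⟨ sum-cong-≗ (λ l → sum-cong-≗ λ m → ring₂ (kb g * prod (off g)) (𝟙 (A° l)) (nbd g l ^ α) (𝟙 (B° m)) (nbd g m ^ β)) ⟩
          sum (λ l → sum λ m → 𝟙 (A° l) * 𝟙 (B° m) * X l m g)  ∎
        each : ∀ l m → ∑V h (λ g → 𝟙 (A° l) * 𝟙 (B° m) * X l m g) ≤ 𝟙 (A° l) * 𝟙 (B° m) * edgeWeight G p q
        each l m = ≤-trans (≤-reflexive (∑V-*ˡ h (𝟙 (A° l) * 𝟙 (B° m)) (X l m)))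
          (guarded (A° l) (B° m) (λ e e′ → core (nb m) (nb l) (κ-nb m) (κ-nb l)
            (trans (xor≡true {χ m} (proper m (nb m) (nb-edge m))) (cong not (χB m e′)))
            (trans (xor≡true {χ l} (proper l (nb l) (nb-edge l))) (cong not (χA l e)))))
    in *-cancelˡ-≤ (a * b) {{>-nonZero (*-mono-≤ A°≥1 B°≥1)}} (begin
      a * b * emb H G
        ≤⟨ *-monoʳ-≤ (a * b) emb≤pend ⟩
      a * b * ∑V h (λ g → kb g * pend g)
        ≡⟨ sym (∑V-*ˡ h (a * b) (λ g → kb g * pend g)) ⟩
      ∑V h (λ g → a * b * (kb g * pend g))
        ≤⟨ ∑V-mono h per-g ⟩
      ∑V h (λ g → sum λ l → sum λ m → 𝟙 (A° l) * 𝟙 (B° m) * X l m g)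
        ≡⟨ trans (∑V-sum h (λ l g → sum λ m → 𝟙 (A° l) * 𝟙 (B° m) * X l m g))
                 (sum-cong-≗ λ l → ∑V-sum h (λ m g → 𝟙 (A° l) * 𝟙 (B° m) * X l m g)) ⟩
      sum (λ l → sum λ m → ∑V h (λ g → 𝟙 (A° l) * 𝟙 (B° m) * X l m g))
        ≤⟨ sum-mono (λ l → sum-mono λ m → each l m) ⟩
      sum (λ l → sum λ m → 𝟙 (A° l) * 𝟙 (B° m) * edgeWeight G p q)
        ≡⟨ trans (sum-cong-≗ λ l → trans (sum-*ʳ (edgeWeight G p q) (λ m → 𝟙 (A° l) * 𝟙 (B° m))) (cong (_* edgeWeight G p q) (sum-*ˡ (𝟙 (A° l)) (𝟙 ∘ B°))))
                 (trans (sum-*ʳ (edgeWeight G p q) (λ l → 𝟙 (A° l) * b)) (cong (_* edgeWeight G p q) (sum-*ʳ b (𝟙 ∘ A°)))) ⟩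
      a * b * edgeWeight G p q  ∎)
    where
    open ≤-Reasoning
    ΠA ΠB : Vec (Fin n) h → ℕ
    ΠA g = prod (λ l → if A l then nbd g l else 1)
    ΠB g = prod (λ l → if B l then nbd g l else 1)
    ring₁ : ∀ a b k o x y → a * b * (k * (o * (x * y))) ≡ k * o * (a * x * (b * y))
    ring₁ = solve-∀
    ring₂ : ∀ k a x b y → k * (a * x * (b * y)) ≡ a * b * (k * (x * y))
    ring₂ = solve-∀
    guarded : ∀ s t {x y} → (s ≡ true → t ≡ true → x ≤ y) → 𝟙 s * 𝟙 t * x ≤ 𝟙 s * 𝟙 t * y
    guarded true  true  f = *-monoʳ-≤ 1 (f refl refl)
    guarded true  false f = z≤n
    guarded false t     f = z≤n

-- The edge sum in the absence of a rich edge

-- The number of homomorphisms into K_{x,y} of a connected bipartite graph with parts of sizes suc p and suc q.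
biHom : ℕ → ℕ → ℕ → ℕ → ℕ
biHom p q x y = x ^ suc p * y ^ suc q + x ^ suc q * y ^ suc p

biHom′ : ℕ → ℕ → ℕ → ℕ → ℕ
biHom′ p q x y = x ^ p * y ^ q + x ^ q * y ^ p

biHom-factor : ∀ p q x y → biHom p q x y ≡ x * y * biHom′ p q x y
biHom-factor p q x y = ring x y (x ^ p) (y ^ q) (x ^ q) (y ^ p)
  where
  ring : ∀ x y a b c d → x * a * (y * b) + x * c * (y * d) ≡ x * y * (a * b + c * d)
  ring = solve-∀

biHom-sym : ∀ p q x y → biHom p q x y ≡ biHom p q y x
biHom-sym p q x y = ring (x ^ suc p) (y ^ suc q) (x ^ suc q) (y ^ suc p)
  where
  ring : ∀ a b c d → a * b + c * d ≡ d * c + b * a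
  ring = solve-∀

biHom′-mono : ∀ p q {x X} y → x ≤ X → biHom′ p q x y ≤ biHom′ p q X y
biHom′-mono p q y x≤X = +-mono-≤ (*-monoˡ-≤ (y ^ q) (^-monoˡ-≤ p x≤X)) (*-monoˡ-≤ (y ^ p) (^-monoˡ-≤ q x≤X))

biHom-≤ : ∀ p q {x y n} → x ≤ n → y ≤ n → n * biHom p q x y ≤ 2 * x * n ^ (suc p + suc q)
biHom-≤ p q {x} {y} {n} x≤n y≤n = begin
  n * biHom p q x y  ≡⟨ cong (n *_) (biHom-factor p q x y) ⟩
  n * (x * y * biHom′ p q x y)  ≤⟨ *-monoʳ-≤ n (*-mono-≤ (*-monoʳ-≤ x y≤n)
                                                     (+-mono-≤ (*-mono-≤ (^-monoˡ-≤ p x≤n) (^-monoˡ-≤ q y≤n)) (*-mono-≤ (^-monoˡ-≤ q x≤n) (^-monoˡ-≤ p y≤n)))) ⟩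
  n * (x * n * (n ^ p * n ^ q + n ^ q * n ^ p))  ≡⟨ ring n x (n ^ p) (n ^ q) ⟩
  2 * x * (n * n ^ p * (n * n ^ q))  ≡⟨ cong (2 * x *_) (sym (^-distribˡ-+-* n (suc p) (suc q))) ⟩
  2 * x * n ^ (suc p + suc q)  ∎
  where
  open ≤-Reasoning
  ring : ∀ n x a b → n * (x * n * (a * b + b * a)) ≡ 2 * x * (n * a * (n * b))
  ring = solve-∀

-- n! / k, so that n! serves as a common denominator for the reciprocals of the degrees.
factorialOver : ℕ → ℕ → ℕ
factorialOver n zero    = 0
factorialOver n (suc k) = n ! / suc k

factorialOver-spec : ∀ n k → 0 < k → k ≤ n → k * factorialOver n k ≡ n !
factorialOver-spec n (suc k) _ k≤n = m*[n/m]≡n (∣-trans (m∣m*n (k !)) (m≤n⇒m!∣n! k≤n))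

-- For an edge with degrees `x`, `y` the aim is `D * n * biHom p q x y ≤ (x + y) * B`: at most
-- `(x + y) / n` times `M`, with relative loss `1 / D`. Dividing by `x * y` turns `x + y` into
-- `1 / x + 1 / y`, whose sum over the edges is at most `n`.
module EdgeBound (p q n c₀ ℓ M : ℕ) (n>0 : 0 < n) (c₀>0 : 0 < c₀) (ℓ>0 : 0 < ℓ)
  (M-max : ∀ x y → x + y ≡ n → biHom p q x y ≤ M)
  (M-large : n ^ (suc p + suc q) ≤ c₀ * M) where

  a D : ℕ
  a = 4 * c₀
  D = a * ℓ

  open ≤-Reasoning

  2≤D : 2 ≤ D
  2≤D = ≤-trans (s≤s (s≤s z≤n)) (*-mono-≤ (*-monoʳ-≤ 4 c₀>0) ℓ>0)

  B : ℕ
  B = pred D * M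

  B+M : B + M ≡ D * M
  B+M = pred-step D 2≤D
    where
    pred-step : ∀ d → 2 ≤ d → pred d * M + M ≡ d * M
    pred-step (suc d) _ = +-comm (d * M) M

  to-B : ∀ {w} z → w + z * M ≤ z * (D * M) → w ≤ z * B
  to-B {w} z le = +-cancelʳ-≤ (z * M) w (z * B) (≤-trans le (≤-reflexive (trans (cong (z *_) (sym B+M)) (*-distribˡ-+ z B M))))

  -- Since `biHom` has the factor `x * y`, a degree of at most `n / a` with `a = 4 * c₀` leaves at
  -- most half of `(x + y) * M / n`; this is enough because `D ≥ 2`.
  small-degree : ∀ {x y} → x ≤ n → y ≤ n → a * x ≤ n → D * n * biHom p q x y ≤ (x + y) * B
  small-degree {x} {y} x≤n y≤n ax≤n = to-B (x + y) (*-cancelˡ-≤ 2 (begin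
    2 * (D * n * biHom p q x y + (x + y) * M)  ≡⟨ ring₅ D n (biHom p q x y) ((x + y) * M) ⟩
    D * (2 * (n * biHom p q x y)) + 2 * ((x + y) * M)  ≤⟨ +-mono-≤ (*-monoʳ-≤ D half) (*-monoˡ-≤ ((x + y) * M) 2≤D) ⟩
    D * ((x + y) * M) + D * ((x + y) * M)  ≡⟨ ring₆ D (x + y) M ⟩
    2 * ((x + y) * (D * M))  ∎))
    where
    ring₁ : ∀ c n b → 2 * c * (2 * (n * b)) ≡ 4 * c * (n * b)
    ring₁ = solve-∀
    ring₂ : ∀ a n x y b → a * (n * (x * y * b)) ≡ a * x * (n * (y * b))
    ring₂ = solve-∀
    ring₃ : ∀ n y s t → n * (n * (y * (s * t + t * s))) ≡ 2 * y * (n * s * (n * t))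
    ring₃ = solve-∀
    ring₄ : ∀ c s m → 2 * s * (c * m) ≡ 2 * c * (s * m)
    ring₄ = solve-∀
    ring₅ : ∀ d n b s → 2 * (d * n * b + s) ≡ d * (2 * (n * b)) + 2 * s
    ring₅ = solve-∀
    ring₆ : ∀ d z m → d * (z * m) + d * (z * m) ≡ 2 * (z * (d * m))
    ring₆ = solve-∀
    half : 2 * (n * biHom p q x y) ≤ (x + y) * M
    half = *-cancelˡ-≤ (2 * c₀) {{>-nonZero (*-mono-≤ {1} {2} (s≤s z≤n) c₀>0)}} (begin
      2 * c₀ * (2 * (n * biHom p q x y))  ≡⟨ ring₁ c₀ n (biHom p q x y) ⟩
      a * (n * biHom p q x y)  ≡⟨ cong (λ t → a * (n * t)) (biHom-factor p q x y) ⟩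
      a * (n * (x * y * biHom′ p q x y))  ≡⟨ ring₂ a n x y (biHom′ p q x y) ⟩
      a * x * (n * (y * biHom′ p q x y))  ≤⟨ *-mono-≤ ax≤n (*-monoʳ-≤ n (*-monoʳ-≤ y
                                                                (+-mono-≤ (*-mono-≤ (^-monoˡ-≤ p x≤n) (^-monoˡ-≤ q y≤n)) (*-mono-≤ (^-monoˡ-≤ q x≤n) (^-monoˡ-≤ p y≤n))))) ⟩
      n * (n * (y * (n ^ p * n ^ q + n ^ q * n ^ p)))  ≡⟨ ring₃ n y (n ^ p) (n ^ q) ⟩
      2 * y * (n * n ^ p * (n * n ^ q))  ≡⟨ cong (2 * y *_) (sym (^-distribˡ-+-* n (suc p) (suc q))) ⟩
      2 * y * n ^ (suc p + suc q)  ≤⟨ *-mono-≤ (*-monoʳ-≤ 2 (m≤n+m y x)) M-large ⟩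
      2 * (x + y) * (c₀ * M)  ≡⟨ ring₄ c₀ (x + y) M ⟩
      2 * c₀ * ((x + y) * M)  ∎)

  -- Enlarging `x` to `X = n - y` makes the sum equal to `n`, and `biHom` grows at least in
  -- proportion to its first argument, so `X * biHom p q x y ≤ x * M`.
  small-degree-sum : ∀ {x y} → ℓ * (x + y) + n ≤ ℓ * n → n ≤ a * y → D * n * biHom p q x y ≤ (x + y) * B
  small-degree-sum {x} {y} deficit n≤ay with m≤n⇒∃[o]m+o≡n y≤n
    where
    y≤n : y ≤ n
    y≤n = *-cancelˡ-≤ ℓ {{>-nonZero ℓ>0}} (≤-trans (*-monoʳ-≤ ℓ (m≤n+m y x)) (≤-trans (m≤m+n (ℓ * (x + y)) n) deficit))
  ... | X , y+X≡n = to-B (x + y) (*-cancelˡ-≤ X {{>-nonZero X>0}} (begin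
    X * (D * n * biHom p q x y + (x + y) * M)  ≡⟨ ring₁ X D n (biHom p q x y) ((x + y) * M) ⟩
    D * n * (X * biHom p q x y) + X * ((x + y) * M)  ≤⟨ +-monoˡ-≤ (X * ((x + y) * M)) (*-monoʳ-≤ (D * n) compare) ⟩
    D * n * (x * M) + X * ((x + y) * M)  ≡⟨ ring₂ D n x M X (x + y) ⟩
    (D * n * x + (x + y) * X) * M  ≤⟨ *-monoˡ-≤ M key ⟩
    D * (x + y) * X * M  ≡⟨ ring₃ D (x + y) X M ⟩
    X * ((x + y) * (D * M))  ∎))
    where
    ring₁ : ∀ X d n b s → X * (d * n * b + s) ≡ d * n * (X * b) + X * s
    ring₁ = solve-∀
    ring₂ : ∀ d n x m X z → d * n * (x * m) + X * (z * m) ≡ (d * n * x + z * X) * m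
    ring₂ = solve-∀
    ring₃ : ∀ d z X m → d * z * X * m ≡ X * (z * (d * m))
    ring₃ = solve-∀
    ring₄ : ∀ ℓ y X → ℓ * (y + X) ≡ ℓ * X + ℓ * y
    ring₄ = solve-∀
    ring₅ : ∀ ℓ x y n → ℓ * (x + y) + n ≡ ℓ * x + n + ℓ * y
    ring₅ = solve-∀
    ring₆ : ∀ X x y b → X * (x * y * b) ≡ x * (X * y * b)
    ring₆ = solve-∀
    gap : ℓ * x + n ≤ ℓ * X
    gap = +-cancelʳ-≤ (ℓ * y) (ℓ * x + n) (ℓ * X) (begin
      ℓ * x + n + ℓ * y  ≡⟨ sym (ring₅ ℓ x y n) ⟩
      ℓ * (x + y) + n  ≤⟨ deficit ⟩
      ℓ * n  ≡⟨ cong (ℓ *_) (sym y+X≡n) ⟩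
      ℓ * (y + X)  ≡⟨ ring₄ ℓ y X ⟩
      ℓ * X + ℓ * y  ∎)
    x≤X : x ≤ X
    x≤X = *-cancelˡ-≤ ℓ {{>-nonZero ℓ>0}} (≤-trans (m≤m+n (ℓ * x) n) gap)
    X>0 : 0 < X
    X>0 = proj₂ (*-pos {ℓ} (≤-trans n>0 (≤-trans (m≤n+m n (ℓ * x)) gap)))
    X≤n : X ≤ n
    X≤n = ≤-trans (m≤n+m X y) (≤-reflexive y+X≡n)
    x+y≤n : x + y ≤ n
    x+y≤n = *-cancelˡ-≤ ℓ {{>-nonZero ℓ>0}} (≤-trans (m≤m+n (ℓ * (x + y)) n) deficit)
    compare : X * biHom p q x y ≤ x * M
    compare = begin
      X * biHom p q x y  ≡⟨ cong (X *_) (biHom-factor p q x y) ⟩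
      X * (x * y * biHom′ p q x y)  ≤⟨ *-monoʳ-≤ X (*-monoʳ-≤ (x * y) (biHom′-mono p q y x≤X)) ⟩
      X * (x * y * biHom′ p q X y)  ≡⟨ ring₆ X x y (biHom′ p q X y) ⟩
      x * (X * y * biHom′ p q X y)  ≡⟨ cong (x *_) (sym (biHom-factor p q X y)) ⟩
      x * biHom p q X y  ≤⟨ *-monoʳ-≤ x (M-max X y (trans (+-comm X y) y+X≡n)) ⟩
      x * M  ∎
    -- The difference of `(x + y) * X` and `n * x` is `y * (X - x)`, at least `(n / a) * (n / ℓ)`;
    -- this is the origin of `D = a * ℓ`.
    key : D * n * x + (x + y) * X ≤ D * (x + y) * X
    key = begin
      D * n * x + (x + y) * X  ≡⟨ cong (λ t → D * t * x + (x + y) * X) (sym y+X≡n) ⟩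
      D * (y + X) * x + (x + y) * X  ≤⟨ +-monoʳ-≤ (D * (y + X) * x) (≤-trans (*-mono-≤ x+y≤n X≤n) (*-monoˡ-≤ n n≤ay)) ⟩
      D * (y + X) * x + a * y * n  ≡⟨ ring₇ a ℓ x y X n ⟩
      D * x * X + a * y * (ℓ * x + n)  ≤⟨ +-monoʳ-≤ (D * x * X) (*-monoʳ-≤ (a * y) gap) ⟩
      D * x * X + a * y * (ℓ * X)  ≡⟨ ring₈ a ℓ x y X ⟩
      D * (x + y) * X  ∎
      where
      ring₇ : ∀ a ℓ x y X n → a * ℓ * (y + X) * x + a * y * n ≡ a * ℓ * x * X + a * y * (ℓ * x + n)
      ring₇ = solve-∀
      ring₈ : ∀ a ℓ x y X → a * ℓ * x * X + a * y * (ℓ * X) ≡ a * ℓ * (x + y) * X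
      ring₈ = solve-∀

  -- Edges of large codegree escape the degree bounds above. They get the trivial bound, recorded as
  -- the extra term of `C`, and `K` is so large that their total cost is at most half of the gain.
  module NoRichEdge (G : Graph n) (G-simple : IsSimple G) (K : ℕ) (K-large : 4 * D * (ℓ * ℓ) * c₀ ≤ K)
    (tri≤ : ∀ u → K * tri G u ≤ n * n)
    (poor : ∀ u v → G u v ≡ true → (n ≤ ℓ * codeg G u v) ⊎ (a * deg G u ≤ n) ⊎ (a * deg G v ≤ n) ⊎
              (ℓ * (deg G u + deg G v) + n ≤ ℓ * n × n ≤ a * deg G v)) where
    private
      G-sym = proj₁ G-simple
      d : Fin n → ℕ
      d = deg G
      N : ℕ
      N = n ^ (suc p + suc q)

      heavy : Fin n → Fin n → Bool
      heavy u v = ⌊ n ≤? ℓ * codeg G u v ⌋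

      C : Fin n → Fin n → ℕ
      C u v = B + 2 * D * N * 𝟙 (heavy u v)

      C-sym : ∀ u v → C u v ≡ C v u
      C-sym u v = cong (λ t → B + 2 * D * N * 𝟙 ⌊ n ≤? ℓ * t ⌋) (codeg-sym G u v)

      d≤n : ∀ u → d u ≤ n
      d≤n u = #≤n (G u)

      edge-bound : ∀ u v → G u v ≡ true → D * n * biHom p q (d u) (d v) ≤ (d u + d v) * C u v
      edge-bound u v e with poor u v e
      ... | inj₁ n≤ℓt = begin
        D * n * biHom p q (d u) (d v)  ≡⟨ *-assoc D n _ ⟩
        D * (n * biHom p q (d u) (d v))  ≤⟨ *-monoʳ-≤ D (biHom-≤ p q (d≤n u) (d≤n v)) ⟩
        D * (2 * d u * N)  ≡⟨ ring D (d u) N ⟩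
        d u * (2 * D * N * 1)  ≤⟨ *-mono-≤ (m≤m+n (d u) (d v)) (*-monoʳ-≤ (2 * D * N) (true⇒1≤𝟙 (⌊⌋-complete (n ≤? _) n≤ℓt))) ⟩
        (d u + d v) * (2 * D * N * 𝟙 (heavy u v))  ≤⟨ *-monoʳ-≤ (d u + d v) (m≤n+m _ B) ⟩
        (d u + d v) * C u v  ∎
        where
        ring : ∀ D x N → D * (2 * x * N) ≡ x * (2 * D * N * 1)
        ring = solve-∀
      ... | inj₂ (inj₁ ax≤n) = ≤-trans (small-degree (d≤n u) (d≤n v) ax≤n) (*-monoʳ-≤ (d u + d v) (m≤m+n B _))
      ... | inj₂ (inj₂ (inj₁ ay≤n)) = begin
        D * n * biHom p q (d u) (d v)  ≡⟨ cong (D * n *_) (biHom-sym p q (d u) (d v)) ⟩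
        D * n * biHom p q (d v) (d u)  ≤⟨ small-degree (d≤n v) (d≤n u) ay≤n ⟩
        (d v + d u) * B  ≤⟨ *-mono-≤ (≤-reflexive (+-comm (d v) (d u))) (m≤m+n B _) ⟩
        (d u + d v) * C u v  ∎
      ... | inj₂ (inj₂ (inj₂ (deficit , n≤ay))) = ≤-trans (small-degree-sum deficit n≤ay) (*-monoʳ-≤ (d u + d v) (m≤m+n B _))

      r : ℕ → ℕ
      r = factorialOver n

      edge-weight : ∀ u v → G u v ≡ true → D * n * n ! * biHom′ p q (d u) (d v) ≤ (r (d u) + r (d v)) * C u v
      edge-weight u v e = *-cancelˡ-≤ (d u * d v) {{>-nonZero (*-mono-≤ du>0 dv>0)}} (begin
        d u * d v * (D * n * n ! * biHom′ p q (d u) (d v))  ≡⟨ ring₁ (d u) (d v) (D * n) (n !) (biHom′ p q (d u) (d v)) ⟩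
        n ! * (D * n * (d u * d v * biHom′ p q (d u) (d v)))  ≡⟨ cong (λ t → n ! * (D * n * t)) (sym (biHom-factor p q (d u) (d v))) ⟩
        n ! * (D * n * biHom p q (d u) (d v))  ≤⟨ *-monoʳ-≤ (n !) (edge-bound u v e) ⟩
        n ! * ((d u + d v) * C u v)  ≡⟨ ring₂ (n !) (d u) (d v) (C u v) ⟩
        (d u * n ! + d v * n !) * C u v  ≡⟨ cong₂ (λ s t → (d u * s + d v * t) * C u v) (sym (factorialOver-spec n (d v) dv>0 (d≤n v)))
                                                                          (sym (factorialOver-spec n (d u) du>0 (d≤n u))) ⟩
        (d u * (d v * r (d v)) + d v * (d u * r (d u))) * C u v  ≡⟨ ring₃ (d u) (d v) (r (d u)) (r (d v)) (C u v) ⟩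
        d u * d v * ((r (d u) + r (d v)) * C u v)  ∎)
        where
        du>0 : 0 < d u
        du>0 = ≤-trans (true⇒1≤𝟙 e) (term≤sum (𝟙 ∘ G u) v)
        dv>0 : 0 < d v
        dv>0 = ≤-trans (true⇒1≤𝟙 (trans (G-sym v u) e)) (term≤sum (𝟙 ∘ G v) u)
        ring₁ : ∀ x y D f b → x * y * (D * f * b) ≡ f * (D * (x * y * b))
        ring₁ = solve-∀
        ring₂ : ∀ f x y c → f * ((x + y) * c) ≡ (x * f + y * f) * c
        ring₂ = solve-∀
        ring₃ : ∀ x y s t c → (x * (y * t) + y * (x * s)) * c ≡ x * y * ((s + t) * c)
        ring₃ = solve-∀

      row : Fin n → ℕ
      row u = r (d u) * sum λ v → 𝟙 (G u v) * C u v

      Φ : ℕ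
      Φ = edgeWeight G p q

      twiceΦ : 2 * Φ ≡ sum λ u → sum λ v → 𝟙 (G u v) * biHom′ p q (d u) (d v)
      twiceΦ = begin-equality
        2 * Φ  ≡⟨ cong (Φ +_) (+-identityʳ Φ) ⟩
        Φ + Φ  ≡⟨ cong₂ _+_ (trans (sum-comm₂ (λ u v → 𝟙 (G u v) * (d v ^ p * d u ^ q)))
                                     (sum-cong-≗ λ u → sum-cong-≗ λ v → cong (λ b → 𝟙 b * (d u ^ p * d v ^ q)) (G-sym v u)))
                              (sum-cong-≗ λ u → sum-cong-≗ λ v → cong (𝟙 (G u v) *_) (*-comm (d v ^ p) (d u ^ q))) ⟩
        sum (λ u → sum λ v → 𝟙 (G u v) * (d u ^ p * d v ^ q)) + sum (λ u → sum λ v → 𝟙 (G u v) * (d u ^ q * d v ^ p))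
                 ≡⟨ sym (trans (sum-cong-≗ λ u → sum-+ (λ v → 𝟙 (G u v) * (d u ^ p * d v ^ q)) (λ v → 𝟙 (G u v) * (d u ^ q * d v ^ p)))
                               (sum-+ (λ u → sum λ v → 𝟙 (G u v) * (d u ^ p * d v ^ q)) (λ u → sum λ v → 𝟙 (G u v) * (d u ^ q * d v ^ p)))) ⟩
        sum (λ u → sum λ v → 𝟙 (G u v) * (d u ^ p * d v ^ q) + 𝟙 (G u v) * (d u ^ q * d v ^ p))
                 ≡⟨ sum-cong-≗ (λ u → sum-cong-≗ λ v → sym (*-distribˡ-+ (𝟙 (G u v)) (d u ^ p * d v ^ q) (d u ^ q * d v ^ p))) ⟩
        (sum λ u → sum λ v → 𝟙 (G u v) * biHom′ p q (d u) (d v))  ∎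

      half-row : (sum λ u → sum λ v → 𝟙 (G u v) * (r (d u) * C u v)) ≡ sum row
      half-row = sum-cong-≗ λ u → trans (sum-cong-≗ λ v → ring (𝟙 (G u v)) (r (d u)) (C u v)) (sum-*ˡ (r (d u)) (λ v → 𝟙 (G u v) * C u v))
        where
        ring : ∀ g r c → g * (r * c) ≡ r * (g * c)
        ring = solve-∀

      Φ≤rows : D * n * n ! * Φ ≤ sum row
      Φ≤rows = *-cancelˡ-≤ 2 (begin
        2 * (D * n * n ! * Φ)
          ≡⟨ ring (D * n * n !) Φ ⟩
        D * n * n ! * (2 * Φ)
          ≡⟨ cong (D * n * n ! *_) twiceΦ ⟩
        D * n * n ! * (sum λ u → sum λ v → 𝟙 (G u v) * biHom′ p q (d u) (d v))
          ≡⟨ sym (trans (sum-cong-≗ λ u → sum-*ˡ (D * n * n !) (λ v → 𝟙 (G u v) * biHom′ p q (d u) (d v)))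
                        (sum-*ˡ (D * n * n !) (λ u → sum λ v → 𝟙 (G u v) * biHom′ p q (d u) (d v)))) ⟩
        (sum λ u → sum λ v → D * n * n ! * (𝟙 (G u v) * biHom′ p q (d u) (d v)))
          ≤⟨ sum-mono (λ u → sum-mono λ v → guard u v (G u v) refl) ⟩
        (sum λ u → sum λ v → 𝟙 (G u v) * (r (d u) * C u v) + 𝟙 (G u v) * (r (d v) * C u v))
          ≡⟨ trans (sum-cong-≗ λ u → sum-+ (λ v → 𝟙 (G u v) * (r (d u) * C u v)) (λ v → 𝟙 (G u v) * (r (d v) * C u v)))
                   (sum-+ (λ u → sum λ v → 𝟙 (G u v) * (r (d u) * C u v)) (λ u → sum λ v → 𝟙 (G u v) * (r (d v) * C u v))) ⟩
        (sum λ u → sum λ v → 𝟙 (G u v) * (r (d u) * C u v)) + (sum λ u → sum λ v → 𝟙 (G u v) * (r (d v) * C u v))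
          ≡⟨ cong ((sum λ u → sum λ v → 𝟙 (G u v) * (r (d u) * C u v)) +_)
                  (trans (sum-comm₂ (λ u v → 𝟙 (G u v) * (r (d v) * C u v)))
                         (sum-cong-≗ λ u → sum-cong-≗ λ v → cong₂ (λ b c → 𝟙 b * (r (d u) * c)) (G-sym v u) (C-sym v u))) ⟩
        (sum λ u → sum λ v → 𝟙 (G u v) * (r (d u) * C u v)) + (sum λ u → sum λ v → 𝟙 (G u v) * (r (d u) * C u v))
          ≡⟨ cong₂ _+_ half-row half-row ⟩
        sum row + sum row
          ≡⟨ cong (sum row +_) (sym (+-identityʳ (sum row))) ⟩
        2 * sum row  ∎)
        where
        ring : ∀ x y → 2 * (x * y) ≡ x * (2 * y)
        ring = solve-∀
        guard : ∀ u v b → G u v ≡ b → D * n * n ! * (𝟙 b * biHom′ p q (d u) (d v)) ≤ 𝟙 b * (r (d u) * C u v) + 𝟙 b * (r (d v) * C u v)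
        guard u v false _ = ≤-reflexive (*-zeroʳ (D * n * n !))
        guard u v true  e = begin
          D * n * n ! * (1 * biHom′ p q (d u) (d v))  ≡⟨ cong (D * n * n ! *_) (*-identityˡ (biHom′ p q (d u) (d v))) ⟩
          D * n * n ! * biHom′ p q (d u) (d v)  ≤⟨ edge-weight u v e ⟩
          (r (d u) + r (d v)) * C u v  ≡⟨ expand (r (d u)) (r (d v)) (C u v) ⟩
          1 * (r (d u) * C u v) + 1 * (r (d v) * C u v)  ∎
          where
          expand : ∀ s t c → (s + t) * c ≡ 1 * (s * c) + 1 * (t * c)
          expand = solve-∀

      heavyDeg : Fin n → ℕ
      heavyDeg u = sum λ v → 𝟙 (G u v) * 𝟙 (heavy u v)

      -- By Markov and `tri≤` at most `ℓ * n / K` heavy edges meet `u`. A single heavy edge already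
      -- forces `d u ≥ n / ℓ`, which turns this into a fraction of `d u`.
      heavyDeg-bound : ∀ u → K * heavyDeg u ≤ ℓ * ℓ * d u
      heavyDeg-bound u with heavyDeg u in eq
      ... | zero  = ≤-trans (≤-reflexive (*-zeroʳ K)) z≤n
      ... | suc m = *-cancelˡ-≤ n {{>-nonZero n>0}} (begin
        n * (K * suc m)  ≡⟨ cong (λ t → n * (K * t)) (sym eq) ⟩
        n * (K * heavyDeg u)  ≡⟨ ring₁ n K (heavyDeg u) ⟩
        K * (n * heavyDeg u)  ≤⟨ *-monoʳ-≤ K markov ⟩
        K * (ℓ * tri G u)  ≡⟨ ring₁ K ℓ (tri G u) ⟩
        ℓ * (K * tri G u)  ≤⟨ *-monoʳ-≤ ℓ (tri≤ u) ⟩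
        ℓ * (n * n)  ≤⟨ *-monoʳ-≤ ℓ (*-monoʳ-≤ n n≤ℓd) ⟩
        ℓ * (n * (ℓ * d u))  ≡⟨ ring₂ ℓ n (d u) ⟩
        n * (ℓ * ℓ * d u)  ∎)
        where
        ring₁ : ∀ n k x → n * (k * x) ≡ k * (n * x)
        ring₁ = solve-∀
        ring₂ : ∀ l n x → l * (n * (l * x)) ≡ n * (l * l * x)
        ring₂ = solve-∀
        ring₃ : ∀ n g x → n * (g * x) ≡ g * (n * x)
        ring₃ = solve-∀
        markov : n * heavyDeg u ≤ ℓ * tri G u
        markov = begin
          n * heavyDeg u
            ≡⟨ sym (sum-*ˡ n (λ v → 𝟙 (G u v) * 𝟙 (heavy u v))) ⟩
          (sum λ v → n * (𝟙 (G u v) * 𝟙 (heavy u v)))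
            ≤⟨ sum-mono (λ v → ≤-trans (≤-reflexive (ring₃ n (𝟙 (G u v)) (𝟙 (heavy u v))))
                              (≤-trans (*-monoʳ-≤ (𝟙 (G u v)) (term v)) (≤-reflexive (ring₃ (𝟙 (G u v)) ℓ (codeg G u v))))) ⟩
          (sum λ v → ℓ * (𝟙 (G u v) * codeg G u v))
            ≡⟨ sum-*ˡ ℓ (λ v → 𝟙 (G u v) * codeg G u v) ⟩
          ℓ * tri G u  ∎
          where
          term : ∀ v → n * 𝟙 (heavy u v) ≤ ℓ * codeg G u v
          term v with n ≤? ℓ * codeg G u v
          ... | yes le = ≤-trans (≤-reflexive (*-identityʳ n)) le
          ... | no _   = ≤-trans (≤-reflexive (*-zeroʳ n)) z≤n
        n≤ℓd : n ≤ ℓ * d u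
        n≤ℓd = let (v , pos) = sum-pos (λ v → 𝟙 (G u v) * 𝟙 (heavy u v)) (subst (0 <_) (sym eq) (s≤s z≤n))
                   hv = ⌊⌋-sound (n ≤? ℓ * codeg G u v) (𝟙-pos (proj₂ (*-pos {𝟙 (G u v)} pos)))
               in ≤-trans hv (*-monoʳ-≤ ℓ (#-mono (λ z → G u z ∧ G v z) (G u) λ z e → proj₁ (∧-true e)))

      -- The weights `r (d u)` on the `d u` edges at `u` add up to `n !`, so the common part of `C`
      -- contributes `n ! * B`; an isolated vertex has an empty row.
      row-bound : ∀ u → K * row u ≤ n ! * (K * B + 2 * D * N * (ℓ * ℓ))
      row-bound u with d u in du
      ... | zero  = ≤-trans (≤-reflexive (trans (cong (λ t → K * (r 0 * t)) empty) (trans (cong (K *_) (*-zeroʳ (r 0))) (*-zeroʳ K)))) z≤n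
        where
        empty : (sum λ v → 𝟙 (G u v) * C u v) ≡ 0
        empty = trans (sum-cong-≗ λ v → cong (_* C u v) (n≤0⇒n≡0 (≤-trans (term≤sum (𝟙 ∘ G u) v) (≤-reflexive du)))) (sum-zero n)
      ... | suc k = begin
        K * (r (suc k) * sum (λ v → 𝟙 (G u v) * C u v))
          ≡⟨ cong (λ t → K * (r (suc k) * t)) expand ⟩
        K * (r (suc k) * (d u * B + 2 * D * N * heavyDeg u))
          ≡⟨ ring₁ K (r (suc k)) (d u) B (2 * D * N) (heavyDeg u) ⟩
        r (suc k) * (K * B * d u + 2 * D * N * (K * heavyDeg u))
          ≤⟨ *-monoʳ-≤ (r (suc k)) (+-monoʳ-≤ (K * B * d u) (*-monoʳ-≤ (2 * D * N) (heavyDeg-bound u))) ⟩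
        r (suc k) * (K * B * d u + 2 * D * N * (ℓ * ℓ * d u))
          ≡⟨ ring₂ (r (suc k)) (K * B) (d u) (2 * D * N) (ℓ * ℓ) ⟩
        d u * r (suc k) * (K * B + 2 * D * N * (ℓ * ℓ))
          ≡⟨ cong (_* (K * B + 2 * D * N * (ℓ * ℓ))) (trans (cong (_* r (suc k)) du) (factorialOver-spec n (suc k) (s≤s z≤n) (subst (_≤ n) du (d≤n u)))) ⟩
        n ! * (K * B + 2 * D * N * (ℓ * ℓ))  ∎
        where
        ring₁ : ∀ K r d B E m → K * (r * (d * B + E * m)) ≡ r * (K * B * d + E * (K * m))
        ring₁ = solve-∀
        ring₂ : ∀ r b d E l → r * (b * d + E * (l * d)) ≡ d * r * (b + E * l)
        ring₂ = solve-∀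
        ring₃ : ∀ g B E w → g * (B + E * w) ≡ g * B + E * (g * w)
        ring₃ = solve-∀
        expand : (sum λ v → 𝟙 (G u v) * C u v) ≡ d u * B + 2 * D * N * heavyDeg u
        expand = begin-equality
          (sum λ v → 𝟙 (G u v) * C u v)
            ≡⟨ sum-cong-≗ (λ v → ring₃ (𝟙 (G u v)) B (2 * D * N) (𝟙 (heavy u v))) ⟩
          (sum λ v → 𝟙 (G u v) * B + 2 * D * N * (𝟙 (G u v) * 𝟙 (heavy u v)))
            ≡⟨ sum-+ (λ v → 𝟙 (G u v) * B) (λ v → 2 * D * N * (𝟙 (G u v) * 𝟙 (heavy u v))) ⟩
          (sum λ v → 𝟙 (G u v) * B) + (sum λ v → 2 * D * N * (𝟙 (G u v) * 𝟙 (heavy u v)))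
            ≡⟨ cong₂ _+_ (sum-*ʳ B (𝟙 ∘ G u)) (sum-*ˡ (2 * D * N) (λ v → 𝟙 (G u v) * 𝟙 (heavy u v))) ⟩
          d u * B + 2 * D * N * heavyDeg u  ∎

    -- The edges lose a fraction `1 / D` of `M`; heavy edges give back at most half of it, which
    -- leaves `1 / (2 * D)`.
    edgeWeight-small : 2 * (D * edgeWeight G p q) + M ≤ 2 * (D * M)
    edgeWeight-small = begin
      2 * (D * Φ) + M  ≤⟨ +-monoˡ-≤ M twice ⟩
      2 * B + M + M  ≡⟨ ring₁ B M ⟩
      2 * (B + M)  ≡⟨ cong (2 *_) B+M ⟩
      2 * (D * M)  ∎
      where
      ring₁ : ∀ b m → 2 * b + m + m ≡ 2 * (b + m)
      ring₁ = solve-∀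
      ring₂ : ∀ K D n f x → n * f * (K * (D * x)) ≡ K * (D * n * f * x)
      ring₂ = solve-∀
      ring₃ : ∀ D c m l → 4 * D * (c * m) * l ≡ 4 * D * l * c * m
      ring₃ = solve-∀
      ring₄ : ∀ K D x → K * (2 * (D * x)) ≡ 2 * (K * (D * x))
      ring₄ = solve-∀
      ring₅ : ∀ K B D N l → 2 * (K * B + 2 * D * N * l) ≡ K * (2 * B) + 4 * D * N * l
      ring₅ = solve-∀
      main : K * (D * Φ) ≤ K * B + 2 * D * N * (ℓ * ℓ)
      main = *-cancelˡ-≤ (n * n !) {{>-nonZero (*-mono-≤ n>0 (1≤n! n))}} (begin
        n * n ! * (K * (D * Φ))  ≡⟨ ring₂ K D n (n !) Φ ⟩
        K * (D * n * n ! * Φ)  ≤⟨ *-monoʳ-≤ K Φ≤rows ⟩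
        K * sum row  ≡⟨ sym (sum-*ˡ K row) ⟩
        (sum λ u → K * row u)  ≤⟨ sum-≤-const row-bound ⟩
        n * (n ! * (K * B + 2 * D * N * (ℓ * ℓ)))  ≡⟨ sym (*-assoc n (n !) _) ⟩
        n * n ! * (K * B + 2 * D * N * (ℓ * ℓ))  ∎)
      K>0 : 0 < K
      K>0 = ≤-trans (*-mono-≤ (*-mono-≤ (*-mono-≤ {1} {4} (s≤s z≤n) (≤-trans (n≤1+n 1) 2≤D)) (*-mono-≤ ℓ>0 ℓ>0)) c₀>0) K-large
      twice : 2 * (D * Φ) ≤ 2 * B + M
      twice = *-cancelˡ-≤ K {{>-nonZero K>0}} (begin
        K * (2 * (D * Φ))  ≡⟨ ring₄ K D Φ ⟩
        2 * (K * (D * Φ))  ≤⟨ *-monoʳ-≤ 2 main ⟩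
        2 * (K * B + 2 * D * N * (ℓ * ℓ))  ≡⟨ ring₅ K B D N (ℓ * ℓ) ⟩
        K * (2 * B) + 4 * D * N * (ℓ * ℓ)  ≤⟨ +-monoʳ-≤ (K * (2 * B)) (begin
          4 * D * N * (ℓ * ℓ)  ≤⟨ *-monoˡ-≤ (ℓ * ℓ) (*-monoʳ-≤ (4 * D) M-large) ⟩
          4 * D * (c₀ * M) * (ℓ * ℓ)  ≡⟨ ring₃ D c₀ M (ℓ * ℓ) ⟩
          4 * D * (ℓ * ℓ) * c₀ * M  ≤⟨ *-monoˡ-≤ M K-large ⟩
          K * M  ∎) ⟩
        K * (2 * B) + K * M  ≡⟨ sym (*-distribˡ-+ K (2 * B) M) ⟩
        K * (2 * B + M)  ∎)

-- Refining a partition across which almost all edges are present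

cutConst : ℕ → ℕ → ℕ
cutConst h g = suc (h * h * (2 * g) ^ h)

-- Eliminates the free size `s` of `emb≤cut`: taking `h + 2` away from the smaller part costs at
-- most a factor 2, which is the `2 * g` in `cutConst`.
emb≤cut′ : ∀ {h} {H : Graph h} (bip : Bipartite H) {n} (G : Graph n) (σ : Fin n → Bool) g → 0 < n →
  2 * g * (h + 2) ≤ n → n ≤ g * # σ → n ≤ g * # (not ∘ σ) →
  cutConst h g * inner G σ ≤ missing G σ → emb H G ≤ emb H (cut σ)
emb≤cut′ {h} bip {n} G σ g n>0 n-large n≤σ n≤σ′ few =
  emb≤cut bip G σ s (2 * g) n>0 (≤-trans s-spec (m⊓n≤m _ _)) (≤-trans s-spec (m⊓n≤n _ _)) n≤2gs
    (≤-trans (*-monoˡ-≤ (inner G σ) (n≤1+n (h * h * (2 * g) ^ h))) few)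
  where
  m s : ℕ
  m = # σ ⊓ # (not ∘ σ)
  s = m ∸ (h + 2)
  n≤gm : n ≤ g * m
  n≤gm with ⊓-sel (# σ) (# (not ∘ σ))
  ... | inj₁ eq = subst (λ t → n ≤ g * t) (sym eq) n≤σ
  ... | inj₂ eq = subst (λ t → n ≤ g * t) (sym eq) n≤σ′
  g>0 : 0 < g
  g>0 = proj₁ (*-pos {g} (≤-trans n>0 n≤gm))
  h+2≤m : h + 2 ≤ m
  h+2≤m = *-cancelˡ-≤ g {{>-nonZero g>0}} (≤-trans (≤-trans (*-monoˡ-≤ (h + 2) (m≤m+n g (1 * g))) n-large) n≤gm)
  s+ : s + (h + 2) ≡ m
  s+ = m∸n+n≡m h+2≤m
  s-spec : s + h + 2 ≤ m
  s-spec = ≤-reflexive (trans (+-assoc s h 2) s+)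
  n≤2gs : n ≤ 2 * g * s
  n≤2gs = ≤-by 0 (+-mono-≤ (+-mono-≤ n≤gm n≤gm) n-large)
    (trans (ring g s (h + 2) n) (cong (λ t → n + (g * t + g * t + n) + 0) s+))
    where
    ring : ∀ g s k n → 2 * g * s + (n + n + 2 * g * k) ≡ n + (g * (s + k) + g * (s + k) + n) + 0
    ring = solve-∀

#-cover : ∀ {n} (P Q R : Fin n → Bool) → (∀ x → P x ≡ true → Q x ≡ true ⊎ R x ≡ true) → # P ≤ # Q + # R
#-cover P Q R cover = ≤-trans (sum-mono λ x → le x (P x) refl) (≤-reflexive (sum-+ (𝟙 ∘ Q) (𝟙 ∘ R)))
  where
  le : ∀ x b → P x ≡ b → 𝟙 b ≤ 𝟙 (Q x) + 𝟙 (R x)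
  le x false _ = z≤n
  le x true  e with cover x e
  ... | inj₁ q = ≤-trans (true⇒1≤𝟙 q) (m≤m+n _ _)
  ... | inj₂ r = ≤-trans (true⇒1≤𝟙 r) (m≤n+m _ _)

side-self : ∀ {n} (σ : Fin n → Bool) {c x} → σ x ≡ c → side σ c x ≡ true
side-self σ {c} refl = cong not (xor-same c)

xor-not : ∀ {a b} → b ≡ not a → a xor b ≡ true
xor-not {true}  refl = refl
xor-not {false} refl = refl

not-xor : ∀ {a b} → not (a xor b) ≡ true → a ≡ b
not-xor {true}  {true}  _ = refl
not-xor {false} {false} _ = refl

true⊎false : ∀ b → b ≡ true ⊎ b ≡ false
true⊎false true  = inj₁ refl
true⊎false false = inj₂ refl

-- As fractions of `n`: `1 / g` bounds the parts from below, `1 / b` the cross defect of a core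
-- vertex, `1 / c` the exceptional set and the core neighbours of a vertex on its new side, and a
-- defect above `1 / e` makes a vertex deficient. By `4 * e * C ≤ c`, missing pairs at deficient
-- vertices outweigh inner edges.
module Refine {h : ℕ} {H : Graph h} (bip : Bipartite H) {n : ℕ} (G : Graph n) (G-simple : IsSimple G)
  (f : ℕ) (noBook : NoBook f G) (σ : Fin n → Bool) (g : ℕ) (g>0 : 0 < g) (n>0 : 0 < n)
  (n≤σ : n ≤ g * # σ) (n≤σ′ : n ≤ g * # (not ∘ σ))
  (C e c b : ℕ) (C≥ : cutConst h (2 * g) ≤ C) (e≥ : 8 * g ≤ e) (c≥ : 4 * e * C ≤ c) (c≥4g : 4 * g ≤ c) (b≥ : 4 * c ≤ b) where

  private
    G-sym = proj₁ G-simple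
    irr : ∀ {v} → G v v ≡ true → ⊥
    irr = irreflexive {G = G} G-simple

  cross : Fin n → Fin n → Bool
  cross u v = (σ u xor σ v) ∧ not (G u v)

  coreᵇ : Fin n → Bool
  coreᵇ w = ⌊ b * # (cross w) ≤? n ⌋

  module _ (exceptional-few : c * # (not ∘ coreᵇ) ≤ n) (n≥4c : 4 * c ≤ n) (n≥2g : 2 * (2 * g) * (h + 2) ≤ n) (n≥16g : 16 * g ≤ n)
    (n≥book₁ : book-n₀ f (2 * c) ≤ n) (n≥book₂ : book-n₀ f (4 * g) ≤ n) where

    core-side : Bool → Fin n → Bool
    core-side s x = coreᵇ x ∧ side σ s x

    core-bound : ∀ {w} → coreᵇ w ≡ true → 4 * c * # (cross w) ≤ n
    core-bound {w} r = ≤-trans (*-monoˡ-≤ (# (cross w)) b≥) (⌊⌋-sound (b * # (cross w) ≤? n) r)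

    core-bound′ : ∀ {w} → coreᵇ w ≡ true → 8 * g * # (cross w) ≤ n
    core-bound′ {w} r = ≤-trans (*-monoˡ-≤ (# (cross w)) (≤-trans (≤-reflexive (ring g)) (≤-trans (*-monoʳ-≤ 2 c≥4g) (*-monoˡ-≤ c {2} {4} (s≤s (s≤s z≤n)))))) (core-bound r)
      where
      ring : ∀ g → 8 * g ≡ 2 * (4 * g)
      ring = solve-∀

    core-side-σ : ∀ {s x} → core-side s x ≡ true → σ x ≡ s
    core-side-σ {s} {x} r = side-eq s (σ x) (proj₂ (∧-true {coreᵇ x} r))

    core-side-large : ∀ s → n ≤ 2 * g * # (core-side s)
    core-side-large s = ≤-by 0 (+-mono-≤ (+-mono-≤ n≤g n≤g) 2gk≤n) (ring g n (# (core-side s)) (# (not ∘ coreᵇ)))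
      where
      ring : ∀ g n s k → 2 * g * s + (n + n + 2 * g * k) ≡ n + (g * (s + k) + g * (s + k) + n) + 0
      ring = solve-∀
      2gk≤n : 2 * g * # (not ∘ coreᵇ) ≤ n
      2gk≤n = ≤-trans (*-monoˡ-≤ (# (not ∘ coreᵇ)) (≤-trans (*-monoˡ-≤ g {2} {4} (s≤s (s≤s z≤n))) c≥4g)) exceptional-few
      n≤side : ∀ s → n ≤ g * # (side σ s)
      n≤side true  = ≤-trans n≤σ (*-monoʳ-≤ g (#-mono σ (side σ true) λ x r → trans (not-involutive (σ x)) r))
      n≤side false = n≤σ′
      n≤g : n ≤ g * (# (core-side s) + # (not ∘ coreᵇ))
      n≤g = ≤-trans (n≤side s) (*-monoʳ-≤ g (#-cover (side σ s) (core-side s) (not ∘ coreᵇ) λ x r →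
        case true⊎false (coreᵇ x) of λ { (inj₁ t) → inj₁ (∧-intro t r) ; (inj₂ t) → inj₂ (cong not t) }))

    nbr : Fin n → Bool → Fin n → Bool
    nbr w s x = G w x ∧ core-side s x

    #nbr : Fin n → Bool → ℕ
    #nbr w s = # (nbr w s)

    -- Otherwise let `y` be a neighbour of `w` in the `false` core. Then `w`, `y` and further
    -- `false` neighbours of `w` form one part of a book, and `true` neighbours of `w` adjacent to
    -- `y` form the other; core vertices miss too little across to prevent this.
    not-both-sides : ∀ w → n ≤ c * #nbr w true → n ≤ c * #nbr w false → ⊥
    not-both-sides w many many′ = noBook-dense f (2 * c) G noBook n≥book₁ w y P Q Gwy P-adj Q-avoids P-large Q-dense
      where
      witness : ∃ λ y → nbr w false y ≡ true
      witness = #-pos (nbr w false) (proj₂ (*-pos {c} (≤-trans n>0 many′)))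
      y : Fin n
      y = proj₁ witness
      Gwy : G w y ≡ true
      Gwy = proj₁ (∧-true (proj₂ witness))
      y-core : core-side false y ≡ true
      y-core = proj₂ (∧-true {G w y} (proj₂ witness))
      P Q : Fin n → Bool
      P x = nbr w true x ∧ G y x
      Q = remove y (nbr w false)
      P-adj : ∀ p → P p ≡ true → G p w ≡ true × G p y ≡ true
      P-adj p r = trans (G-sym p w) (proj₁ (∧-true (proj₁ (∧-true r)))) , trans (G-sym p y) (proj₂ (∧-true {nbr w true p} r))
      Q-avoids : ∀ q → Q q ≡ true → q ≢ w × q ≢ y
      Q-avoids q r = (λ { refl → irr (proj₁ (∧-true (remove⊆ y (nbr w false) q r))) }) , remove-≢ y (nbr w false) q r
      P-large : n ≤ 2 * c * # P
      P-large = *-cancelˡ-≤ 2 (≤-by n (+-mono-≤ n≤cP (core-bound (proj₁ (∧-true y-core)))) (ring c n (# P) (# (cross y))))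
        where
        n≤cP : 4 * n ≤ 4 * (c * (# P + # (cross y)))
        n≤cP = *-monoʳ-≤ 4 (≤-trans many (*-monoʳ-≤ c (#-cover (nbr w true) P (cross y) λ x r →
          case true⊎false (G y x) of λ
            { (inj₁ t) → inj₁ (∧-intro r t)
            ; (inj₂ t) → inj₂ (∧-intro (cong₂ _xor_ (core-side-σ {false} {y} y-core) (core-side-σ {true} {x} (proj₂ (∧-true {G w x} r)))) (cong not t)) })))
        ring : ∀ c n P m → 2 * (2 * c * P) + (4 * n + 4 * c * m) ≡ 2 * n + (4 * (c * (P + m)) + n) + n
        ring = solve-∀
      Q-dense : ∀ p → P p ≡ true → n ≤ 2 * c * # (λ q → G p q ∧ Q q)
      Q-dense p r = *-cancelˡ-≤ 2 (≤-by 0 (+-mono-≤ (+-mono-≤ n≤c (core-bound (proj₁ (∧-true p-core)))) n≥4c) (ring c n (# (λ q → G p q ∧ Q q)) (# (cross p))))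
        where
        p-core : core-side true p ≡ true
        p-core = proj₂ (∧-true {G w p} (proj₁ (∧-true r)))
        n≤c : 4 * n ≤ 4 * (c * suc (# (λ q → G p q ∧ Q q) + # (cross p)))
        n≤c = *-monoʳ-≤ 4 (≤-trans many′ (*-monoʳ-≤ c (≤-trans (#-remove y (nbr w false)) (s≤s (#-cover Q (λ q → G p q ∧ Q q) (cross p) λ x r′ →
          case true⊎false (G p x) of λ
            { (inj₁ t) → inj₁ (∧-intro t r′)
            ; (inj₂ t) → inj₂ (∧-intro (cong₂ _xor_ (core-side-σ {true} {p} p-core) (core-side-σ {false} {x} (proj₂ (∧-true {G w x} (remove⊆ y (nbr w false) x r′))))) (cong not t)) })))))
        ring : ∀ c n q m → 2 * (2 * c * q) + (4 * n + 4 * c * m + 4 * c) ≡ 2 * n + (4 * (c * suc (q + m)) + n + n) + 0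
        ring = solve-∀

    -- A vertex with many core neighbours on the `true` side is put on `false`, where by
    -- `not-both-sides` it has few; every other vertex has few on `true`. One test thus settles both
    -- sides.
    σ′ : Fin n → Bool
    σ′ w = not ⌊ n ≤? c * #nbr w true ⌋

    few-own-side : ∀ w → c * #nbr w (σ′ w) < n
    few-own-side w with n ≤? c * #nbr w true
    ... | yes many = ≰⇒> λ many′ → not-both-sides w many many′
    ... | no few   = ≰⇒> few

    -- A core vertex has at least `n / (4 * g) ≥ n / c` core neighbours on the opposite side, so
    -- being moved there would violate `few-own-side`.
    core-σ′ : ∀ {w} → coreᵇ w ≡ true → σ′ w ≡ σ w
    core-σ′ {w} w-core with σ′ w Bool.≟ σ w
    ... | yes eq = eq
    ... | no neq = ⊥-elim (<⇒≱ (few-own-side w) (≤-trans (*-cancelˡ-≤ 2 lower) (*-monoˡ-≤ (#nbr w (σ′ w)) c≥4g)))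
      where
      cover : n ≤ 2 * g * (#nbr w (σ′ w) + # (cross w))
      cover = ≤-trans (core-side-large (σ′ w)) (*-monoʳ-≤ (2 * g) (#-cover (core-side (σ′ w)) (nbr w (σ′ w)) (cross w) λ x r →
        case true⊎false (G w x) of λ
          { (inj₁ t) → inj₁ (∧-intro t r)
          ; (inj₂ t) → inj₂ (∧-intro (xor-not (trans (core-side-σ r) (¬-not neq))) (cong not t)) }))
      lower : 2 * n ≤ 2 * (4 * g * #nbr w (σ′ w))
      lower = ≤-by n (+-mono-≤ (*-monoʳ-≤ 4 cover) (core-bound′ w-core)) (ring g n (#nbr w (σ′ w)) (# (cross w)))
        where
        ring : ∀ g n x m → 2 * (4 * g * x) + (4 * n + 8 * g * m) ≡ 2 * n + (4 * (2 * g * (x + m)) + n) + n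
        ring = solve-∀

    far : Fin n → Fin n → Bool
    far w y = core-side (not (σ′ w)) y ∧ not (G w y)

    deficientᵇ : Fin n → Bool
    deficientᵇ w = ⌊ suc n ≤? e * # (far w) ⌋

    -- If both ends miss few core vertices across, they have linearly many common neighbours there,
    -- and these are densely joined to the core on the side of `u` and `v`: a book.
    inner-edge-deficient : ∀ u v → G u v ≡ true → σ′ u ≡ σ′ v → deficientᵇ u ≡ false → deficientᵇ v ≡ false → ⊥
    inner-edge-deficient u v Guv same fine-u fine-v = noBook-dense f (4 * g) G noBook n≥book₂ u v P Q Guv P-adj Q-avoids P-large Q-dense
      where
      fine : ∀ {w} → deficientᵇ w ≡ false → 8 * g * # (far w) ≤ n
      fine {w} eq with suc n ≤? e * # (far w)
      ... | no ¬p = ≤-trans (*-monoˡ-≤ (# (far w)) e≥) (≤-pred (≰⇒> ¬p))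
      s s′ : Bool
      s  = σ′ u
      s′ = not s
      P Q₁ Q : Fin n → Bool
      P y = core-side s′ y ∧ (G u y ∧ G v y)
      Q₁ = remove u (core-side s)
      Q = remove v Q₁
      P-adj : ∀ p → P p ≡ true → G p u ≡ true × G p v ≡ true
      P-adj p r = let r′ = proj₂ (∧-true {core-side s′ p} r) in trans (G-sym p u) (proj₁ (∧-true r′)) , trans (G-sym p v) (proj₂ (∧-true {G u p} r′))
      Q-avoids : ∀ q → Q q ≡ true → q ≢ u × q ≢ v
      Q-avoids q r = remove-≢ u (core-side s) q (remove⊆ v Q₁ q r) , remove-≢ v Q₁ q r
      P-large : n ≤ 4 * g * # P
      P-large = *-cancelˡ-≤ 2 (≤-by 0 (+-mono-≤ (+-mono-≤ (*-monoʳ-≤ 4 cover) (fine fine-u)) (fine fine-v)) (ring g n (# P) (# (far u)) (# (far v))))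
        where
        ring : ∀ g n P x y → 2 * (4 * g * P) + (4 * n + 8 * g * x + 8 * g * y) ≡ 2 * n + (4 * (2 * g * (P + (x + y))) + n + n) + 0
        ring = solve-∀
        P₁ : Fin n → Bool
        P₁ y = core-side s′ y ∧ not (G u y ∧ G v y)
        cover : n ≤ 2 * g * (# P + (# (far u) + # (far v)))
        cover = ≤-trans (core-side-large s′) (*-monoʳ-≤ (2 * g) (≤-trans
          (#-cover (core-side s′) P P₁ λ x r → case true⊎false (G u x ∧ G v x) of λ
            { (inj₁ t) → inj₁ (∧-intro r t) ; (inj₂ t) → inj₂ (∧-intro r (cong not t)) })
          (+-monoʳ-≤ (# P) (#-cover P₁ (far u) (far v) λ x r → case true⊎false (G u x) of λ
            { (inj₁ t) → inj₂ (∧-intro (subst (λ z → core-side (not z) x ≡ true) same (proj₁ (∧-true r)))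
                                       (trans (cong (λ z → not (z ∧ G v x)) (sym t)) (proj₂ (∧-true {core-side s′ x} r))))
            ; (inj₂ t) → inj₁ (∧-intro (proj₁ (∧-true r)) (cong not t)) }))))
      Q-dense : ∀ p → P p ≡ true → n ≤ 4 * g * # (λ q → G p q ∧ Q q)
      Q-dense p r = *-cancelˡ-≤ 2 (≤-by 0 (+-mono-≤ (+-mono-≤ (*-monoʳ-≤ 4 cover) (core-bound′ (proj₁ (∧-true p-core)))) n≥16g) (ring g n (# (λ q → G p q ∧ Q q)) (# (cross p))))
        where
        ring : ∀ g n q m → 2 * (4 * g * q) + (4 * n + 8 * g * m + 16 * g) ≡ 2 * n + (4 * (2 * g * suc (suc (q + m))) + n + n) + 0
        ring = solve-∀
        p-core : core-side s′ p ≡ true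
        p-core = proj₁ (∧-true r)
        cover : n ≤ 2 * g * suc (suc (# (λ q → G p q ∧ Q q) + # (cross p)))
        cover = ≤-trans (core-side-large s) (*-monoʳ-≤ (2 * g) (≤-trans (#-remove u (core-side s)) (s≤s (≤-trans (#-remove v Q₁) (s≤s
          (#-cover Q (λ q → G p q ∧ Q q) (cross p) λ x r′ → case true⊎false (G p x) of λ
            { (inj₁ t) → inj₁ (∧-intro t r′)
            ; (inj₂ t) → inj₂ (∧-intro (xor-not (trans (core-side-σ (remove⊆ u (core-side s) x (remove⊆ v Q₁ x r′)))
                                        (trans (sym (not-involutive s)) (cong not (sym (core-side-σ p-core)))))) (cong not t)) }))))))

    private
      E : ℕ
      E = # deficientᵇ

      same-side : Fin n → Fin n → Bool
      same-side u v = G u v ∧ not (σ′ u xor σ′ v)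

      row≤ : ∀ u → c * # (same-side u) ≤ 2 * n
      row≤ u = begin
        c * # (same-side u)  ≤⟨ *-monoʳ-≤ c (#-cover (same-side u) (nbr u (σ′ u)) (not ∘ coreᵇ) cover) ⟩
        c * (#nbr u (σ′ u) + # (not ∘ coreᵇ))  ≡⟨ *-distribˡ-+ c _ _ ⟩
        c * #nbr u (σ′ u) + c * # (not ∘ coreᵇ)  ≤⟨ +-mono-≤ (<⇒≤ (few-own-side u)) exceptional-few ⟩
        n + n  ≡⟨ cong (n +_) (sym (+-identityʳ n)) ⟩
        2 * n  ∎
        where
        open ≤-Reasoning
        cover : ∀ x → same-side u x ≡ true → nbr u (σ′ u) x ≡ true ⊎ not (coreᵇ x) ≡ true
        cover x r with true⊎false (coreᵇ x)
        ... | inj₂ t = inj₂ (cong not t)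
        ... | inj₁ t = inj₁ (∧-intro {G u x} (proj₁ (∧-true r)) (∧-intro {coreᵇ x} t
                         (side-self σ {σ′ u} {x} (trans (sym (core-σ′ t)) (sym (not-xor {σ′ u} {σ′ x} (proj₂ (∧-true {G u x} r))))))))

      -- Every inner edge has a deficient end, and a vertex has at most `2 * n / c` neighbours on
      -- its own side, half of this bound for core vertices and half for exceptional ones. A further
      -- factor 2 arises because either end of an ordered pair may be the deficient one.
      inner≤ : c * inner G σ′ ≤ 4 * n * E
      inner≤ = begin
        c * inner G σ′
          ≤⟨ *-monoʳ-≤ c (sum-mono λ u → sum-mono λ v → term u v (same-side u v) refl) ⟩
        c * (sum λ u → sum λ v → 𝟙 (deficientᵇ u) * 𝟙 (same-side u v) + 𝟙 (deficientᵇ v) * 𝟙 (same-side u v))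
          ≡⟨ cong (c *_) (trans (sum-cong-≗ λ u → sum-+ (λ v → 𝟙 (deficientᵇ u) * 𝟙 (same-side u v)) (λ v → 𝟙 (deficientᵇ v) * 𝟙 (same-side u v)))
                                (sum-+ (λ u → sum λ v → 𝟙 (deficientᵇ u) * 𝟙 (same-side u v)) (λ u → sum λ v → 𝟙 (deficientᵇ v) * 𝟙 (same-side u v)))) ⟩
        c * ((sum λ u → sum λ v → 𝟙 (deficientᵇ u) * 𝟙 (same-side u v)) + (sum λ u → sum λ v → 𝟙 (deficientᵇ v) * 𝟙 (same-side u v)))
          ≡⟨ cong (λ t → c * ((sum λ u → sum λ v → 𝟙 (deficientᵇ u) * 𝟙 (same-side u v)) + t))
                  (trans (sum-comm₂ (λ u v → 𝟙 (deficientᵇ v) * 𝟙 (same-side u v)))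
                         (sum-cong-≗ λ u → sum-cong-≗ λ v → cong (λ t → 𝟙 (deficientᵇ u) * 𝟙 t) (same-sym v u))) ⟩
        c * (X + X)
          ≡⟨ ring₁ c X ⟩
        2 * (c * X)
          ≡⟨ cong (λ t → 2 * (c * t)) (sum-cong-≗ λ u → sum-*ˡ (𝟙 (deficientᵇ u)) (𝟙 ∘ same-side u)) ⟩
        2 * (c * (sum λ u → 𝟙 (deficientᵇ u) * # (same-side u)))
          ≡⟨ cong (2 *_) (sym (sum-*ˡ c (λ u → 𝟙 (deficientᵇ u) * # (same-side u)))) ⟩
        2 * (sum λ u → c * (𝟙 (deficientᵇ u) * # (same-side u)))
          ≤⟨ *-monoʳ-≤ 2 (sum-mono λ u → ≤-trans (≤-reflexive (ring₂ c (𝟙 (deficientᵇ u)) (# (same-side u))))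
                                         (≤-trans (*-monoʳ-≤ (𝟙 (deficientᵇ u)) (row≤ u)) (≤-reflexive (*-comm (𝟙 (deficientᵇ u)) (2 * n))))) ⟩
        2 * (sum λ u → 2 * n * 𝟙 (deficientᵇ u))
          ≡⟨ cong (2 *_) (sum-*ˡ (2 * n) (𝟙 ∘ deficientᵇ)) ⟩
        2 * (2 * n * E)
          ≡⟨ ring₃ n E ⟩
        4 * n * E  ∎
        where
        open ≤-Reasoning
        X : ℕ
        X = sum λ u → sum λ v → 𝟙 (deficientᵇ u) * 𝟙 (same-side u v)
        ring₁ : ∀ c x → c * (x + x) ≡ 2 * (c * x)
        ring₁ = solve-∀
        ring₂ : ∀ c d x → c * (d * x) ≡ d * (c * x)
        ring₂ = solve-∀
        ring₃ : ∀ n x → 2 * (2 * n * x) ≡ 4 * n * x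
        ring₃ = solve-∀
        same-sym : ∀ u v → same-side u v ≡ same-side v u
        same-sym u v = cong₂ (λ s t → s ∧ not t) (G-sym u v) (xor-comm (σ′ u) (σ′ v))
        term : ∀ u v s → same-side u v ≡ s → 𝟙 s ≤ 𝟙 (deficientᵇ u) * 𝟙 s + 𝟙 (deficientᵇ v) * 𝟙 s
        term u v false _ = z≤n
        term u v true  r with true⊎false (deficientᵇ u) | true⊎false (deficientᵇ v)
        ... | inj₁ t | _      = ≤-trans (*-mono-≤ (true⇒1≤𝟙 t) ≤-refl) (m≤m+n _ _)
        ... | _      | inj₁ t = ≤-trans (*-mono-≤ (true⇒1≤𝟙 t) ≤-refl) (m≤n+m _ _)
        ... | inj₂ t | inj₂ t′ = ⊥-elim (inner-edge-deficient u v (proj₁ (∧-true r)) (not-xor (proj₂ (∧-true {G u v} r))) t t′)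

      missing≥ : n * E ≤ e * missing G σ′
      missing≥ = begin
        n * E  ≡⟨ sym (sum-*ˡ n (𝟙 ∘ deficientᵇ)) ⟩
        (sum λ u → n * 𝟙 (deficientᵇ u))  ≤⟨ sum-mono term ⟩
        (sum λ u → e * # (far u))  ≡⟨ sum-*ˡ e (λ u → # (far u)) ⟩
        e * (sum λ u → # (far u))  ≤⟨ *-monoʳ-≤ e (sum-mono λ u → #-mono (far u) (λ v → (σ′ u xor σ′ v) ∧ not (G u v)) (far⊆ u)) ⟩
        e * missing G σ′  ∎
        where
        open ≤-Reasoning
        term : ∀ u → n * 𝟙 (deficientᵇ u) ≤ e * # (far u)
        term u with suc n ≤? e * # (far u)
        ... | yes p = ≤-trans (≤-reflexive (*-identityʳ n)) (<⇒≤ p)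
        ... | no _  = ≤-trans (≤-reflexive (*-zeroʳ n)) z≤n
        far⊆ : ∀ u x → far u x ≡ true → (σ′ u xor σ′ x) ∧ not (G u x) ≡ true
        far⊆ u x r = let x-core = proj₁ (∧-true {core-side (not (σ′ u)) x} r) in
          ∧-intro (xor-not {σ′ u} {σ′ x} (trans (core-σ′ (proj₁ (∧-true x-core))) (core-side-σ {not (σ′ u)} {x} x-core))) (proj₂ (∧-true {core-side (not (σ′ u)) x} r))

    σ′-large : ∀ s → n ≤ 2 * g * # (side σ′ s)
    σ′-large s = ≤-trans (core-side-large s) (*-monoʳ-≤ (2 * g) (#-mono (core-side s) (side σ′ s) λ x r →
      side-self σ′ {s} {x} (trans (core-σ′ (proj₁ (∧-true r))) (core-side-σ {s} {x} r))))

    σ′-large′ : n ≤ 2 * g * # σ′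
    σ′-large′ = ≤-trans (σ′-large true) (*-monoʳ-≤ (2 * g) (#-mono (side σ′ true) σ′ λ x r → side-eq true (σ′ x) r))

    -- Both counts are measured by the number `E` of deficient vertices: `inner` is at most
    -- `4 * n * E / c`, `missing` at least `n * E / e`.
    refined : emb H G ≤ emb H (cut σ′)
    refined = emb≤cut′ bip G σ′ (2 * g) n>0 n≥2g σ′-large′ (σ′-large false)
      (≤-trans (*-monoˡ-≤ (inner G σ′) C≥) (*-cancelˡ-≤ c {{>-nonZero (≤-trans (*-mono-≤ {1} {4} (s≤s z≤n) g>0) c≥4g)}} (begin
        c * (C * inner G σ′)  ≡⟨ ring₁ c C (inner G σ′) ⟩
        C * (c * inner G σ′)  ≤⟨ *-monoʳ-≤ C inner≤ ⟩
        C * (4 * n * E)  ≡⟨ ring₂ C n E ⟩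
        4 * C * (n * E)  ≤⟨ *-monoʳ-≤ (4 * C) missing≥ ⟩
        4 * C * (e * missing G σ′)  ≡⟨ ring₃ C e (missing G σ′) ⟩
        4 * e * C * missing G σ′  ≤⟨ *-monoˡ-≤ (missing G σ′) c≥ ⟩
        c * missing G σ′  ∎)))
      where
      open ≤-Reasoning
      ring₁ : ∀ c C x → c * (C * x) ≡ C * (c * x)
      ring₁ = solve-∀
      ring₂ : ∀ C n x → C * (4 * n * x) ≡ 4 * C * (n * x)
      ring₂ = solve-∀
      ring₃ : ∀ C e m → 4 * C * (e * m) ≡ 4 * e * C * m
      ring₃ = solve-∀

  exceptional≤ : n * # (not ∘ coreᵇ) ≤ b * missing G σ
  exceptional≤ = begin
    n * # (not ∘ coreᵇ)  ≡⟨ sym (sum-*ˡ n (𝟙 ∘ not ∘ coreᵇ)) ⟩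
    (sum λ w → n * 𝟙 (not (coreᵇ w))) ≤⟨ sum-mono term ⟩
    (sum λ w → b * # (cross w))  ≡⟨ sum-*ˡ b (λ w → # (cross w)) ⟩
    b * missing G σ  ∎
    where
    open ≤-Reasoning
    term : ∀ w → n * 𝟙 (not (coreᵇ w)) ≤ b * # (cross w)
    term w with b * # (cross w) ≤? n
    ... | yes _ = ≤-trans (≤-reflexive (*-zeroʳ n)) z≤n
    ... | no p  = ≤-trans (≤-reflexive (*-identityʳ n)) (<⇒≤ (≰⇒> p))

#-initial : ∀ n x → x ≤ n → # {n} (λ i → toℕ i <ᵇ x) ≡ x
#-initial zero    zero    _         = refl
#-initial (suc n) zero    _         = sum-zero n
#-initial (suc n) (suc x) (s≤s x≤n) = cong suc (#-initial n x x≤n)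

-- The partition at a rich edge, and the upper bound

module RichEdge {n : ℕ} (G : Graph n) (G-simple : IsSimple G) (a ℓ K : ℕ) (2a≤ℓ : 2 * a ≤ ℓ) (2ℓ≤K : 2 * ℓ ≤ K)
  (tri≤ : ∀ u → K * tri G u ≤ n * n) (u v : Fin n) (ℓt≤n : ℓ * codeg G v u ≤ n)
  (n≤adu : n ≤ a * deg G u) (n≤adv : n ≤ a * deg G v) (sum-large : ℓ * n ≤ ℓ * (deg G u + deg G v) + n) where

  open ≤-Reasoning

  private
    -- The parts will be the neighbourhood of `v` and its complement; the latter is the
    -- neighbourhood of `u` up to common neighbours and `outside`.
    outside : Fin n → Bool
    outside x = not (G v x) ∧ not (G u x)

    outside-few : ℓ * # outside ≤ 2 * n
    outside-few = ≤-by 0 (+-mono-≤ (≤-reflexive (cong (ℓ *_) count)) (+-mono-≤ ℓt≤n sum-large))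
      (ring ℓ (# outside) (deg G u) (deg G v) n (codeg G v u))
      where
      count : # outside + (deg G v + deg G u) ≡ n + codeg G v u
      count = begin-equality
        # outside + (deg G v + deg G u)
          ≡⟨ sym (trans (sum-+ (𝟙 ∘ outside) (λ x → 𝟙 (G v x) + 𝟙 (G u x))) (cong (# outside +_) (sum-+ (𝟙 ∘ G v) (𝟙 ∘ G u)))) ⟩
        sum (λ x → 𝟙 (outside x) + (𝟙 (G v x) + 𝟙 (G u x)))
          ≡⟨ sum-cong-≗ (λ x → incl (G v x) (G u x)) ⟩
        sum (λ x → 1 + 𝟙 (G v x ∧ G u x))
          ≡⟨ trans (sum-+ {n} (λ _ → 1) (λ x → 𝟙 (G v x ∧ G u x))) (cong (_+ codeg G v u) (trans (sum-const n 1) (*-identityʳ n))) ⟩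
        n + codeg G v u  ∎
        where
        incl : ∀ s t → 𝟙 (not s ∧ not t) + (𝟙 s + 𝟙 t) ≡ 1 + 𝟙 (s ∧ t)
        incl true  true  = refl
        incl true  false = refl
        incl false true  = refl
        incl false false = refl
      ring : ∀ l z x y n t → 2 * n + (l * (z + (y + x)) + (l * t + l * n)) ≡ l * z + (l * (n + t) + (n + (l * (x + y) + n))) + 0
      ring = solve-∀

  -- An adjacent inner pair lies in the neighbourhood of `v`, or in that of `u`, or meets `outside`.
  -- The first two kinds are triangles, at most `n * n / (2 * ℓ)` of each as `2 * ℓ ≤ K`; the last
  -- kind numbers at most `2 * n * (2 * n / ℓ)`.
  sides-inner : ℓ * inner G (G v) ≤ 5 * (n * n)
  sides-inner = *-cancelˡ-≤ 2 (begin
    2 * (ℓ * inner G (G v))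
      ≤⟨ *-monoʳ-≤ 2 (*-monoʳ-≤ ℓ split) ⟩
    2 * (ℓ * (tri G v + tri G u + (n * # outside + n * # outside)))
      ≡⟨ ring ℓ (tri G v) (tri G u) n (# outside) ⟩
    2 * ℓ * tri G v + 2 * ℓ * tri G u + 4 * n * (ℓ * # outside)
      ≤⟨ +-mono-≤ (+-mono-≤ (≤-trans (*-monoˡ-≤ (tri G v) 2ℓ≤K) (tri≤ v)) (≤-trans (*-monoˡ-≤ (tri G u) 2ℓ≤K) (tri≤ u)))
                  (*-monoʳ-≤ (4 * n) outside-few) ⟩
    n * n + n * n + 4 * n * (2 * n)
      ≡⟨ ring′ n ⟩
    2 * (5 * (n * n))  ∎)
    where
    ring : ∀ l s t n z → 2 * (l * (s + t + (n * z + n * z))) ≡ 2 * l * s + 2 * l * t + 4 * n * (l * z)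
    ring = solve-∀
    ring′ : ∀ n → n * n + n * n + 4 * n * (2 * n) ≡ 2 * (5 * (n * n))
    ring′ = solve-∀
    tri-sum : ∀ w → (sum λ x → sum λ y → 𝟙 (G w x) * 𝟙 (G w y ∧ G x y)) ≡ tri G w
    tri-sum w = sum-cong-≗ λ x → sum-*ˡ (𝟙 (G w x)) (λ y → 𝟙 (G w y ∧ G x y))
    pointwise : ∀ vx vy ux uy xy → 𝟙 (xy ∧ not (vx xor vy)) ≤
      (𝟙 vx * 𝟙 (vy ∧ xy) + 𝟙 ux * 𝟙 (uy ∧ xy)) + (𝟙 (not vx ∧ not ux) + 𝟙 (not vy ∧ not uy))
    pointwise vx    vy    ux    uy    false = z≤n
    pointwise true  true  ux    uy    true  = s≤s z≤n
    pointwise true  false ux    uy    true  = z≤n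
    pointwise false true  ux    uy    true  = z≤n
    pointwise false false true  true  true  = s≤s z≤n
    pointwise false false true  false true  = s≤s z≤n
    pointwise false false false uy    true  = s≤s z≤n
    split : inner G (G v) ≤ tri G v + tri G u + (n * # outside + n * # outside)
    split = begin
      inner G (G v)
        ≤⟨ sum-mono (λ x → sum-mono λ y → pointwise (G v x) (G v y) (G u x) (G u y) (G x y)) ⟩
      sum (λ x → sum λ y → A v x y + A u x y + (𝟙 (outside x) + 𝟙 (outside y)))
        ≡⟨ sum-cong-≗ (λ x → trans (sum-+ (λ y → A v x y + A u x y) (λ y → 𝟙 (outside x) + 𝟙 (outside y)))
             (cong₂ _+_ (sum-+ (A v x) (A u x))
                        (trans (sum-+ {n} (λ _ → 𝟙 (outside x)) (𝟙 ∘ outside)) (cong (_+ # outside) (sum-const n (𝟙 (outside x))))))) ⟩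
      sum (λ x → (sum (A v x) + sum (A u x)) + (n * 𝟙 (outside x) + # outside))
        ≡⟨ trans (sum-+ (λ x → sum (A v x) + sum (A u x)) (λ x → n * 𝟙 (outside x) + # outside))
             (cong₂ _+_ (trans (sum-+ (λ x → sum (A v x)) (λ x → sum (A u x))) (cong₂ _+_ (tri-sum v) (tri-sum u)))
                        (trans (sum-+ (λ x → n * 𝟙 (outside x)) (λ _ → # outside)) (cong₂ _+_ (sum-*ˡ n (𝟙 ∘ outside)) (sum-const n (# outside))))) ⟩
      tri G v + tri G u + (n * # outside + n * # outside)  ∎
      where
      A : Fin n → Fin n → Fin n → ℕ
      A w x y = 𝟙 (G w x) * 𝟙 (G w y ∧ G x y)

  side₁ : n ≤ 2 * a * # (G v)
  side₁ = ≤-trans n≤adv (*-monoˡ-≤ (deg G v) (m≤m+n a (1 * a)))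

  -- The complement contains the neighbourhood of `u` except for at most `n / ℓ ≤ n / (2 * a)`
  -- common neighbours.
  side₂ : n ≤ 2 * a * # (not ∘ G v)
  side₂ = ≤-by 0 (+-mono-≤ (+-mono-≤ n≤ n≤) (≤-trans (*-monoˡ-≤ (codeg G v u) 2a≤ℓ) ℓt≤n)) (ring a (# (not ∘ G v)) (codeg G v u) n)
    where
    n≤ : n ≤ a * (# (not ∘ G v) + codeg G v u)
    n≤ = ≤-trans n≤adu (*-monoʳ-≤ a (#-cover (G u) (not ∘ G v) (λ x → G v x ∧ G u x) λ x r →
      case true⊎false (G v x) of λ { (inj₁ t) → inj₂ (∧-intro t r) ; (inj₂ t) → inj₁ (cong not t) }))
    ring : ∀ a s t n → 2 * a * s + (n + n + 2 * a * t) ≡ n + (a * (s + t) + a * (s + t) + n) + 0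
    ring = solve-∀

module UpperBound {h : ℕ} {H : Graph h} (dom : DominatingBiclique H) (p q : ℕ)
  (p≡ : # (DominatingBiclique.χ dom) ≡ suc p) (q≡ : # (not ∘ DominatingBiclique.χ dom) ≡ suc q)
  (f c₀ g C e c b ℓ K : ℕ)
  (c₀≡ : c₀ ≡ 3 ^ (suc p + suc q)) (g≡ : g ≡ 2 * (4 * c₀)) (C≡ : C ≡ cutConst h (2 * g)) (e≡ : e ≡ 8 * g)
  (c≡ : c ≡ 4 * e * C + 4 * g) (b≡ : b ≡ 4 * c) (ℓ≡ : ℓ ≡ 5 * b * C * c + g) (K≡ : K ≡ 4 * (4 * c₀ * ℓ) * (ℓ * ℓ) * c₀ + 2 * ℓ)
  {n : ℕ} (G : Graph n) (G-simple : IsSimple G) (noBook : NoBook f G)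
  (n≥2 : 2 ≤ n) (n≥4c : 4 * c ≤ n) (n≥4g : 2 * (2 * g) * (h + 2) ≤ n) (n≥16g : 16 * g ≤ n)
  (n≥book₁ : book-n₀ f (2 * c) ≤ n) (n≥book₂ : book-n₀ f (4 * g) ≤ n) (n≥tri : tri-n₀ f K ≤ n)
  (n≥D : 2 * (4 * c₀ * ℓ) * (h * h * c₀) ≤ n)
  (M : ℕ) (cut≤M : ∀ (σ : Fin n → Bool) → 0 < # σ → 0 < # (not ∘ σ) → emb H (cut σ) ≤ M) where

  open DominatingBiclique dom using (χ; bipartite)
  open ≤-Reasoning

  private
    n>0 : 0 < n
    n>0 = ≤-trans (s≤s z≤n) n≥2
    c₀>0 : 0 < c₀
    c₀>0 = ≤-trans (m^n>0 3 (suc p + suc q)) (≤-reflexive (sym c₀≡))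
    g>0 : 0 < g
    g>0 = ≤-trans (*-mono-≤ {1} {2} (s≤s z≤n) (*-mono-≤ {1} {4} (s≤s z≤n) c₀>0)) (≤-reflexive (sym g≡))
    C>0 : 0 < C
    C>0 = subst (0 <_) (sym C≡) (s≤s z≤n)
    g≤ℓ : g ≤ ℓ
    g≤ℓ = ≤-trans (m≤n+m g (5 * b * C * c)) (≤-reflexive (sym ℓ≡))
    ℓ>0 : 0 < ℓ
    ℓ>0 = ≤-trans g>0 g≤ℓ
    2ℓ≤K : 2 * ℓ ≤ K
    2ℓ≤K = ≤-trans (m≤n+m (2 * ℓ) (4 * (4 * c₀ * ℓ) * (ℓ * ℓ) * c₀)) (≤-reflexive (sym K≡))
    c≥4g : 4 * g ≤ c
    c≥4g = ≤-trans (m≤n+m (4 * g) (4 * e * C)) (≤-reflexive (sym c≡))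
    c>0 : 0 < c
    c>0 = ≤-trans (*-mono-≤ {1} {4} (s≤s z≤n) g>0) c≥4g
    b>0 : 0 < b
    b>0 = ≤-trans (*-mono-≤ {1} {4} (s≤s z≤n) c>0) (≤-reflexive (sym b≡))

    tri≤ : ∀ u → K * tri G u ≤ n * n
    tri≤ = tri-small f K G G-simple noBook n≥tri

    h≡ : suc p + suc q ≡ h
    h≡ = trans (sym (cong₂ _+_ p≡ q≡)) (#-not χ)

    -- The copies of H in a bipartite graph with parts x, y number at least biHom p q x y ∸ E.
    E M⁺ : ℕ
    E  = h * h * n ^ (p + suc q)
    M⁺ = M + E

    M-max : ∀ x y → x + y ≡ n → biHom p q x y ≤ M⁺
    M-max zero    y       _ = ≤-trans (≤-reflexive refl) z≤n
    M-max (suc x) zero    _ = ≤-trans (≤-reflexive (biHom-sym p q (suc x) 0)) z≤n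
    M-max (suc x) (suc y) x+y≡n = *-cancelʳ-≤ _ _ (n * n) {{>-nonZero (*-mono-≤ n>0 n>0)}} (begin
      biHom p q (suc x) (suc y) * (n * n)
        ≡⟨ cong (_* (n * n)) (cong₂ (λ s t → s ^ suc p * t ^ suc q + s ^ suc q * t ^ suc p) (sym #σ) (sym #σ′)) ⟩
      (# σ ^ suc p * # (not ∘ σ) ^ suc q + # σ ^ suc q * # (not ∘ σ) ^ suc p) * (n * n)
        ≡⟨ cong₂ (λ s t → (# σ ^ s * # (not ∘ σ) ^ t + # σ ^ t * # (not ∘ σ) ^ s) * (n * n)) (sym p≡) (sym q≡) ⟩
      (# σ ^ # χ * # (not ∘ σ) ^ # (not ∘ χ) + # σ ^ # (not ∘ χ) * # (not ∘ σ) ^ # χ) * (n * n)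
        ≤⟨ homs-cut bipartite G σ ⟩
      emb H (cut σ) * (n * n) + h * (h * (n * n ^ h))
        ≤⟨ +-monoˡ-≤ (h * (h * (n * n ^ h))) (*-monoˡ-≤ (n * n) (cut≤M σ (subst (0 <_) (sym #σ) (s≤s z≤n)) (subst (0 <_) (sym #σ′) (s≤s z≤n)))) ⟩
      M * (n * n) + h * (h * (n * n ^ h))
        ≡⟨ cong (λ t → M * (n * n) + h * (h * (n * n ^ t))) (sym h≡) ⟩
      M * (n * n) + h * (h * (n * (n * n ^ (p + suc q))))
        ≡⟨ ring M n h (n ^ (p + suc q)) ⟩
      M⁺ * (n * n)  ∎)
      where
      σ : Fin n → Bool
      σ i = toℕ i <ᵇ suc x
      #σ : # σ ≡ suc x
      #σ = #-initial n (suc x) (≤-trans (m≤m+n (suc x) (suc y)) (≤-reflexive x+y≡n))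
      #σ′ : # (not ∘ σ) ≡ suc y
      #σ′ = +-cancelˡ-≡ (suc x) _ _ (trans (cong (_+ # (not ∘ σ)) (sym #σ)) (trans (#-not σ) (sym x+y≡n)))
      ring : ∀ M n h t → M * (n * n) + h * (h * (n * (n * t))) ≡ (M + h * h * t) * (n * n)
      ring = solve-∀

    -- Tested on the balanced pair: for `n ≥ 2` both halves are at least `n / 3`, whence the base 3
    -- in `c₀`.
    M-large : n ^ (suc p + suc q) ≤ c₀ * M⁺
    M-large = begin
      n ^ (suc p + suc q)  ≡⟨ ^-distribˡ-+-* n (suc p) (suc q) ⟩
      n ^ suc p * n ^ suc q  ≤⟨ *-mono-≤ (^-monoˡ-≤ (suc p) n≤3x) (^-monoˡ-≤ (suc q) n≤3y) ⟩
      (3 * x) ^ suc p * (3 * y) ^ suc q  ≡⟨ cong₂ _*_ (^-distrib-* (suc p) 3 x) (^-distrib-* (suc q) 3 y) ⟩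
      3 ^ suc p * x ^ suc p * (3 ^ suc q * y ^ suc q)  ≡⟨ ring (3 ^ suc p) (x ^ suc p) (3 ^ suc q) (y ^ suc q) ⟩
      3 ^ suc p * 3 ^ suc q * (x ^ suc p * y ^ suc q)  ≡⟨ cong (_* (x ^ suc p * y ^ suc q)) (sym (trans c₀≡ (^-distribˡ-+-* 3 (suc p) (suc q)))) ⟩
      c₀ * (x ^ suc p * y ^ suc q)  ≤⟨ *-monoʳ-≤ c₀ (m≤m+n _ _) ⟩
      c₀ * biHom p q x y  ≤⟨ *-monoʳ-≤ c₀ (M-max x y (⌊n/2⌋+⌈n/2⌉≡n n)) ⟩
      c₀ * M⁺  ∎
      where
      x y : ℕ
      x = ⌊ n /2⌋
      y = ⌈ n /2⌉
      ring : ∀ s a t b → s * a * (t * b) ≡ s * t * (a * b)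
      ring = solve-∀
      ring₃ : ∀ x → x + (x + x) ≡ 3 * x
      ring₃ = solve-∀
      half : ∀ m → 2 ≤ m → ⌈ m /2⌉ ≤ ⌊ m /2⌋ + ⌊ m /2⌋
      half (suc zero) (s≤s ())
      half (suc (suc zero)) _ = s≤s z≤n
      half (suc (suc (suc zero))) _ = ≤-refl
      half (suc (suc (suc (suc m)))) _ = s≤s (≤-trans (half (suc (suc m)) (s≤s (s≤s z≤n))) (+-monoʳ-≤ ⌊ suc (suc m) /2⌋ (n≤1+n ⌊ suc (suc m) /2⌋)))
      n≤3x : n ≤ 3 * x
      n≤3x = ≤-trans (≤-reflexive (sym (⌊n/2⌋+⌈n/2⌉≡n n))) (≤-trans (+-monoʳ-≤ x (half n n≥2)) (≤-reflexive (ring₃ x)))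
      n≤3y : n ≤ 3 * y
      n≤3y = ≤-trans n≤3x (*-monoʳ-≤ 3 (⌊n/2⌋≤⌈n/2⌉ n))

    module EB = EdgeBound p q n c₀ ℓ M⁺ n>0 c₀>0 ℓ>0 M-max M-large
    a D : ℕ
    a = 4 * c₀
    D = a * ℓ

    z₀ : Fin n
    z₀ = Fin.fromℕ< n>0

    -- The loss `M⁺ / (2 * D)` is at least the correction `E`: `M⁺` is at least `n ^ h / c₀` while
    -- `E` is `h * h * n ^ (h - 1)`, and `n≥D` makes `n` large enough. So the bound holds for `M`
    -- itself.
    no-rich-edge : (∀ u v → G u v ≡ true → (n ≤ ℓ * codeg G u v) ⊎ (a * deg G u ≤ n) ⊎ (a * deg G v ≤ n) ⊎
              (ℓ * (deg G u + deg G v) + n ≤ ℓ * n × n ≤ a * deg G v)) → emb H G ≤ M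
    no-rich-edge poor = *-cancelˡ-≤ (2 * D) {{>-nonZero (*-mono-≤ {1} {2} (s≤s z≤n) (*-mono-≤ (*-mono-≤ {1} {4} (s≤s z≤n) c₀>0) ℓ>0))}}
      (≤-by 0 (+-mono-≤ small 2DE≤M) (ring D (emb H G) M E))
      where
      open EB.NoRichEdge G G-simple K (≤-trans (m≤m+n (4 * (4 * c₀ * ℓ) * (ℓ * ℓ) * c₀) (2 * ℓ)) (≤-reflexive (sym K≡))) tri≤ poor
      small : 2 * (D * emb H G) + M⁺ ≤ 2 * (D * M⁺)
      small = ≤-trans (+-monoˡ-≤ M⁺ (*-monoʳ-≤ 2 (*-monoʳ-≤ D (emb≤edgeWeight dom G G-simple z₀ p q p≡ q≡)))) edgeWeight-small
      ring : ∀ D x M E → 2 * D * M + (2 * (D * x) + (M + E) + 2 * D * E) ≡ 2 * D * x + (2 * (D * (M + E)) + (M + E)) + 0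
      ring = solve-∀
      ring₁ : ∀ n D h t → n * (2 * D * (h * h * t)) ≡ 2 * D * (h * h) * (n * t)
      ring₁ = solve-∀
      ring₂ : ∀ D h c m → 2 * D * (h * h) * (c * m) ≡ 2 * D * (h * h * c) * m
      ring₂ = solve-∀
      2DE≤M : 2 * D * E ≤ M⁺
      2DE≤M = *-cancelˡ-≤ n {{>-nonZero n>0}} (begin
        n * (2 * D * E)  ≡⟨ ring₁ n D h (n ^ (p + suc q)) ⟩
        2 * D * (h * h) * n ^ (suc p + suc q)  ≤⟨ *-monoʳ-≤ (2 * D * (h * h)) M-large ⟩
        2 * D * (h * h) * (c₀ * M⁺)  ≡⟨ ring₂ D h c₀ M⁺ ⟩
        2 * D * (h * h * c₀) * M⁺  ≤⟨ *-monoˡ-≤ M⁺ n≥D ⟩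
        n * M⁺  ∎)

    cut-bound : ∀ {x} σ → n ≤ x * # σ → n ≤ x * # (not ∘ σ) → emb H (cut σ) ≤ M
    cut-bound {x} σ l l′ = cut≤M σ (proj₂ (*-pos {x} (≤-trans n>0 l))) (proj₂ (*-pos {x} (≤-trans n>0 l′)))

    module FromRich (u v : Fin n) (t≤ : ℓ * codeg G v u ≤ n) (du : n ≤ a * deg G u) (dv : n ≤ a * deg G v)
      (sum-large : ℓ * n ≤ ℓ * (deg G u + deg G v) + n) where
      open RichEdge G G-simple a ℓ K (subst (_≤ ℓ) g≡ g≤ℓ) 2ℓ≤K tri≤ u v t≤ du dv sum-large
      σ : Fin n → Bool
      σ = G v
      n≤σ : n ≤ g * # σ
      n≤σ = subst (λ t → n ≤ t * # σ) (sym g≡) side₁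
      n≤σ′ : n ≤ g * # (not ∘ σ)
      n≤σ′ = subst (λ t → n ≤ t * # (not ∘ σ)) (sym g≡) side₂
      double : ∀ {m} → n ≤ g * m → n ≤ 2 * g * m
      double {m} l = ≤-trans l (*-monoˡ-≤ m (m≤m+n g (1 * g)))
      module R = Refine bipartite G G-simple f noBook σ g g>0 n>0 n≤σ n≤σ′ C e c b
        (≤-reflexive (sym C≡)) (≤-reflexive (sym e≡)) (≤-trans (m≤m+n _ (4 * g)) (≤-reflexive (sym c≡))) c≥4g (≤-reflexive (sym b≡))
      k : ℕ
      k = # (not ∘ R.coreᵇ)
      ring₁ : ∀ x c n k → n * (x * (c * k)) ≡ x * c * (n * k)
      ring₁ = solve-∀
      ring₂ : ∀ ℓ b m → ℓ * (b * m) ≡ b * (ℓ * m)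
      ring₂ = solve-∀
      ring₃ : ∀ b ℓ C i → b * (ℓ * (C * i)) ≡ b * C * (ℓ * i)
      ring₃ = solve-∀
      ring₄ : ∀ b C n → b * C * (5 * (n * n)) ≡ n * (5 * b * C * n)
      ring₄ = solve-∀
      -- Each exceptional vertex misses more than `n / b` vertices across. With `missing` at most
      -- `C * inner` and `inner` at most `5 * n * n / ℓ`, the choice `ℓ ≥ 5 * b * C * c` leaves at
      -- most `n / c` of them.
      exceptional : missing G σ ≤ C * inner G σ → c * k ≤ n
      exceptional many = *-cancelˡ-≤ (5 * b * C) {{>-nonZero (*-mono-≤ (*-mono-≤ {1} {5} (s≤s z≤n) b>0) C>0)}}
        (*-cancelˡ-≤ n {{>-nonZero n>0}} (begin
        n * (5 * b * C * (c * k))  ≡⟨ ring₁ (5 * b * C) c n k ⟩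
        5 * b * C * c * (n * k)  ≤⟨ *-monoˡ-≤ (n * k) (≤-trans (m≤m+n _ g) (≤-reflexive (sym ℓ≡))) ⟩
        ℓ * (n * k)  ≤⟨ *-monoʳ-≤ ℓ R.exceptional≤ ⟩
        ℓ * (b * missing G σ)  ≡⟨ ring₂ ℓ b (missing G σ) ⟩
        b * (ℓ * missing G σ)  ≤⟨ *-monoʳ-≤ b (*-monoʳ-≤ ℓ many) ⟩
        b * (ℓ * (C * inner G σ))  ≡⟨ ring₃ b ℓ C (inner G σ) ⟩
        b * C * (ℓ * inner G σ)  ≤⟨ *-monoʳ-≤ (b * C) sides-inner ⟩
        b * C * (5 * (n * n))  ≡⟨ ring₄ b C n ⟩
        n * (5 * b * C * n)  ∎))
      conclusion : emb H G ≤ M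
      -- If missing pairs already outweigh inner ones, `σ` itself serves; otherwise few pairs are
      -- missing, and the refinement applies.
      conclusion with C * inner G σ ≤? missing G σ
      ... | yes few = ≤-trans (emb≤cut′ bipartite G σ (2 * g) n>0 n≥4g (double n≤σ) (double n≤σ′)
                        (subst (λ t → t * inner G σ ≤ missing G σ) C≡ few)) (cut-bound {2 * g} σ (double n≤σ) (double n≤σ′))
      ... | no many = ≤-trans (R.refined ex n≥4c n≥4g n≥16g n≥book₁ n≥book₂)
                        (cut-bound {2 * g} (R.σ′ ex n≥4c n≥4g n≥16g n≥book₁ n≥book₂)
                          (R.σ′-large′ ex n≥4c n≥4g n≥16g n≥book₁ n≥book₂) (R.σ′-large ex n≥4c n≥4g n≥16g n≥book₁ n≥book₂ false))
        where
        ex = exceptional (<⇒≤ (≰⇒> many))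

  emb≤M : emb H G ≤ M
  emb≤M with any? (λ u → any? λ v → (ℓ * codeg G v u ≤? n) ×-dec (n ≤? a * deg G u) ×-dec (n ≤? a * deg G v) ×-dec
                                     (ℓ * n ≤? ℓ * (deg G u + deg G v) + n))
  ... | yes (u , v , t≤ , du , dv , sum-large) = FromRich.conclusion u v t≤ du dv sum-large
  ... | no none = no-rich-edge poor
    where
    poor : ∀ u v → G u v ≡ true → (n ≤ ℓ * codeg G u v) ⊎ (a * deg G u ≤ n) ⊎ (a * deg G v ≤ n) ⊎
              (ℓ * (deg G u + deg G v) + n ≤ ℓ * n × n ≤ a * deg G v)
    poor u v _ with ℓ * codeg G v u ≤? n | n ≤? a * deg G u | n ≤? a * deg G v | ℓ * n ≤? ℓ * (deg G u + deg G v) + n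
    ... | no t≰ | _ | _ | _ = inj₁ (<⇒≤ (≤-trans (≰⇒> t≰) (≤-reflexive (cong (ℓ *_) (codeg-sym G v u)))))
    ... | _ | no du | _ | _ = inj₂ (inj₁ (<⇒≤ (≰⇒> du)))
    ... | _ | _ | no dv | _ = inj₂ (inj₂ (inj₁ (<⇒≤ (≰⇒> dv))))
    ... | _ | _ | yes dv | no s = inj₂ (inj₂ (inj₂ (<⇒≤ (≰⇒> s) , dv)))
    ... | yes t | yes du | yes dv | yes s = ⊥-elim (none (u , v , t , du , dv , s))

-- Copies and embeddings differ by the factor `aut H`

_≟ᵛ_ : ∀ {n h} (v w : Vec (Fin n) h) → Dec (v ≡ w)
_≟ᵛ_ = Vec.≡-dec _≟_

_≟ˢ_ : ∀ {n} (S T : SubgraphData n) → Dec (S ≡ T)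
_≟ˢ_ = Product.≡-dec (Vec.≡-dec Bool._≟_) (Vec.≡-dec (Vec.≡-dec Bool._≟_))

Vec-ext : ∀ {A : Set} {n} {v w : Vec A n} → (∀ i → lookup v i ≡ lookup w i) → v ≡ w
Vec-ext {v = v} {w} eq = trans (sym (Vec.tabulate∘lookup v)) (trans (Vec.tabulate-cong eq) (Vec.tabulate∘lookup w))

sum-≤1 : ∀ {n} (f : Fin n → ℕ) → (∀ x → f x ≤ 1) → (∀ x y → 0 < f x → 0 < f y → x ≡ y) → sum f ≤ 1
sum-≤1 {zero}  f f≤1 single = z≤n
sum-≤1 {suc n} f f≤1 single with f zero in eq
... | zero  = sum-≤1 (f ∘ suc) (f≤1 ∘ suc) λ x y p q → suc-injective (single (suc x) (suc y) p q)
... | suc k = ≤-trans (≤-reflexive (trans (cong (suc k +_) (trans (sum-cong-≗ none) (sum-zero n))) (+-identityʳ (suc k))))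
                      (≤-trans (≤-reflexive (sym eq)) (f≤1 zero))
  where
  none : ∀ x → f (suc x) ≡ 0
  none x with f (suc x) in eqx
  ... | zero = refl
  ... | suc _ with () ← single zero (suc x) (subst (0 <_) (sym eq) (s≤s z≤n)) (subst (0 <_) (sym eqx) (s≤s z≤n))

∑V-pos : ∀ {n} h (φ : Vec (Fin n) h → ℕ) → 0 < ∑V h φ → ∃ λ v → 0 < φ v
∑V-pos zero    φ pos = [] , pos
∑V-pos (suc h) φ pos = let (x , px) = sum-pos (λ x → ∑V h (φ ∘ (x ∷_))) pos
                           (v , pv) = ∑V-pos h (φ ∘ (x ∷_)) px in x ∷ v , pv

∑V-≤1 : ∀ {n} h (φ : Vec (Fin n) h → ℕ) → (∀ v → φ v ≤ 1) → (∀ v w → 0 < φ v → 0 < φ w → v ≡ w) → ∑V h φ ≤ 1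
∑V-≤1 zero    φ φ≤1 single = φ≤1 []
∑V-≤1 (suc h) φ φ≤1 single = sum-≤1 (λ x → ∑V h (φ ∘ (x ∷_)))
  (λ x → ∑V-≤1 h (φ ∘ (x ∷_)) (φ≤1 ∘ (x ∷_)) λ v w p q → Vec.∷-injectiveʳ (single (x ∷ v) (x ∷ w) p q))
  (λ x y p q → let (v , pv) = ∑V-pos h (φ ∘ (x ∷_)) p
                   (w , pw) = ∑V-pos h (φ ∘ (y ∷_)) q in Vec.∷-injectiveˡ (single (x ∷ v) (y ∷ w) pv pw))

term≤∑V : ∀ {n} h (φ : Vec (Fin n) h → ℕ) v → φ v ≤ ∑V h φ
term≤∑V zero    φ []      = ≤-refl
term≤∑V (suc h) φ (x ∷ v) = ≤-trans (term≤∑V h (φ ∘ (x ∷_)) v) (term≤sum (λ x → ∑V h (φ ∘ (x ∷_))) x)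

-- Double counting on the graph of `T`: each `v` in `P` has a point on it, and injectivity leaves at
-- most one `v` over each `w`.
∑V-injection : ∀ {n m h k} (P : Vec (Fin n) h → Bool) (Q : Vec (Fin m) k → Bool) (T : Vec (Fin n) h → Vec (Fin m) k) →
  (∀ v → P v ≡ true → Q (T v) ≡ true) → (∀ v w → P v ≡ true → P w ≡ true → T v ≡ T w → v ≡ w) →
  ∑V h (𝟙 ∘ P) ≤ ∑V k (𝟙 ∘ Q)
∑V-injection {h = h} {k} P Q T PQ T-inj = begin
  ∑V h (𝟙 ∘ P)  ≤⟨ ∑V-mono h graph ⟩
  ∑V h (λ v → ∑V k λ w → φ v w)  ≡⟨ ∑V-comm h k φ ⟩
  ∑V k (λ w → ∑V h λ v → φ v w)  ≤⟨ ∑V-mono k fibre ⟩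
  ∑V k (𝟙 ∘ Q)  ∎
  where
  open ≤-Reasoning
  φ : _ → _ → ℕ
  φ v w = 𝟙 (P v ∧ ⌊ T v ≟ᵛ w ⌋)
  φ-elim : ∀ v w → 0 < φ v w → P v ≡ true × T v ≡ w
  φ-elim v w pos = let (p , t) = ∧-true {P v} (𝟙-pos pos) in p , ⌊⌋-sound (T v ≟ᵛ w) t
  graph : ∀ v → 𝟙 (P v) ≤ ∑V k (φ v)
  graph v = ≤-trans (𝟙-mono λ p → ∧-intro p (⌊⌋-complete (T v ≟ᵛ T v) refl)) (term≤∑V k (φ v) (T v))
  fibre : ∀ w → ∑V h (λ v → φ v w) ≤ 𝟙 (Q w)
  fibre w = 01-≤ (∑V-≤1 h (λ v → φ v w) (λ v → 𝟙≤1 (P v ∧ ⌊ T v ≟ᵛ w ⌋)) λ v v′ p p′ →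
                    let (q , e) = φ-elim v w p ; (q′ , e′) = φ-elim v′ w p′ in T-inj v v′ q q′ (trans e (sym e′)))
                 λ pos → let (v , p) = ∑V-pos h (λ v → φ v w) pos ; (q , e) = φ-elim v w p
                         in true⇒1≤𝟙 (subst (λ t → Q t ≡ true) e (PQ v q))

IsAut : ∀ {h} → Graph h → (Fin h → Fin h) → Set
IsAut H σ = (∀ i j → σ i ≡ σ j → i ≡ j) × (∀ j → ∃ λ i → σ i ≡ j) × (∀ i j → H (σ i) (σ j) ≡ H i j)

isAut? : ∀ {h} (H : Graph h) (σ : Fin h → Fin h) → Dec (IsAut H σ)
isAut? H σ = (all? λ i → all? λ j → (σ i ≟ σ j) →-dec (i ≟ j)) ×-dec (all? λ j → any? λ i → σ i ≟ j)
       ×-dec (all? λ i → all? λ j → H (σ i) (σ j) Bool.≟ H i j)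

autᵇ : ∀ {h} → Graph h → Vec (Fin h) h → Bool
autᵇ H v = ⌊ isAut? H (lookup v) ⌋

aut : ∀ {h} → Graph h → ℕ
aut {h} H = ∑V h (𝟙 ∘ autᵇ H)

aut>0 : ∀ {h} (H : Graph h) → 0 < aut H
aut>0 {h} H = ≤-trans (true⇒1≤𝟙 (⌊⌋-complete (isAut? H (lookup ι))
    ((λ i j eq → trans (sym (l i)) (trans eq (l j))) , (λ j → j , l j) , λ i j → cong₂ H (l i) (l j))))
  (term≤∑V h (𝟙 ∘ autᵇ H) ι)
  where
  ι : Vec (Fin h) h
  ι = tabulate id
  l : ∀ i → lookup ι i ≡ i
  l = lookup∘tabulate id

subgraph-ext : ∀ {n} {S T : SubgraphData n} → (∀ v → inV S v ≡ inV T v) → (∀ u v → inE S u v ≡ inE T u v) → S ≡ T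
subgraph-ext eqV eqE = cong₂ _,_ (Vec-ext eqV) (Vec-ext λ u → Vec-ext (eqE u))

-- The embeddings of H with a given image S are obtained from one of them by composing with the automorphisms of H.
embeddings-onto : ∀ {h n} (H : Graph h) (G : Graph n) (S : SubgraphData n) → IsSimple H → IsCopy H G S →
  ∑V h (λ f → 𝟙 (homᵇ H G f ∧ ⌊ image H (lookup f) ≟ˢ S ⌋)) ≡ aut H
embeddings-onto {h} {n} H G S H-simple ((_ , sub) , e , e-inj , e-V , e-onto , e-E) =
  ≤-antisym (∑V-injection Onto (autᵇ H) back back-aut back-inj) (∑V-injection (autᵇ H) Onto forth forth-onto forth-inj)
  where
  Onto : Vec (Fin n) h → Bool
  Onto f = homᵇ H G f ∧ ⌊ image H (lookup f) ≟ˢ S ⌋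
  onto : ∀ f → Onto f ≡ true → IsHom H G (lookup f) × image H (lookup f) ≡ S
  onto f r = let (p , q) = ∧-true {homᵇ H G f} r in homᵇ-sound H G f p , ⌊⌋-sound (image H (lookup f) ≟ˢ S) q
  -- The default `i` is taken off the vertex set of `S`; embeddings with image `S` stay inside that
  -- set.
  e⁻¹ : Fin n → Fin h → Fin h
  e⁻¹ v i with inV S v Bool.≟ true
  ... | yes p = proj₁ (e-onto v p)
  ... | no _  = i
  e∘e⁻¹ : ∀ v i → inV S v ≡ true → e (e⁻¹ v i) ≡ v
  e∘e⁻¹ v i p with inV S v Bool.≟ true
  ... | yes p′ = proj₂ (e-onto v p′)
  ... | no ¬p  = ⊥-elim (¬p p)
  back : Vec (Fin n) h → Vec (Fin h) h
  back f = tabulate λ i → e⁻¹ (lookup f i) i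
  e-back : ∀ f → Onto f ≡ true → ∀ i → e (lookup (back f) i) ≡ lookup f i
  e-back f r i = trans (cong e (lookup∘tabulate _ i)) (e∘e⁻¹ (lookup f i) i
    (subst (λ T → inV T (lookup f i) ≡ true) (proj₂ (onto f r)) (inV-image-intro H (lookup f) i)))
  back-aut : ∀ f → Onto f ≡ true → autᵇ H (back f) ≡ true
  back-aut f r = ⌊⌋-complete (isAut? H (lookup (back f)))
    ( (λ i j eq → IsHom.inj f-hom i j (trans (sym (eb i)) (trans (cong e eq) (eb j))))
    , (λ j → let (i , fi≡ej) = inV-image-elim H (lookup f) (e j) (subst (λ T → inV T (e j) ≡ true) (sym f-image) (e-V j))
             in i , e-inj (trans (eb i) fi≡ej))
    , λ i j → trans (e-E _ _) (trans (cong₂ (inE S) (eb i) (eb j)) (trans (cong (λ T → inE T (lookup f i) (lookup f j)) (sym f-image))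
        (sym (proj₂ (proj₂ (proj₂ (proj₂ (proj₂ (image-isCopy H G (lookup f) H-simple f-hom))))) i j)))))
    where
    f-hom = proj₁ (onto f r)
    f-image = proj₂ (onto f r)
    eb = e-back f r
  back-inj : ∀ f f′ → Onto f ≡ true → Onto f′ ≡ true → back f ≡ back f′ → f ≡ f′
  back-inj f f′ r r′ eq = Vec-ext λ i → trans (sym (e-back f r i)) (trans (cong (λ t → e (lookup t i)) eq) (e-back f′ r′ i))
  forth : Vec (Fin h) h → Vec (Fin n) h
  forth σ = tabulate λ i → e (lookup σ i)
  l : ∀ σ i → lookup (forth σ) i ≡ e (lookup σ i)
  l σ i = lookup∘tabulate (λ i → e (lookup σ i)) i
  forth-onto : ∀ σ → autᵇ H σ ≡ true → Onto (forth σ) ≡ true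
  forth-onto σ r = ∧-intro (homᵇ-complete H G (forth σ) f-hom) (⌊⌋-complete (image H f ≟ˢ S) (subgraph-ext
    (λ v → Bool-ext (V→ v) (V← v)) (λ u v → Bool-ext (E→ u v) (E← u v))))
    where
    f : Fin h → Fin n
    f = lookup (forth σ)
    σ-aut : IsAut H (lookup σ)
    σ-aut = ⌊⌋-sound (isAut? H (lookup σ)) r
    f-E : ∀ i j → H i j ≡ inE S (f i) (f j)
    f-E i j = trans (sym (proj₂ (proj₂ σ-aut) i j)) (trans (e-E _ _) (sym (cong₂ (inE S) (l σ i) (l σ j))))
    f-hom : IsHom H G f
    f-hom = mkHom (λ i j eq → proj₁ σ-aut i j (e-inj (trans (sym (l σ i)) (trans eq (l σ j)))))
                  (λ i j Hij → proj₂ (proj₂ (sub (f i) (f j) (trans (sym (f-E i j)) Hij))))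
    reach : ∀ v → inV S v ≡ true → ∃ λ i → f i ≡ v
    reach v p = let (j , ej) = e-onto v p ; (i , σi) = proj₁ (proj₂ σ-aut) j in i , trans (l σ i) (trans (cong e σi) ej)
    V→ : ∀ v → inV (image H f) v ≡ true → inV S v ≡ true
    V→ v p = let (i , fi) = inV-image-elim H f v p in subst (λ t → inV S t ≡ true) (trans (sym (l σ i)) fi) (e-V (lookup σ i))
    V← : ∀ v → inV S v ≡ true → inV (image H f) v ≡ true
    V← v p = let (i , fi) = reach v p in subst (λ t → inV (image H f) t ≡ true) fi (inV-image-intro H f i)
    E→ : ∀ u v → inE (image H f) u v ≡ true → inE S u v ≡ true
    E→ u v p = let (i , j , fi , fj , Hij) = inE-image-elim H f u v p in subst₂ (λ s t → inE S s t ≡ true) fi fj (trans (sym (f-E i j)) Hij)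
    E← : ∀ u v → inE S u v ≡ true → inE (image H f) u v ≡ true
    E← u v p with sub u v p
    ... | pu , pv , _ with reach u pu | reach v pv
    ... | i , refl | j , refl = inE-image-intro H f i j (trans (f-E i j) p)
  forth-inj : ∀ σ τ → autᵇ H σ ≡ true → autᵇ H τ ≡ true → forth σ ≡ forth τ → σ ≡ τ
  forth-inj σ τ _ _ eq = Vec-ext λ i → e-inj (trans (sym (l σ i)) (trans (cong (λ t → lookup t i) eq) (l τ i)))

copy-image : ∀ {h n} (H : Graph h) (G : Graph n) (S : SubgraphData n) → IsSimple H → IsCopy H G S →
  ∃ λ f → IsHom H G (lookup f) × image H (lookup f) ≡ S
copy-image {h} H G S H-simple copy =
  let (f , pos) = ∑V-pos h (λ f → 𝟙 (homᵇ H G f ∧ ⌊ image H (lookup f) ≟ˢ S ⌋)) (subst (0 <_) (sym (embeddings-onto H G S H-simple copy)) (aut>0 H))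
      (p , q)   = ∧-true {homᵇ H G f} (𝟙-pos pos)
  in f , homᵇ-sound H G f p , ⌊⌋-sound (image H (lookup f) ≟ˢ S) q

sumL : ∀ {A : Set} → (A → ℕ) → List A → ℕ
sumL φ L = ListAction.sum (List.map φ L)

sumL-indicator : ∀ {n} {S : SubgraphData n} {L} → Unique L → S ∈ L → sumL (λ T → 𝟙 ⌊ S ≟ˢ T ⌋) L ≡ 1
sumL-indicator {S = S} {T ∷ L} (fresh ∷ unique) (here refl) =
  cong₂ _+_ (cong 𝟙 (⌊⌋-complete (S ≟ˢ S) refl)) (none L fresh)
  where
  none : ∀ L → All (S ≢_) L → sumL (λ T → 𝟙 ⌊ S ≟ˢ T ⌋) L ≡ 0
  none []      []        = refl
  none (T ∷ L) (ne ∷ nes) = cong₂ _+_ (cong 𝟙 (⌊⌋-refute (S ≟ˢ T) ne)) (none L nes)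
sumL-indicator {S = S} {T ∷ L} (fresh ∷ unique) (there S∈L) =
  cong₂ _+_ (cong 𝟙 (⌊⌋-refute (S ≟ˢ T) λ eq → All.lookup fresh S∈L (sym eq))) (sumL-indicator unique S∈L)

∑V-sumL : ∀ {A : Set} {n} h (φ : A → Vec (Fin n) h → ℕ) L → ∑V h (λ v → sumL (λ x → φ x v) L) ≡ sumL (λ x → ∑V h (φ x)) L
∑V-sumL {n = n} h φ []      = trans (∑V-const {n} h 0) (*-zeroʳ (n ^ h))
∑V-sumL h φ (x ∷ L) = trans (∑V-+ h (φ x) (λ v → sumL (λ x → φ x v) L)) (cong (∑V h (φ x) +_) (∑V-sumL h φ L))

-- Embeddings are sorted by their image, which occurs exactly once in `L`; each fibre has `aut H`
-- elements.
emb-copies : ∀ {h n} (H : Graph h) (G : Graph n) k → IsSimple H → NumCopies H G k → emb H G ≡ k * aut H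
emb-copies {h} H G k H-simple (L , unique , copies , complete , refl) = begin
  emb H G
    ≡⟨ ∑V-cong h (λ f → classify f (homᵇ H G f) refl) ⟩
  ∑V h (λ f → sumL (λ S → 𝟙 (homᵇ H G f ∧ ⌊ image H (lookup f) ≟ˢ S ⌋)) L)
    ≡⟨ ∑V-sumL h (λ S f → 𝟙 (homᵇ H G f ∧ ⌊ image H (lookup f) ≟ˢ S ⌋)) L ⟩
  sumL (λ S → ∑V h (λ f → 𝟙 (homᵇ H G f ∧ ⌊ image H (lookup f) ≟ˢ S ⌋))) L
    ≡⟨ const L copies ⟩
  length L * aut H  ∎
  where
  open ≡-Reasoning
  sumL-zero : ∀ {A : Set} (L : List A) → sumL (λ _ → 0) L ≡ 0
  sumL-zero []      = refl
  sumL-zero (_ ∷ L) = sumL-zero L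
  classify : ∀ f b → homᵇ H G f ≡ b → 𝟙 b ≡ sumL (λ S → 𝟙 (b ∧ ⌊ image H (lookup f) ≟ˢ S ⌋)) L
  classify f false _ = sym (sumL-zero L)
  classify f true  r = sym (sumL-indicator unique (complete _ (image-isCopy H G (lookup f) H-simple (homᵇ-sound H G f r))))
  const : ∀ L → All (IsCopy H G) L → sumL (λ S → ∑V h (λ f → 𝟙 (homᵇ H G f ∧ ⌊ image H (lookup f) ≟ˢ S ⌋))) L ≡ length L * aut H
  const []      []       = refl
  const (S ∷ L) (c ∷ cs) = cong₂ _+_ (embeddings-onto H G S H-simple c) (const L cs)

allVec : ∀ n h → List (Vec (Fin n) h)
allVec n zero    = [] ∷ []
allVec n (suc h) = cartesianProductWith _∷_ (allFin n) (allVec n h)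

∈-allVec : ∀ {n h} (v : Vec (Fin n) h) → v ∈ allVec n h
∈-allVec []      = here refl
∈-allVec (x ∷ v) = ∈-cartesianProductWith⁺ _∷_ (∈-allFin x) (∈-allVec v)

count : ∀ {A : Set} (_≟ᴬ_ : (x y : A) → Dec (x ≡ y)) (P : A → Set) (xs : List A) →
  (∀ a → a ∈ xs → P a) → (∀ a → P a → a ∈ xs) → Σ ℕ (HasCount P)
count _≟ᴬ_ P xs sound complete =
  length ys , ys , UniqueDec.deduplicate-! _≟ᴬ_ xs , All.tabulate (λ a∈ → sound _ (∈-deduplicate⁻ _≟ᴬ_ xs a∈)) ,
  (λ a p → ∈-deduplicate⁺ _≟ᴬ_ (complete a p)) , refl
  where
  ys = deduplicate _≟ᴬ_ xs

numCopies : ∀ {h n} (H : Graph h) (G : Graph n) → IsSimple H → Σ ℕ (NumCopies H G)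
numCopies {h} {n} H G H-simple = count _≟ˢ_ (IsCopy H G) images sound complete
  where
  hom? : (v : Vec (Fin n) h) → Dec (IsHom H G (lookup v))
  hom? v = isHom? H G (lookup v)
  img : Vec (Fin n) h → SubgraphData n
  img v = image H (lookup v)
  images : List (SubgraphData n)
  images = List.map img (filter hom? (allVec n h))
  sound : ∀ S → S ∈ images → IsCopy H G S
  sound S S∈ = let (v , v∈ , S≡) = ∈-map⁻ img {xs = filter hom? (allVec n h)} S∈
               in subst (IsCopy H G) (sym S≡) (image-isCopy H G (lookup v) H-simple (proj₂ (∈-filter⁻ hom? {xs = allVec n h} v∈)))
  complete : ∀ S → IsCopy H G S → S ∈ images
  complete S copy = let (v , v-hom , eq) = copy-image H G S H-simple copy
                    in subst (_∈ images) eq (∈-map⁺ img (∈-filter⁺ hom? (∈-allVec v) v-hom))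

-- Cuts as `Kab`, freeness, and the best part sizes

-- Matches the convention of `Kab`, whose first part comes first: recursively, a `true` vertex is
-- put at the front and a `false` one at the end.
relabel : ∀ {n} (σ : Fin n → Bool) → Σ (Fin n → Fin (# σ + # (not ∘ σ))) λ π →
  (∀ i j → π i ≡ π j → i ≡ j) × (∀ i → (toℕ (π i) <ᵇ # σ) ≡ σ i)
relabel {zero}  σ = (λ ()) , (λ ()) , (λ ())
relabel {suc n} σ with σ zero in eq | relabel (σ ∘ suc)
... | true  | π , π-inj , π-side = π′ , inj , λ { zero → sym eq ; (suc i) → π-side i }
  where
  π′ : Fin (suc n) → Fin (suc (# (σ ∘ suc)) + # (not ∘ σ ∘ suc))
  π′ zero    = zero
  π′ (suc i) = suc (π i)
  inj : ∀ i j → π′ i ≡ π′ j → i ≡ j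
  inj zero    zero    _ = refl
  inj (suc i) (suc j) e = cong suc (π-inj i j (suc-injective e))
... | false | π , π-inj , π-side = (λ i → Fin.cast (sym (+-suc a b)) (π′ i)) , inj , side′
  where
  a b : ℕ
  a = # (σ ∘ suc)
  b = # (not ∘ σ ∘ suc)
  π′ : Fin (suc n) → Fin (suc (a + b))
  π′ zero    = Fin.fromℕ (a + b)
  π′ (suc i) = Fin.inject₁ (π i)
  π′-inj : ∀ i j → π′ i ≡ π′ j → i ≡ j
  π′-inj zero    zero    _ = refl
  π′-inj zero    (suc j) e = ⊥-elim (Fin.fromℕ≢inject₁ e)
  π′-inj (suc i) zero    e = ⊥-elim (Fin.fromℕ≢inject₁ (sym e))
  π′-inj (suc i) (suc j) e = cong suc (π-inj i j (Fin.inject₁-injective e))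
  inj : ∀ i j → Fin.cast (sym (+-suc a b)) (π′ i) ≡ Fin.cast (sym (+-suc a b)) (π′ j) → i ≡ j
  inj i j e = π′-inj i j (Fin.toℕ-injective (trans (sym (Fin.toℕ-cast _ (π′ i))) (trans (cong toℕ e) (Fin.toℕ-cast _ (π′ j)))))
  a+b≮a : ∀ a b → (a + b <ᵇ a) ≡ false
  a+b≮a zero    b = refl
  a+b≮a (suc a) b = a+b≮a a b
  π′-side : ∀ i → (toℕ (π′ i) <ᵇ a) ≡ σ i
  π′-side zero    = trans (cong (_<ᵇ a) (Fin.toℕ-fromℕ (a + b))) (trans (a+b≮a a b) (sym eq))
  π′-side (suc i) = trans (cong (_<ᵇ a) (Fin.toℕ-inject₁ (π i))) (π-side i)
  side′ : ∀ i → (toℕ (Fin.cast (sym (+-suc a b)) (π′ i)) <ᵇ a) ≡ σ i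
  side′ i = trans (cong (_<ᵇ a) (Fin.toℕ-cast _ (π′ i))) (π′-side i)

emb-cut≤Kab : ∀ {h n} (H : Graph h) (σ : Fin n → Bool) → emb H (cut σ) ≤ emb H (Kab (# σ) (# (not ∘ σ)))
emb-cut≤Kab H σ with relabel σ
... | π , π-inj , π-side = ∑V-injection (homᵇ H (cut σ)) (homᵇ H K) (Vec.map π) keeps
    λ v w _ _ e → Vec-ext λ i → π-inj _ _ (trans (sym (Vec.lookup-map i π v)) (trans (cong (λ t → lookup t i) e) (Vec.lookup-map i π w)))
  where
  K = Kab (# σ) (# (not ∘ σ))
  keeps : ∀ v → homᵇ H (cut σ) v ≡ true → homᵇ H K (Vec.map π v) ≡ true
  keeps v r = homᵇ-complete H K (Vec.map π v) (mkHom
    (λ i j e → IsHom.inj v-hom i j (π-inj _ _ (trans (sym (Vec.lookup-map i π v)) (trans e (Vec.lookup-map j π v)))))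
    (λ i j Hij → trans (cong₂ K (Vec.lookup-map i π v) (Vec.lookup-map j π v))
                  (trans (cong₂ _xor_ (π-side (lookup v i)) (π-side (lookup v j))) (IsHom.hom v-hom i j Hij))))
    where
    v-hom = homᵇ-sound H (cut σ) v r

Kab-simple : ∀ a b → IsSimple (Kab a b)
Kab-simple a b = (λ i j → xor-comm (toℕ i <ᵇ a) (toℕ j <ᵇ a)) , λ i → xor-same (toℕ i <ᵇ a)

Kab-free : ∀ {f} (F : Graph f) a b → IsSimple F → ChromaticNumber F 3 → Free F (Kab a b)
Kab-free F a b F-simple χF (S , copy) =
  let (v , v-hom , _) = copy-image F (Kab a b) S F-simple copy
  in 2-colouring⇒χ≢3 F χF (λ i → toℕ (lookup v i) <ᵇ a) λ i j e eq →
       case trans (sym (IsHom.hom v-hom i j e)) (trans (cong (_xor (toℕ (lookup v j) <ᵇ a)) eq) (xor-same (toℕ (lookup v j) <ᵇ a))) of λ ()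

argmax : (v : ℕ → ℕ) (m : ℕ) → Σ ℕ λ a → 1 ≤ a × a ≤ suc m × (∀ a′ → 1 ≤ a′ → a′ ≤ suc m → v a′ ≤ v a)
argmax v zero = 1 , ≤-refl , ≤-refl , λ a′ 1≤a′ a′≤1 → ≤-reflexive (cong v (≤-antisym a′≤1 1≤a′))
argmax v (suc m) with argmax v m
... | a , 1≤a , a≤m , best with ≤-total (v a) (v (suc (suc m)))
...   | inj₁ va≤ = suc (suc m) , s≤s z≤n , ≤-refl , λ a′ 1≤a′ a′≤ → case m≤n⇒m<n∨m≡n a′≤ of λ where
        (inj₁ a′<)   → ≤-trans (best a′ 1≤a′ (≤-pred a′<)) va≤
        (inj₂ refl) → ≤-refl
...   | inj₂ ≤va = a , 1≤a , m≤n⇒m≤1+n a≤m , λ a′ 1≤a′ a′≤ → case m≤n⇒m<n∨m≡n a′≤ of λ where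
        (inj₁ a′<)   → best a′ 1≤a′ (≤-pred a′<)
        (inj₂ refl) → ≤va

bestKab : ∀ {h} (H : Graph h) n → 2 ≤ n → Σ ℕ λ a → Σ ℕ λ b → 1 ≤ a × 1 ≤ b × a + b ≡ n ×
  (∀ a′ b′ → 1 ≤ a′ → 1 ≤ b′ → a′ + b′ ≡ n → emb H (Kab a′ b′) ≤ emb H (Kab a b))
bestKab H (suc zero) (s≤s ())
-- For `n = suc (suc m)` the range from 1 to `suc m` is exactly the one with both parts nonempty.
bestKab H (suc (suc m)) _ with argmax (λ a → emb H (Kab a (suc (suc m) ∸ a))) m
... | a , 1≤a , a≤m , best = a , suc (suc m) ∸ a , 1≤a , m<n⇒0<n∸m (s≤s a≤m) , m+[n∸m]≡n (m≤n⇒m≤1+n a≤m) , compare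
  where
  compare : ∀ a′ b′ → 1 ≤ a′ → 1 ≤ b′ → a′ + b′ ≡ suc (suc m) → emb H (Kab a′ b′) ≤ emb H (Kab a (suc (suc m) ∸ a))
  compare a′ (suc b′) 1≤a′ _ eq = subst (λ t → emb H (Kab a′ t) ≤ emb H (Kab a (suc (suc m) ∸ a))) b′≡
      (best a′ 1≤a′ (≤-pred (≤-trans (≤-trans (s≤s (m≤m+n a′ b′)) (≤-reflexive (sym (+-suc a′ b′)))) (≤-reflexive eq))))
    where
    b′≡ : suc (suc m) ∸ a′ ≡ suc b′
    b′≡ = trans (cong (_∸ a′) (sym eq)) (m+n∸m≡n a′ (suc b′))

-- Assembly: the colouring of `H`, the constants, the extremal number

-- The colouring is normalised at the first left vertex `i₀` of the biclique. Adjacency then forces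
-- `false` on the right and, through `right₀`, `true` on the left, so vertices of `K` with different
-- colours lie on different sides and are joined.
dominatingBiclique : ∀ {h} (H : Graph h) → Colorable H 2 →
  (Σ ℕ λ s → Σ ℕ λ t → 1 ≤ s × 1 ≤ t × Σ (SubgraphData h) λ K → IsCopy (Kab s t) H K ×
    (∀ v → ∃ λ w → inV K w ≡ true × H v w ≡ true)) → DominatingBiclique H
dominatingBiclique {h} H (col , col-proper)
  (suc s , suc t , _ , _ , K , ((_ , sub) , φ , φ-inj , φ-V , φ-onto , φ-E) , dominates) = record
  { bipartite  = record { χ = χ ; proper = proper ; i₀ = i₀ ; j₀ = proj₁ (dominates i₀) ; i₀j₀-edge = proj₂ (proj₂ (dominates i₀)) }
  ; κ          = inV K
  ; κ-complete = complete
  ; nb         = λ v → proj₁ (dominates v)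
  ; κ-nb       = λ v → proj₁ (proj₂ (dominates v))
  ; nb-edge    = λ v → proj₂ (proj₂ (dominates v))
  ; χi₀        = norm (fin2 (col i₀)) }
  where
  i₀ : Fin h
  i₀ = φ zero
  χ : Fin h → Bool
  χ i = not (fin2 (col i₀)) xor fin2 (col i)
  norm : ∀ b → not b xor b ≡ true
  norm true  = refl
  norm false = refl
  xor-≢ : ∀ a b c → b ≢ c → (a xor b) xor (a xor c) ≡ true
  xor-≢ a     true  true  ne = ⊥-elim (ne refl)
  xor-≢ a     false false ne = ⊥-elim (ne refl)
  xor-≢ true  true  false _  = refl
  xor-≢ true  false true  _  = refl
  xor-≢ false true  false _  = refl
  xor-≢ false false true  _  = refl
  proper : ∀ i j → H i j ≡ true → χ i xor χ j ≡ true
  proper i j e = xor-≢ (not (fin2 (col i₀))) (fin2 (col i)) (fin2 (col j)) (λ eq → col-proper i j e (fin2-inj _ _ eq))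
  left : Fin (suc s + suc t) → Bool
  left x = toℕ x <ᵇ suc s
  edge : ∀ x y → left x xor left y ≡ true → H (φ x) (φ y) ≡ true
  edge x y e = proj₂ (proj₂ (sub (φ x) (φ y) (trans (sym (φ-E x y)) e)))
  right₀ : Fin (suc s + suc t)
  right₀ = suc s Fin.↑ʳ zero
  right₀-left : left right₀ ≡ false
  right₀-left = trans (cong (_<ᵇ suc s) (Fin.toℕ-↑ʳ (suc s) (zero {t}))) (n≮ s)
    where
    n≮ : ∀ s → (s + 0 <ᵇ s) ≡ false
    n≮ zero    = refl
    n≮ (suc s) = n≮ s
  χ-right : ∀ x → left x ≡ false → χ (φ x) ≡ false
  χ-right x e = trans (xor≡true {χ i₀} (proper i₀ (φ x) (edge zero x (cong not e)))) (cong not (norm (fin2 (col i₀))))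
  χ-left : ∀ x → left x ≡ true → χ (φ x) ≡ true
  χ-left x e = trans (xor≡true {χ (φ right₀)} (proper (φ right₀) (φ x) (edge right₀ x (cong₂ _xor_ right₀-left e)))) (cong not (χ-right right₀ right₀-left))
  complete : ∀ i j → inV K i ≡ true → inV K j ≡ true → χ i ≡ true → χ j ≡ false → H i j ≡ true
  complete i j κi κj χi χj with φ-onto i κi | φ-onto j κj
  ... | x , refl | y , refl with left x in ex | left y in ey
  ...   | true  | false = edge x y (cong₂ _xor_ ex ey)
  ...   | false | _     with () ← trans (sym χi) (χ-right x ex)
  ...   | true  | true  with () ← trans (sym (χ-left y ey)) χj

suc-pred-pos : ∀ {m} → 0 < m → m ≡ suc (pred m)
suc-pred-pos {suc m} _ = refl

record Large (h f c₀ g c ℓ K n : ℕ) : Set where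
  field
    ≥2    : 2 ≤ n
    ≥4c   : 4 * c ≤ n
    ≥4g   : 2 * (2 * g) * (h + 2) ≤ n
    ≥16g  : 16 * g ≤ n
    ≥book₁ : book-n₀ f (2 * c) ≤ n
    ≥book₂ : book-n₀ f (4 * g) ≤ n
    ≥tri  : tri-n₀ f K ≤ n
    ≥D    : 2 * (4 * c₀ * ℓ) * (h * h * c₀) ≤ n

max : List ℕ → ℕ
max = List.foldr _⊔_ 0

∈⇒≤max : ∀ {x} {L : List ℕ} → x ∈ L → x ≤ max L
∈⇒≤max {x} {_ ∷ L} (here refl) = m≤m⊔n x (max L)
∈⇒≤max {x} {y ∷ L} (there x∈)  = ≤-trans (∈⇒≤max x∈) (m≤n⊔m y (max L))

threshold : ∀ h f c₀ g c ℓ K → Σ ℕ λ n₀ → ∀ n → n₀ ≤ n → Large h f c₀ g c ℓ K n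
threshold h f c₀ g c ℓ K = max bounds , λ n N≤n → record
  { ≥2    = ≤-trans (∈⇒≤max {L = bounds} (here refl)) N≤n
  ; ≥4c   = ≤-trans (∈⇒≤max {L = bounds} (there (here refl))) N≤n
  ; ≥4g   = ≤-trans (∈⇒≤max {L = bounds} (there (there (here refl)))) N≤n
  ; ≥16g  = ≤-trans (∈⇒≤max {L = bounds} (there (there (there (here refl))))) N≤n
  ; ≥book₁ = ≤-trans (∈⇒≤max {L = bounds} (there (there (there (there (here refl)))))) N≤n
  ; ≥book₂ = ≤-trans (∈⇒≤max {L = bounds} (there (there (there (there (there (here refl))))))) N≤n
  ; ≥tri  = ≤-trans (∈⇒≤max {L = bounds} (there (there (there (there (there (there (here refl)))))))) N≤n
  ; ≥D    = ≤-trans (∈⇒≤max {L = bounds} (there (there (there (there (there (there (there (here refl))))))))) N≤n }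
  where
  bounds : List ℕ
  bounds = 2 ∷ 4 * c ∷ 2 * (2 * g) * (h + 2) ∷ 16 * g ∷ book-n₀ f (2 * c) ∷ book-n₀ f (4 * g) ∷ tri-n₀ f K ∷ 2 * (4 * c₀ * ℓ) * (h * h * c₀) ∷ []

-- Inside the continuation y does not reduce, so that the large constants are never unfolded.
named : {A B : Set} (x : A) → (∀ y → y ≡ x → B) → B
named x k = k x refl

emb≤bestKab : ∀ {h f} (H : Graph h) (F : Graph f) → IsSimple F → DominatingBiclique H → CriticalColouring F →
  Σ ℕ λ n₀ → ∀ n → n₀ ≤ n → 2 ≤ n × (∀ (G : Graph n) → IsSimple G → Free F G → ∀ M →
    (∀ a b → 1 ≤ a → 1 ≤ b → a + b ≡ n → emb H (Kab a b) ≤ M) → emb H G ≤ M)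
emb≤bestKab {h} {f} H F F-simple dom cc =
  named (3 ^ (suc p + suc q)) λ c₀ c₀≡ →
  named (2 * (4 * c₀)) λ g g≡ →
  named (cutConst h (2 * g)) λ C C≡ →
  named (8 * g) λ e e≡ →
  named (4 * e * C + 4 * g) λ c c≡ →
  named (4 * c) λ b b≡ →
  named (5 * b * C * c + g) λ ℓ ℓ≡ →
  named (4 * (4 * c₀ * ℓ) * (ℓ * ℓ) * c₀ + 2 * ℓ) λ K K≡ →
  let (n₀ , large) = threshold h f c₀ g c ℓ K in
  n₀ , λ n n₀≤n → Large.≥2 (large n n₀≤n) , λ G G-simple G-free M Kab≤M →
    let open Large (large n n₀≤n) in
    UpperBound.emb≤M dom p q p≡ q≡ f c₀ g C e c b ℓ K c₀≡ g≡ C≡ e≡ c≡ b≡ ℓ≡ K≡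
      G G-simple (free⇒noBook F G F-simple G-simple cc G-free) ≥2 ≥4c ≥4g ≥16g ≥book₁ ≥book₂ ≥tri ≥D M
      (λ σ pos pos′ → ≤-trans (emb-cut≤Kab H σ) (Kab≤M (# σ) (# (not ∘ σ)) pos pos′ (#-not σ)))
  where
  open DominatingBiclique dom
  p q : ℕ
  p = pred (# χ)
  q = pred (# (not ∘ χ))
  p≡ : # χ ≡ suc p
  p≡ = suc-pred-pos (≤-trans (true⇒1≤𝟙 χi₀) (term≤sum (𝟙 ∘ χ) i₀))
  q≡ : # (not ∘ χ) ≡ suc q
  q≡ = suc-pred-pos (≤-trans (true⇒1≤𝟙 (cong not χj₀)) (term≤sum (𝟙 ∘ not ∘ χ) j₀))

-- Multiplication by the positive number `aut H` turns the comparison of copies into one of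
-- embeddings.
Kab-extremal : ∀ {h f n} (H : Graph h) (F : Graph f) → IsSimple H → IsSimple F → ChromaticNumber F 3 →
  ∀ a b → a + b ≡ n → (∀ (G : Graph n) → IsSimple G → Free F G → emb H G ≤ emb H (Kab a b)) →
  ∀ m → NumCopies H (Kab a b) m → IsEx n H F m
Kab-extremal H F H-simple F-simple χF a b refl most m m-copies =
  (Kab a b , Kab-simple a b , Kab-free F a b F-simple χF , m-copies) ,
  λ G G-simple G-free k k-copies → *-cancelʳ-≤ k m (aut H) {{>-nonZero (aut>0 H)}}
    (subst₂ _≤_ (emb-copies H G k H-simple k-copies) (emb-copies H (Kab a b) m H-simple m-copies) (most G G-simple G-free))

theorem1 : ∀ {h f} (H : Graph h) (F : Graph f) →
    IsSimple H → IsSimple F →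
    Colorable H 2 →
    (Σ ℕ λ s → Σ ℕ λ t → 1 ≤ s × 1 ≤ t ×
    Σ (SubgraphData h) λ K → IsCopy (Kab s t) H K ×
    (∀ (v : Fin h) → ∃ λ w → inV K w ≡ true × H v w ≡ true)) →
    ChromaticNumber F 3 → HasColorCriticalEdge F →
    Σ ℕ λ n₀ → ∀ n → n₀ ≤ n →
    Σ ℕ λ a → Σ ℕ λ b → 1 ≤ a × 1 ≤ b × a + b ≡ n ×
    Σ ℕ λ m → NumCopies H (Kab a b) m × IsEx n H F m
theorem1 H F H-simple F-simple H-col K-dom χF crit =
  let (n₀ , bound) = emb≤bestKab H F F-simple (dominatingBiclique H H-col K-dom) (criticalColouring F F-simple χF crit)
  in n₀ , λ n n₀≤n →
    let (2≤n , emb≤)                          = bound n n₀≤n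
        (a , b , 1≤a , 1≤b , a+b≡n , best) = bestKab H n 2≤n
        (m , m-copies)                        = numCopies H (Kab a b) H-simple
    in a , b , 1≤a , 1≤b , a+b≡n , m , m-copies ,
       Kab-extremal H F H-simple F-simple χF a b a+b≡n (λ G G-simple G-free → emb≤ G G-simple G-free (emb H (Kab a b)) best) m m-copies
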